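{- Let $\Gamma$ be a simple graph of order $n>0$ with vertex set $V$ and $c$ connected components, let $\mathfrak{G}$ be a finite group of order $\gamma>0$, let $X\subseteq V$ be any set, and let $\zeta$ be the number of isolated vertices of $\Gamma$ that are not in $X$. Then for each $i=0,1,\dots,n-\zeta$, the signless Whitney number $\bar w_i(\mathfrak{G}\cdot\Gamma^{(X)})$ is a polynomial function of $\gamma$ of degree $\min(i,n-c)$; specifically, $$\bar w_i(\mathfrak{G}\cdot\Gamma^{(X)})=\sum_{j=0}^{i}\gamma^j\sum_{k=0}^{i-j}(-1)^k\binom{n-j-k}{n-i}\sum_{\substack{Y\subseteq V\setminus X\ \text{stable}\\ |Y|=k}}\bar w_j(\Gamma\setminus Y)$$ for $i\le n-\zeta$, while $\bar w_i(\mathfrak{G}\cdot\Gamma^{(X)})=0$ for $i>n-\zeta$. The leading term is $\bar w_i(\Gamma)\gamma^i$ if $i\le n-c$, and is $\bar w_{n-c}(\Gamma)\binom{c-\zeta}{i-(n-c)}\gamma^{n-c}$ if $n-c\le i\le n-\zeta$.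
   Context: A gain graph $\Phi$ over a group $\mathfrak{G}$ consists of a graph (possibly with half edges, i.e. edges with only one endpoint) on vertex set $V$, $|V|=n$, together with a map $\phi$ assigning to each oriented (ordinary) edge an element of $\mathfrak{G}$ such that reversing the orientation inverts the gain. The gain of a circle $C=e_1e_2\cdots e_l$ (traversed in a direction) is $\phi(e_1)\cdots\phi(e_l)$; $C$ is neutral if this is the identity. An edge set is balanced if it contains no half edges and every circle in it is neutral. For $S\subseteq E(\Phi)$, $b(S)$ denotes the number of connected components of the spanning subgraph $(V,S)$ whose edge sets are balanced. The chromatic polynomial is $\chi_\Phi(\lambda)=\sum_{S\subseteq E(\Phi)}(-1)^{|S|}\lambda^{b(S)}$, the signless chromatic polynomial is $\bar\chi_\Phi(\lambda)=(-1)^n\chi_\Phi(-\lambda)$, and the signless Whitney numbers $\bar w_i(\Phi)$ are defined by $\bar\chi_\Phi(\lambda)=\sum_{i=0}^{n}\bar w_i(\Phi)\lambda^{n-i}$. For an ordinary graph $\Delta$ of order $m$, $\bar w_j(\Delta)$ is defined from its usual chromatic polynomial by $(-1)^m\chi_\Delta(-\lambda)=\sum_j\bar w_j(\Delta)\lambda^{m-j}$. The $\mathfrak{G}$-expansion $\mathfrak{G}\cdot\Gamma$ of a graph $\Gamma=(V,E)$ is the gain graph on $V$ having, for each edge $e\in E$ (with a fixed orientation) and each $g\in\mathfrak{G}$, an edge $ge$ with the same endpoints and gain $g$ in that orientation. For $X\subseteq V$, $\mathfrak{G}\cdot\Gamma^{(X)}$ is $\mathfrak{G}\cdot\Gamma$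 with one half edge added at each vertex of $X$. A vertex set is stable if no edge of $\Gamma$ has both endpoints in it (the empty set is stable). $\Gamma\setminus Y$ denotes the graph obtained by deleting the vertices in $Y$ and their incident edges. -}

module Defs where

open import Level using (Level; _⊔_)
open import Data.Bool using (Bool; true; false; if_then_else_; _∧_; _∨_; not)
open import Data.Nat using (ℕ; zero; suc; _+_; _∸_; _≡ᵇ_; _<ᵇ_; _^_; _≤_)
open import Data.Nat.Combinatorics using (_C_)
open import Data.Integer using (ℤ; +_; -_) renaming (_+_ to _+ℤ_; _*_ to _*ℤ_)
open import Data.Fin using (Fin; toℕ)
open import Data.Fin.Subset using (Subset; ∣_∣)
open import Data.Vec using (Vec; []; _∷_) renaming (lookup to vlookup)
open import Data.List using (List; []; _∷_; map; _++_; length; lookup; concatMap; allFin; foldr; upTo; filter)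
open import Data.Bool.ListAction using (and)
open import Data.List.Membership.Propositional using (_∈_)
open import Data.List.Relation.Unary.Unique.Propositional using (Unique)
open import Data.Product using (Σ; ∃; _×_; _,_)
open import Data.Sum using (_⊎_)
open import Relation.Binary.PropositionalEquality using (_≡_)
open import Relation.Nullary using (¬_)
open import Algebra.Bundles using (Group)

sgn : ℕ → ℤ
sgn zero = + 1
sgn (suc k) = - sgn k

sumℤ : List ℤ → ℤ
sumℤ = foldr _+ℤ_ (+ 0)

sumTo : ℕ → (ℕ → ℤ) → ℤ
sumTo i f = sumℤ (map f (upTo (suc i)))

-- all subsets of a list, i.e. all subsets of the POSITIONS of the list
-- (a list of edges is a finite edge multiset; each edge occurrence is
-- chosen in or out independently)
sublists : ∀ {a} {A : Set a} → List A → List (List A)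
sublists [] = [] ∷ []
sublists (x ∷ xs) = map (x ∷_) (sublists xs) ++ sublists xs

allSubsets : (n : ℕ) → List (Subset n)
allSubsets zero = [] ∷ []
allSubsets (suc n) = map (true ∷_) (allSubsets n) ++ map (false ∷_) (allSubsets n)

module Ordinary {V : Set} where

  data OWalk (S : List (V × V)) : V → V → Set where
    here : ∀ {x} → OWalk S x x
    step : ∀ {x y z} → ((x , y) ∈ S ⊎ (y , x) ∈ S) → OWalk S y z → OWalk S x z

  CompCount : List (V × V) → ℕ → Set
  CompCount S k =
    Σ (Fin k → V) λ r →
      (∀ i j → OWalk S (r i) (r j) → i ≡ j) ×
      (∀ v → ∃ λ i → OWalk S v (r i))

  -- Signless Whitney numbers of the ordinary graph (V, Es) of order m,
  -- given the component-count function b (b S = number of components of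
  -- (V,S)).  χ_Δ(λ) = Σ_S (-1)^|S| λ^{b(S)} (Whitney's expansion), hence
  -- the coefficient of λ^{m-j} in (-1)^m χ_Δ(-λ) is
  --   (-1)^j Σ_{S, b(S) = m - j} (-1)^{|S|}.
  ordWhitney : (m : ℕ) → (Es : List (V × V)) → (b : List (V × V) → ℕ) → ℕ → ℤ
  ordWhitney m Es b j =
    sgn j *ℤ sumℤ (map (λ S → if (b S + j) ≡ᵇ m then sgn (length S) else + 0) (sublists Es))

module Gain {c ℓ : Level} (G : Group c ℓ) (V : Set) where
  open Group G renaming (Carrier to Gr)

  -- an edge is a half edge at a vertex, or a link x → y with gain g
  -- in the orientation x → y (gain g⁻¹ in the orientation y → x)
  data Edge : Set c where
    half : V → Edge
    link : V → V → Gr → Edge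

  data Step (S : List Edge) : V → V → Gr → Set c where
    fwd : ∀ {x y g} (e : Fin (length S)) → lookup S e ≡ link x y g → Step S x y g
    bwd : ∀ {x y g} (e : Fin (length S)) → lookup S e ≡ link y x g → Step S x y (g ⁻¹)

  stepEdge : ∀ {S x y g} → Step S x y g → Fin (length S)
  stepEdge (fwd e _) = e
  stepEdge (bwd e _) = e

  data Walk (S : List Edge) : V → V → Set c where
    []  : ∀ {x} → Walk S x x
    _∷_ : ∀ {x y z g} → Step S x y g → Walk S y z → Walk S x z

  walkGain : ∀ {S x y} → Walk S x y → Gr
  walkGain [] = ε
  walkGain (_∷_ {g = g} s w) = g ∙ walkGain w

  walkEdges : ∀ {S x y} → Walk S x y → List (Fin (length S))
  walkEdges [] = []
  walkEdges (s ∷ w) = stepEdge s ∷ walkEdges w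

  walkVerts : ∀ {S x y} → Walk S x y → List V
  walkVerts [] = []
  walkVerts (_∷_ {x = x} s w) = x ∷ walkVerts w

  IsCircle : ∀ {S x} → Walk S x x → Set
  IsCircle w = (1 ≤ length (walkEdges w)) × Unique (walkEdges w) × Unique (walkVerts w)

  BalancedComp : List Edge → V → Set (c ⊔ ℓ)
  BalancedComp S v =
    (∀ w → Walk S v w → ¬ (half w ∈ S)) ×
    (∀ w (C : Walk S w w) → Walk S v w → IsCircle C → walkGain C ≈ ε)

  BalCount : List Edge → ℕ → Set (c ⊔ ℓ)
  BalCount S k =
    Σ (Fin k → V) λ r →
      (∀ i j → Walk S (r i) (r j) → i ≡ j) ×
      (∀ i → BalancedComp S (r i)) ×
      (∀ v → BalancedComp S v → ∃ λ i → Walk S v (r i))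

  -- Signless Whitney numbers of the gain graph (V, Es) of order n, given
  -- b.  χ̄_Φ(λ) = (-1)^n Σ_S (-1)^|S| (-λ)^{b(S)}, so the coefficient of
  -- λ^{n-i} is (-1)^i Σ_{S, b(S) = n - i} (-1)^{|S|}.
  gainWhitney : (n : ℕ) → (Es : List Edge) → (b : List Edge → ℕ) → ℕ → ℤ
  gainWhitney n Es b i =
    sgn i *ℤ sumℤ (map (λ S → if (b S + i) ≡ᵇ n then sgn (length S) else + 0) (sublists Es))

record SimpleGraph (n : ℕ) : Set where
  field
    adj    : Fin n → Fin n → Bool
    sym    : ∀ u v → adj u v ≡ adj v u
    irrefl : ∀ v → adj v v ≡ false
open SimpleGraph public

edgesOf : ∀ {n} → SimpleGraph n → List (Fin n × Fin n)
edgesOf {n} Γ =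
  concatMap (λ u → concatMap (λ v →
    if (toℕ u <ᵇ toℕ v) ∧ adj Γ u v then (u , v) ∷ [] else []) (allFin n)) (allFin n)

zetaOf : ∀ {n} → SimpleGraph n → Subset n → ℕ
zetaOf {n} Γ X =
  length (filter (λ v → Data.Bool._≟_ (and (map (λ w → not (adj Γ v w)) (allFin n)) ∧ not (vlookup X v)) true) (allFin n))
  where import Data.Bool

stableOutsideᵇ : ∀ {n} → SimpleGraph n → Subset n → Subset n → Bool
stableOutsideᵇ {n} Γ X Y =
  and (map (λ u → not (vlookup Y u ∧ vlookup X u) ∧
         and (map (λ v → not (vlookup Y u ∧ vlookup Y v ∧ adj Γ u v)) (allFin n))) (allFin n))

VMinus : ∀ {n} → Subset n → Set
VMinus {n} Y = Σ (Fin n) λ v → vlookup Y v ≡ false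

restrictEdge : ∀ {n} (Y : Subset n) → Fin n × Fin n → List (VMinus Y × VMinus Y)
restrictEdge Y (u , v) with vlookup Y u in eu | vlookup Y v in ev
... | false | false = ((u , eu) , (v , ev)) ∷ []
... | false | true = []
... | true  | _ = []

edgesMinus : ∀ {n} → SimpleGraph n → (Y : Subset n) → List (VMinus Y × VMinus Y)
edgesMinus Γ Y = concatMap (restrictEdge Y) (edgesOf Γ)

expansionEdges : ∀ {c ℓ} (G : Group c ℓ) {n γ : ℕ} → (enum : Fin γ → Group.Carrier G) →
  SimpleGraph n → Subset n → List (Gain.Edge G (Fin n))
expansionEdges G {n} {γ} enum Γ X =
  concatMap (λ { (u , v) → map (λ k → Gain.link u v (enum k)) (allFin γ) }) (edgesOf Γ)
  ++ concatMap (λ x → if vlookup X x then Gain.half x ∷ [] else []) (allFin n)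

-- the γ-independent coefficient of γ^j in the formula for w̄_i:
--   Σ_{k=0}^{i-j} (-1)^k C(n-j-k, n-i) Σ_{Y ⊆ V∖X stable, |Y| = k} w̄_j(Γ∖Y)
-- where wY Y j stands for w̄_j(Γ ∖ Y).
coeff : ∀ {n} → SimpleGraph n → Subset n → (wY : Subset n → ℕ → ℤ) → ℕ → ℕ → ℤ
coeff {n} Γ X wY i j =
  sumTo (i ∸ j) λ k →
    sgn k *ℤ (+ ((n ∸ j ∸ k) C (n ∸ i)) *ℤ
      sumℤ (map (λ Y → if stableOutsideᵇ Γ X Y ∧ (∣ Y ∣ ≡ᵇ k) then wY Y j else + 0) (allSubsets n)))

{-# OPTIONS --safe #-}
-- Write λ = 1 + μ.  Expanding (1 + μ)^{b(S)} chooses a set of balanced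
-- components of S; let Y be the set of vertices outside their union.  Then Y is
-- closed under S and S is balanced outside Y.  For fixed Y the signed sum over
-- the edges inside Y vanishes unless Y is stable and disjoint from X, and
-- T ⊆ E(Γ∖Y) has γ^{n−c(T)} balanced lifts (c(T) the number of components of
-- (V,T)): adding an edge uv one by one, all gains are consistent if u and v are
-- not yet connected, and exactly one is otherwise.  Going back from μ to λ
-- gives the formula.
-- The numbers w̄_i(Γ) with i ≤ n − c are positive by deletion–contraction, and
-- deleting a non-isolated vertex of Y lowers the rank n − c of Γ, so only the
-- sets Y of isolated vertices contribute to γ^{n−c}.
module Submission where

open import Defs hiding (sym)
open import Level using (Level; _⊔_)
open import Data.Bool using (Bool; true; false; if_then_else_; _∧_; _∨_; not)
import Data.Bool as Bool
import Data.Bool.Properties as Boolₚ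
open import Data.Bool.ListAction using (and)
open import Data.Nat as ℕ using (ℕ; zero; suc; _≡ᵇ_; _<ᵇ_; _∸_; _^_)
import Data.Nat.Properties as ℕₚ
open import Data.Nat.Combinatorics using (_C_; nCk+nC[k+1]≡[n+1]C[k+1]; k>n⇒nCk≡0; nCn≡1; nCk≡nC[n∸k])
open import Data.Integer using (ℤ; +_; -_; _+_; _*_; _≤_; _<_; +≤+; +<+)
import Data.Integer.Properties as ℤₚ
open import Data.Integer.Tactic.RingSolver using (solve-∀)
open import Data.Fin as Fin using (Fin; zero; suc)
import Data.Fin.Properties as Finₚ
open import Data.Fin.Subset using (Subset; ∣_∣; ⊥)
open import Data.Fin.Subset.Properties using (∣p∣≤n; ∣⊥∣≡0)
open import Data.Vec as Vec using ([]; _∷_) renaming (lookup to vlookup)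
import Data.Vec.Properties as Vecₚ
open import Data.List using (List; []; _∷_; map; _++_; length; lookup; upTo; allFin; tabulate; concatMap; filter)
import Data.List.Properties as Listₚ
open import Data.List.Membership.Propositional using (_∈_; find; lose)
import Data.List.Membership.Propositional.Properties as ∈ₚ
open import Data.List.Relation.Unary.Any using (here; there; index)
open import Data.List.Relation.Unary.Any.Properties using (lookup-index)
open import Data.List.Relation.Unary.All as All using (All; []; _∷_)
import Data.List.Relation.Unary.All.Properties as Allₚ
open import Data.List.Relation.Unary.AllPairs using ([]; _∷_)
open import Data.List.Relation.Unary.Unique.Propositional using (Unique)
import Data.List.Relation.Unary.Unique.Propositional.Properties as Uniqueₚ
open import Data.Product using (Σ; ∃; _×_; _,_; proj₁; proj₂)
open import Data.Sum using (_⊎_; inj₁; inj₂; [_,_]′)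
open import Data.Unit using (⊤; tt)
open import Function using (_∘_; id; mk⇔; _∋_)
open import Relation.Binary.Definitions using (tri<; tri≈; tri>)
open import Relation.Binary.PropositionalEquality using (_≡_; _≢_; refl; sym; trans; cong; cong₂; subst; subst₂; module ≡-Reasoning)
open import Relation.Nullary using (Dec; yes; no; does; ¬_; contradiction)
open import Relation.Nullary.Decidable using (map′; dec-true; dec-false; _×-dec_; does-⇔)
open import Axiom.UniquenessOfIdentityProofs using (module Decidable⇒UIP)
open import Algebra.Bundles using (Group)
import Algebra.Properties.Group as GroupProperties

open Ordinary using (OWalk; here; step; CompCount)

-- Signed sums

-- The substitution pays because unbalanced components contribute nothing to `b`: they always fall
-- into the remainder `Y`, where switching an edge on or off does not change the summand. This
-- cancellation is what forces `Y` to be stable and to miss `X`. The balanced components to choose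
-- from depend on `S`; recording the remainder `Y` instead gives an index set independent of `S`, so
-- that the sums over `S` and `Y` can be exchanged.
--
-- Balance is defined by circles, which makes it awkward to decide and to extend by one edge. It is
-- therefore traded for a potential `θ` such that a link from `x` to `y` has gain `θ(x)⁻¹ θ(y)`.
-- Whether a link inside one component fits can be read off at its two ends, and a link between two
-- components always fits after a translation of `θ` on one of them.
--
-- The degree in γ cannot be read off the formula, since its coefficients are alternating sums over
-- `k`. The leading one has to be evaluated in closed form and shown to be nonzero.

private variable
  ℓ₁ ℓ₂ : Level
  𝒜 : Set ℓ₁
  ℬ : Set ℓ₂

when : Bool → ℤ → ℤ
when p x = if p then x else + 0

when-*ˡ : ∀ p x y → x * when p y ≡ when p (x * y)
when-*ˡ true  x y = refl
when-*ˡ false x y = ℤₚ.*-zeroʳ x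

when-∧ : ∀ p q x → when (p ∧ q) x ≡ when p (when q x)
when-∧ true  q x = refl
when-∧ false q x = refl

when-0 : ∀ p → when p (+ 0) ≡ + 0
when-0 true  = refl
when-0 false = refl

when-neg : ∀ p x → when p (- x) ≡ - when p x
when-neg true  x = refl
when-neg false x = refl

when-cong : ∀ p {x y} → (p ≡ true → x ≡ y) → when p x ≡ when p y
when-cong true  e = e refl
when-cong false e = refl

∑ : List 𝒜 → (𝒜 → ℤ) → ℤ
∑ L f = sumℤ (map f L)

∑-cong-∈ : (L : List 𝒜) {f g : 𝒜 → ℤ} → (∀ x → x ∈ L → f x ≡ g x) → ∑ L f ≡ ∑ L g
∑-cong-∈ []      e = refl
∑-cong-∈ (x ∷ L) e = cong₂ _+_ (e x (here refl)) (∑-cong-∈ L λ y y∈L → e y (there y∈L))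

∑-cong : (L : List 𝒜) {f g : 𝒜 → ℤ} → (∀ x → f x ≡ g x) → ∑ L f ≡ ∑ L g
∑-cong L e = ∑-cong-∈ L λ x _ → e x

∑-0 : (L : List 𝒜) → ∑ L (λ _ → + 0) ≡ + 0
∑-0 []      = refl
∑-0 (x ∷ L) = trans (ℤₚ.+-identityˡ _) (∑-0 L)

∑-zero : (L : List 𝒜) {f : 𝒜 → ℤ} → (∀ x → x ∈ L → f x ≡ + 0) → ∑ L f ≡ + 0
∑-zero L e = trans (∑-cong-∈ L e) (∑-0 L)

∑-++ : (L M : List 𝒜) (f : 𝒜 → ℤ) → ∑ (L ++ M) f ≡ ∑ L f + ∑ M f
∑-++ []      M f = sym (ℤₚ.+-identityˡ _)
∑-++ (x ∷ L) M f = trans (cong (_+_ (f x)) (∑-++ L M f)) (sym (ℤₚ.+-assoc (f x) _ _))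

∑-+ : (L : List 𝒜) (f g : 𝒜 → ℤ) → ∑ L (λ x → f x + g x) ≡ ∑ L f + ∑ L g
∑-+ []      f g = refl
∑-+ (x ∷ L) f g = trans (cong (_+_ (f x + g x)) (∑-+ L f g)) (interchange (f x) (g x) (∑ L f) (∑ L g))
  where
  interchange : ∀ p q r s → p + q + (r + s) ≡ p + r + (q + s)
  interchange = solve-∀

∑-*ˡ : (L : List 𝒜) (c : ℤ) (f : 𝒜 → ℤ) → ∑ L (λ x → c * f x) ≡ c * ∑ L f
∑-*ˡ []      c f = sym (ℤₚ.*-zeroʳ c)
∑-*ˡ (x ∷ L) c f = trans (cong (_+_ (c * f x)) (∑-*ˡ L c f)) (sym (ℤₚ.*-distribˡ-+ c (f x) (∑ L f)))

∑-neg : (L : List 𝒜) (f : 𝒜 → ℤ) → ∑ L (λ x → - f x) ≡ - ∑ L f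
∑-neg []      f = refl
∑-neg (x ∷ L) f = trans (cong (_+_ (- f x)) (∑-neg L f)) (sym (ℤₚ.neg-distrib-+ (f x) (∑ L f)))

∑-when : (L : List 𝒜) (p : Bool) (f : 𝒜 → ℤ) → ∑ L (λ x → when p (f x)) ≡ when p (∑ L f)
∑-when L true  f = refl
∑-when L false f = ∑-0 L

∑-map : (h : ℬ → 𝒜) (L : List ℬ) (f : 𝒜 → ℤ) → ∑ (map h L) f ≡ ∑ L (f ∘ h)
∑-map h L f = cong sumℤ (sym (Listₚ.map-∘ L))

∑-swap : (L : List 𝒜) (M : List ℬ) (f : 𝒜 → ℬ → ℤ) →
         ∑ L (λ x → ∑ M (f x)) ≡ ∑ M (λ y → ∑ L (λ x → f x y))
∑-swap []      M f = sym (∑-0 M)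
∑-swap (x ∷ L) M f = trans (cong (_+_ (∑ M (f x))) (∑-swap L M f)) (sym (∑-+ M (f x) (λ y → ∑ L (λ x → f x y))))

∑-sublists-∷ : (x : 𝒜) (L : List 𝒜) (f : List 𝒜 → ℤ) →
               ∑ (sublists (x ∷ L)) f ≡ ∑ (sublists L) (f ∘ (x ∷_)) + ∑ (sublists L) f
∑-sublists-∷ x L f = trans (∑-++ (map (x ∷_) (sublists L)) (sublists L) f)
  (cong (_+ ∑ (sublists L) f) (∑-map (x ∷_) (sublists L) f))

∑-sublists-map : (h : 𝒜 → ℬ) (L : List 𝒜) (f : List ℬ → ℤ) →
                 ∑ (sublists (map h L)) f ≡ ∑ (sublists L) (f ∘ map h)
∑-sublists-map h []      f = refl
∑-sublists-map h (x ∷ L) f =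
  trans (∑-sublists-∷ (h x) (map h L) f)
  (trans (cong₂ _+_ (∑-sublists-map h L (f ∘ (h x ∷_))) (∑-sublists-map h L f))
         (sym (∑-sublists-∷ x L (f ∘ map h))))

∑-allSubsets-suc : ∀ n (f : Subset (suc n) → ℤ) →
  ∑ (allSubsets (suc n)) f ≡ ∑ (allSubsets n) (f ∘ (true ∷_)) + ∑ (allSubsets n) (f ∘ (false ∷_))
∑-allSubsets-suc n f = trans (∑-++ (map (true ∷_) (allSubsets n)) _ f)
  (cong₂ _+_ (∑-map (true ∷_) (allSubsets n) f) (∑-map (false ∷_) (allSubsets n) f))

_≟ˢ_ : ∀ {n} (Y Z : Subset n) → Dec (Y ≡ Z)
_≟ˢ_ = Vecₚ.≡-dec Bool._≟_

∑-allSubsets-δ : ∀ n (Z : Subset n) (f : Subset n → ℤ) →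
  ∑ (allSubsets n) (λ Y → when (does (Y ≟ˢ Z)) (f Y)) ≡ f Z
∑-allSubsets-δ zero    []          f = ℤₚ.+-identityʳ _
∑-allSubsets-δ (suc n) (true ∷ Z)  f =
  trans (∑-allSubsets-suc n _)
  (trans (cong₂ _+_ (∑-allSubsets-δ n Z (f ∘ (true ∷_))) (∑-0 (allSubsets n))) (ℤₚ.+-identityʳ _))
∑-allSubsets-δ (suc n) (false ∷ Z) f =
  trans (∑-allSubsets-suc n _)
  (trans (cong₂ _+_ (∑-0 (allSubsets n)) (∑-allSubsets-δ n Z (f ∘ (false ∷_)))) (ℤₚ.+-identityˡ _))

∑-upTo-suc : ∀ N (f : ℕ → ℤ) → ∑ (upTo (suc N)) f ≡ f 0 + ∑ (upTo N) (f ∘ suc)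
∑-upTo-suc N f = cong (_+_ (f 0)) (trans (cong (λ L → ∑ L f) (sym (Listₚ.map-upTo suc N))) (∑-map suc (upTo N) f))

∑-upTo-δ : ∀ N m (f : ℕ → ℤ) → ∑ (upTo N) (λ k → when (m ≡ᵇ k) (f k)) ≡ when (m <ᵇ N) (f m)
∑-upTo-δ zero    m       f = refl
∑-upTo-δ (suc N) zero    f = trans (∑-upTo-suc N (λ k → when (0 ≡ᵇ k) (f k)))
  (trans (cong (_+_ (f 0)) (∑-0 (upTo N))) (ℤₚ.+-identityʳ _))
∑-upTo-δ (suc N) (suc m) f = trans (∑-upTo-suc N (λ k → when (suc m ≡ᵇ k) (f k)))
  (trans (ℤₚ.+-identityˡ _) (∑-upTo-δ N m (f ∘ suc)))

-- Signs and binomial identities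

sgn-+ : ∀ m n → sgn (m ℕ.+ n) ≡ sgn m * sgn n
sgn-+ zero    n = sym (ℤₚ.*-identityˡ _)
sgn-+ (suc m) n = trans (cong -_ (sgn-+ m n)) (ℤₚ.neg-distribˡ-* (sgn m) (sgn n))

sgn-² : ∀ m → sgn m * sgn m ≡ + 1
sgn-² zero    = refl
sgn-² (suc m) = trans (neg² (sgn m)) (sgn-² m)
  where
  neg² : ∀ x → - x * - x ≡ x * x
  neg² = solve-∀

pascal : ∀ n k → + (suc n C suc k) ≡ + (n C k) + + (n C suc k)
pascal n k = cong +_ (sym (nCk+nC[k+1]≡[n+1]C[k+1] n k))

nC0≡1 : ∀ n → n C 0 ≡ 1
nC0≡1 n = trans (nCk≡nC[n∸k] {0} {n} ℕ.z≤n) (nCn≡1 n)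

-- The coefficient of `x^t` in `(x − 1)^s`. The exponent `s + t` has the parity of `s − t` and
-- avoids truncated subtraction.
binv : ℕ → ℕ → ℤ
binv t s = sgn (s ℕ.+ t) * + (s C t)

binv-0-suc : ∀ s → binv 0 (suc s) ≡ - binv 0 s
binv-0-suc s = trans (cong (λ k → - sgn (s ℕ.+ 0) * + k) (trans (nC0≡1 (suc s)) (sym (nC0≡1 s))))
  (sym (ℤₚ.neg-distribˡ-* (sgn (s ℕ.+ 0)) (+ (s C 0))))

-- Compare coefficients of `x^(t+1)` in `(x − 1)^(s+1) = x (x − 1)^s − (x − 1)^s`.
binv-suc-suc : ∀ t s → binv (suc t) (suc s) ≡ binv t s + - binv (suc t) s
binv-suc-suc t s = trans (cong (_* + (suc s C suc t)) e)
  (trans (cong (_*_ (- - sgn (s ℕ.+ t))) (pascal s t))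
  (trans (lemma (sgn (s ℕ.+ t)) (+ (s C t)) (+ (s C suc t)))
         (cong (λ z → binv t s + - (z * + (s C suc t))) (sym (cong sgn (ℕₚ.+-suc s t))))))
  where
  e : sgn (suc s ℕ.+ suc t) ≡ - - sgn (s ℕ.+ t)
  e = cong (λ m → - sgn m) (ℕₚ.+-suc s t)
  lemma : ∀ x y z → - - x * (y + z) ≡ x * y + - (- x * z)
  lemma = solve-∀

-- Σ_{Q ⊆ [b]} Σ_t x^t (−1)^{|Q|+t} C(|Q|,t) = Σ_Q (x − 1)^{|Q|} = x^b.
∑-binv : ∀ b t → ∑ (allSubsets b) (λ Q → binv t ∣ Q ∣) ≡ when (b ≡ᵇ t) (+ 1)
∑-binv zero    zero    = refl
∑-binv zero    (suc t) =
  trans (cong (λ z → sgn (suc t) * + z + + 0) (k>n⇒nCk≡0 {0} {suc t} (ℕ.s≤s ℕ.z≤n))) (lemma (sgn (suc t)))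
  where
  lemma : ∀ x → x * + 0 + + 0 ≡ + 0
  lemma = solve-∀
∑-binv (suc b) zero    = begin
  ∑ (allSubsets (suc b)) (λ Q → binv 0 ∣ Q ∣)   ≡⟨ ∑-allSubsets-suc b _ ⟩
  ∑ (allSubsets b) (λ Q → binv 0 (suc ∣ Q ∣)) + D ≡⟨ cong (_+ D) (∑-cong (allSubsets b) λ Q → binv-0-suc ∣ Q ∣) ⟩
  ∑ (allSubsets b) (λ Q → - binv 0 ∣ Q ∣) + D   ≡⟨ cong (_+ D) (∑-neg (allSubsets b) _) ⟩
  - D + D                                       ≡⟨ ℤₚ.+-inverseˡ D ⟩
  + 0 ∎
  where
  open ≡-Reasoning
  D = ∑ (allSubsets b) (λ Q → binv 0 ∣ Q ∣)
∑-binv (suc b) (suc t) = begin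
  ∑ (allSubsets (suc b)) (λ Q → binv (suc t) ∣ Q ∣)   ≡⟨ ∑-allSubsets-suc b _ ⟩
  ∑ (allSubsets b) (λ Q → binv (suc t) (suc ∣ Q ∣)) + D
    ≡⟨ cong (_+ D) (∑-cong (allSubsets b) λ Q → binv-suc-suc t ∣ Q ∣) ⟩
  ∑ (allSubsets b) (λ Q → (binv t ∣ Q ∣) + (- binv (suc t) ∣ Q ∣)) + D
    ≡⟨ cong (_+ D) (trans (∑-+ (allSubsets b) _ _) (cong (_+_ (∑ (allSubsets b) (λ Q → binv t ∣ Q ∣))) (∑-neg (allSubsets b) _))) ⟩
  ∑ (allSubsets b) (λ Q → binv t ∣ Q ∣) + - D + D ≡⟨ lemma _ D ⟩
  ∑ (allSubsets b) (λ Q → binv t ∣ Q ∣)           ≡⟨ ∑-binv b t ⟩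
  when (b ≡ᵇ t) (+ 1) ∎
  where
  open ≡-Reasoning
  D = ∑ (allSubsets b) (λ Q → binv (suc t) ∣ Q ∣)
  lemma : ∀ x y → x + - y + y ≡ x
  lemma = solve-∀

-- A `z`-fold finite difference of a binomial coefficient: by Pascal's rule the subsets with and
-- without the first element telescope, which lowers the lower index by one. It evaluates what the
-- isolated vertices contribute to the leading coefficient.
∑-alternating-C : ∀ z d m → ∑ (allSubsets z) (λ Q → sgn ∣ Q ∣ * + ((z ℕ.+ d ∸ ∣ Q ∣) C (z ℕ.+ m))) ≡ + (d C m)
∑-alternating-C zero    d m = lemma (+ (d C m))
  where
  lemma : ∀ x → + 1 * x + + 0 ≡ x
  lemma = solve-∀
∑-alternating-C (suc z) d m = begin
  ∑ (allSubsets (suc z)) (λ Q → sgn ∣ Q ∣ * + ((suc z ℕ.+ d ∸ ∣ Q ∣) C (suc z ℕ.+ m)))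
    ≡⟨ ∑-allSubsets-suc z _ ⟩
  ∑ (allSubsets z) (λ Q → - sgn ∣ Q ∣ * + ((z ℕ.+ d ∸ ∣ Q ∣) C suc (z ℕ.+ m)))
    + ∑ (allSubsets z) (λ Q → sgn ∣ Q ∣ * + ((suc z ℕ.+ d ∸ ∣ Q ∣) C suc (z ℕ.+ m)))
    ≡⟨ sym (∑-+ (allSubsets z) _ _) ⟩
  ∑ (allSubsets z) (λ Q → - sgn ∣ Q ∣ * + ((z ℕ.+ d ∸ ∣ Q ∣) C suc (z ℕ.+ m))
      + sgn ∣ Q ∣ * + ((suc (z ℕ.+ d) ∸ ∣ Q ∣) C suc (z ℕ.+ m)))
    ≡⟨ ∑-cong (allSubsets z) telescope ⟩
  ∑ (allSubsets z) (λ Q → sgn ∣ Q ∣ * + ((z ℕ.+ d ∸ ∣ Q ∣) C (z ℕ.+ m)))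
    ≡⟨ ∑-alternating-C z d m ⟩
  + (d C m) ∎
  where
  open ≡-Reasoning
  lemma : ∀ s x y → - s * y + s * (x + y) ≡ s * x
  lemma = solve-∀
  telescope : ∀ Q → - sgn ∣ Q ∣ * + ((z ℕ.+ d ∸ ∣ Q ∣) C suc (z ℕ.+ m))
      + sgn ∣ Q ∣ * + ((suc (z ℕ.+ d) ∸ ∣ Q ∣) C suc (z ℕ.+ m))
      ≡ sgn ∣ Q ∣ * + ((z ℕ.+ d ∸ ∣ Q ∣) C (z ℕ.+ m))
  telescope Q = trans
    (cong (λ x → - sgn ∣ Q ∣ * + (N C suc (z ℕ.+ m)) + sgn ∣ Q ∣ * x)
      (trans (cong (λ k → + (k C suc (z ℕ.+ m))) (ℕₚ.+-∸-assoc 1 (ℕₚ.≤-trans (∣p∣≤n Q) (ℕₚ.m≤m+n z d))))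
             (pascal N (z ℕ.+ m))))
    (lemma (sgn ∣ Q ∣) (+ (N C (z ℕ.+ m))) (+ (N C suc (z ℕ.+ m))))
    where N = z ℕ.+ d ∸ ∣ Q ∣

_⊆ᵇ_ : ∀ {n} → Subset n → Subset n → Bool
[]      ⊆ᵇ []      = true
(y ∷ Y) ⊆ᵇ (z ∷ Z) = (not y ∨ z) ∧ (Y ⊆ᵇ Z)

-- Brings a sum over the subsets of `I` into the shape required by `∑-alternating-C`.
∑-⊆ : ∀ n (I : Subset n) (f : ℕ → ℤ) →
  ∑ (allSubsets n) (λ Y → when (Y ⊆ᵇ I) (f ∣ Y ∣)) ≡ ∑ (allSubsets ∣ I ∣) (λ Q → f ∣ Q ∣)
∑-⊆ zero    []          f = refl
∑-⊆ (suc n) (true ∷ I)  f = trans (∑-allSubsets-suc n _)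
  (trans (cong₂ _+_ (∑-⊆ n I (f ∘ suc)) (∑-⊆ n I f)) (sym (∑-allSubsets-suc ∣ I ∣ _)))
∑-⊆ (suc n) (false ∷ I) f = trans (∑-allSubsets-suc n _)
  (trans (cong₂ _+_ (∑-0 (allSubsets n)) (∑-⊆ n I f)) (ℤₚ.+-identityˡ _))

-- Connectivity and component counts

∈-shift⁺ : ∀ {a} {A : Set a} {x y : A} L {M} → y ∈ x ∷ L ++ M → y ∈ L ++ x ∷ M
∈-shift⁺ L (here refl) = ∈ₚ.∈-++⁺ʳ L (here refl)
∈-shift⁺ L (there p) with ∈ₚ.∈-++⁻ L p
... | inj₁ q = ∈ₚ.∈-++⁺ˡ q
... | inj₂ q = ∈ₚ.∈-++⁺ʳ L (there q)

∈-shift⁻ : ∀ {a} {A : Set a} {x y : A} L {M} → y ∈ L ++ x ∷ M → y ∈ x ∷ L ++ M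
∈-shift⁻ L p with ∈ₚ.∈-++⁻ L p
... | inj₁ q           = there (∈ₚ.∈-++⁺ˡ q)
... | inj₂ (here refl) = here refl
... | inj₂ (there q)   = there (∈ₚ.∈-++⁺ʳ L q)

module _ {V : Set} where

  owalk-trans : ∀ {S : List (V × V)} {x y z} → OWalk S x y → OWalk S y z → OWalk S x z
  owalk-trans here       q = q
  owalk-trans (step e p) q = step e (owalk-trans p q)

  owalk-edge : ∀ {S : List (V × V)} {x y} → (x , y) ∈ S → OWalk S x y
  owalk-edge e = step (inj₁ e) here

  owalk-sym : ∀ {S : List (V × V)} {x y} → OWalk S x y → OWalk S y x
  owalk-sym here              = here
  owalk-sym (step (inj₁ e) p) = owalk-trans (owalk-sym p) (step (inj₂ e) here)
  owalk-sym (step (inj₂ e) p) = owalk-trans (owalk-sym p) (step (inj₁ e) here)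

  owalk-bind : ∀ {S S′ : List (V × V)} → (∀ {x y} → (x , y) ∈ S → OWalk S′ x y) →
               ∀ {x y} → OWalk S x y → OWalk S′ x y
  owalk-bind f here              = here
  owalk-bind f (step (inj₁ e) p) = owalk-trans (f e) (owalk-bind f p)
  owalk-bind f (step (inj₂ e) p) = owalk-trans (owalk-sym (f e)) (owalk-bind f p)

  owalk-mono : ∀ {S S′ : List (V × V)} → (∀ {e} → e ∈ S → e ∈ S′) →
               ∀ {x y} → OWalk S x y → OWalk S′ x y
  owalk-mono f = owalk-bind (owalk-edge ∘ f)

  owalk-[] : ∀ {x y : V} → OWalk [] x y → x ≡ y
  owalk-[] here             = refl
  owalk-[] (step (inj₁ ()) _)
  owalk-[] (step (inj₂ ()) _)

  -- If the new edge is used several times, the stretch between its uses can be cut out, so at most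
  -- one use remains.
  owalk-cut : ∀ {S : List (V × V)} {u v x y} → OWalk ((u , v) ∷ S) x y →
    OWalk S x y ⊎ (OWalk S x u × OWalk S v y) ⊎ (OWalk S x v × OWalk S u y)
  owalk-cut here = inj₁ here
  owalk-cut (step {y = z} e p) = go e (owalk-cut p)
    where
    consˢ : ∀ {S : List (V × V)} {u v x y z} → OWalk S x z →
      OWalk S z y ⊎ (OWalk S z u × OWalk S v y) ⊎ (OWalk S z v × OWalk S u y) →
      OWalk S x y ⊎ (OWalk S x u × OWalk S v y) ⊎ (OWalk S x v × OWalk S u y)
    consˢ q (inj₁ p)              = inj₁ (owalk-trans q p)
    consˢ q (inj₂ (inj₁ (p , r))) = inj₂ (inj₁ (owalk-trans q p , r))
    consˢ q (inj₂ (inj₂ (p , r))) = inj₂ (inj₂ (owalk-trans q p , r))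
    go : ∀ {S : List (V × V)} {u v x y z} → ((x , z) ∈ (u , v) ∷ S ⊎ (z , x) ∈ (u , v) ∷ S) →
      OWalk S z y ⊎ (OWalk S z u × OWalk S v y) ⊎ (OWalk S z v × OWalk S u y) →
      OWalk S x y ⊎ (OWalk S x u × OWalk S v y) ⊎ (OWalk S x v × OWalk S u y)
    go (inj₁ (there e))   c                     = consˢ (owalk-edge e) c
    go (inj₂ (there e))   c                     = consˢ (owalk-sym (owalk-edge e)) c
    go (inj₁ (here refl)) (inj₁ p)              = inj₂ (inj₁ (here , p))
    go (inj₁ (here refl)) (inj₂ (inj₁ (_ , r))) = inj₂ (inj₁ (here , r))
    go (inj₁ (here refl)) (inj₂ (inj₂ (_ , r))) = inj₁ r
    go (inj₂ (here refl)) (inj₁ p)              = inj₂ (inj₂ (here , p))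
    go (inj₂ (here refl)) (inj₂ (inj₁ (_ , r))) = inj₁ r
    go (inj₂ (here refl)) (inj₂ (inj₂ (_ , r))) = inj₂ (inj₂ (here , r))

  owalk-loop : ∀ {S : List (V × V)} {u v} → OWalk S u v → ∀ {x y} → OWalk ((u , v) ∷ S) x y → OWalk S x y
  owalk-loop {S} {u} {v} uv = owalk-bind f
    where
    f : ∀ {x y} → (x , y) ∈ (u , v) ∷ S → OWalk S x y
    f (here refl) = uv
    f (there e)   = owalk-edge e

  component : ∀ {S : List (V × V)} {k} → CompCount S k → V → Fin k
  component (_ , _ , cover) v = proj₁ (cover v)

  component-≡⇒walk : ∀ {S : List (V × V)} {k} (c : CompCount S k) {x y} →
    component c x ≡ component c y → OWalk S x y
  component-≡⇒walk {S} (r , _ , cover) {x} {y} e =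
    owalk-trans (proj₂ (cover x))
      (subst (λ i → OWalk S (r i) y) (sym e) (owalk-sym (proj₂ (cover y))))

  walk⇒component-≡ : ∀ {S : List (V × V)} {k} (c : CompCount S k) {x y} →
    OWalk S x y → component c x ≡ component c y
  walk⇒component-≡ (r , inj , cover) {x} {y} p =
    inj _ _ (owalk-trans (owalk-sym (proj₂ (cover x))) (owalk-trans p (proj₂ (cover y))))

  owalk? : ∀ {S : List (V × V)} {k} → CompCount S k → ∀ x y → Dec (OWalk S x y)
  owalk? c x y = map′ (component-≡⇒walk c) (walk⇒component-≡ c) (component c x Finₚ.≟ component c y)

  -- Representatives of different components of `S′` cannot share a component of `S`, which gives an
  -- injection of `Fin k′` into `Fin k`.
  count-anti : ∀ {S S′ : List (V × V)} {k k′} → CompCount S k → CompCount S′ k′ →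
    (∀ {x y} → OWalk S x y → OWalk S′ x y) → k′ ℕ.≤ k
  count-anti c (r′ , inj′ , _) f =
    Finₚ.injective⇒≤ {f = λ i → component c (r′ i)} (λ e → inj′ _ _ (f (component-≡⇒walk c e)))

  count-≡ : ∀ {S S′ : List (V × V)} {k k′} → CompCount S k → CompCount S′ k′ →
    (∀ {x y} → OWalk S x y → OWalk S′ x y) → (∀ {x y} → OWalk S′ x y → OWalk S x y) → k ≡ k′
  count-≡ c c′ f g = ℕₚ.≤-antisym (count-anti c′ c g) (count-anti c c′ f)

  -- The representative of the component of `v` is dropped, and the vertices of that component are
  -- redirected through the new edge to the representative of the component of `u`.
  count-merge : ∀ {S : List (V × V)} {u v k} → ¬ OWalk S u v → CompCount S (suc k) → CompCount ((u , v) ∷ S) k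
  count-merge {S} {u} {v} {k} ¬uv c@(r , inj , cover) = r ∘ p , inj′ , cover′
    where
    lu = component c u
    lv = component c v
    p = Fin.punchIn lv
    lu≢lv : lv ≢ lu
    lu≢lv e = ¬uv (component-≡⇒walk c (sym e))
    r-lv : ∀ {i x} → OWalk S (r (p i)) x → component c x ≢ lv
    r-lv {i} {x} w e = Finₚ.punchInᵢ≢i lv i (inj _ _ (owalk-trans w
      (subst (λ j → OWalk S x (r j)) e (proj₂ (cover x)))))
    inj′ : ∀ i j → OWalk ((u , v) ∷ S) (r (p i)) (r (p j)) → i ≡ j
    inj′ i j w with owalk-cut w
    ... | inj₁ w′ = Finₚ.punchIn-injective lv i j (inj _ _ w′)
    ... | inj₂ (inj₁ (_ , w′)) = contradiction refl (r-lv (owalk-sym w′))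
    ... | inj₂ (inj₂ (w′ , _)) = contradiction refl (r-lv w′)
    cover′ : ∀ x → ∃ λ i → OWalk ((u , v) ∷ S) x (r (p i))
    cover′ x with lv Finₚ.≟ component c x
    ... | no ne = Fin.punchOut ne , owalk-mono there
            (subst (λ j → OWalk S x (r j)) (sym (Finₚ.punchIn-punchOut ne)) (proj₂ (cover x)))
    ... | yes e = Fin.punchOut lu≢lv ,
            subst (λ j → OWalk ((u , v) ∷ S) x (r j)) (sym (Finₚ.punchIn-punchOut lu≢lv))
              (owalk-trans (owalk-mono there (component-≡⇒walk c (sym e)))
                (owalk-trans (owalk-sym (owalk-edge (here refl))) (owalk-mono there (proj₂ (cover u)))))

count-[] : ∀ n → CompCount {Fin n} [] n
count-[] n = id , (λ _ _ → owalk-[]) , λ v → v , here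

elems : ∀ {n} (p : Subset n) → Fin ∣ p ∣ → Fin n
elems (true ∷ p)  zero    = zero
elems (true ∷ p)  (suc i) = suc (elems p i)
elems (false ∷ p) i       = suc (elems p i)

elems-injective : ∀ {n} (p : Subset n) i j → elems p i ≡ elems p j → i ≡ j
elems-injective (true ∷ p)  zero    zero    e = refl
elems-injective (true ∷ p)  (suc i) (suc j) e = cong suc (elems-injective p i j (Finₚ.suc-injective e))
elems-injective (false ∷ p) i       j       e = elems-injective p i j (Finₚ.suc-injective e)

elems-∈ : ∀ {n} (p : Subset n) i → vlookup p (elems p i) ≡ true
elems-∈ (true ∷ p)  zero    = refl
elems-∈ (true ∷ p)  (suc i) = elems-∈ p i
elems-∈ (false ∷ p) i       = elems-∈ p i

elems-surjective : ∀ {n} (p : Subset n) v → vlookup p v ≡ true → ∃ λ i → elems p i ≡ v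
elems-surjective (true ∷ p)  zero    e = zero , refl
elems-surjective (true ∷ p)  (suc v) e with elems-surjective p v e
... | i , e′ = suc i , cong suc e′
elems-surjective (false ∷ p) (suc v) e with elems-surjective p v e
... | i , e′ = i , cong suc e′

Avoids : ∀ {n} → Subset n → List (Fin n × Fin n) → Set
Avoids Y T = ∀ {x y} → (x , y) ∈ T → vlookup Y x ≡ false × vlookup Y y ≡ false

module _ {n : ℕ} (Y : Subset n) {T : List (Fin n × Fin n)} (avoids : Avoids Y T) where

  walk-outside : ∀ {x y} → OWalk T x y → vlookup Y x ≡ false → vlookup Y y ≡ false
  walk-outside here              o = o
  walk-outside (step (inj₁ e) p) o = walk-outside p (proj₂ (avoids e))
  walk-outside (step (inj₂ e) p) o = walk-outside p (proj₁ (avoids e))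

  walk-inside : ∀ {x y} → OWalk T x y → vlookup Y x ≡ true → x ≡ y
  walk-inside here              o = refl
  walk-inside (step (inj₁ e) p) o with () ← trans (sym o) (proj₁ (avoids e))
  walk-inside (step (inj₂ e) p) o with () ← trans (sym o) (proj₂ (avoids e))

  -- No edge meets `Y`, so each vertex of `Y` is a component by itself and adds one to the count
  -- outside `Y`.
  count-avoiding : ∀ {k} (r : Fin k → Fin n) → (∀ i → vlookup Y (r i) ≡ false) →
    (∀ i j → OWalk T (r i) (r j) → i ≡ j) →
    (∀ v → vlookup Y v ≡ false → ∃ λ i → OWalk T v (r i)) →
    CompCount T (k ℕ.+ ∣ Y ∣)
  count-avoiding {k} r r∉Y inj cover = rep ∘ Fin.splitAt k , inj′ , cover′
    where
    rep : Fin k ⊎ Fin ∣ Y ∣ → Fin n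
    rep = [ r , elems Y ]′
    rep-inj : ∀ s t → OWalk T (rep s) (rep t) → s ≡ t
    rep-inj (inj₁ i) (inj₁ j) w = cong inj₁ (inj i j w)
    rep-inj (inj₁ i) (inj₂ j) w with () ← trans (sym (elems-∈ Y j)) (walk-outside w (r∉Y i))
    rep-inj (inj₂ i) (inj₁ j) w with () ← trans (sym (elems-∈ Y i)) (walk-outside (owalk-sym w) (r∉Y j))
    rep-inj (inj₂ i) (inj₂ j) w = cong inj₂ (elems-injective Y i j (walk-inside w (elems-∈ Y i)))
    inj′ : ∀ i j → OWalk T (rep (Fin.splitAt k i)) (rep (Fin.splitAt k j)) → i ≡ j
    inj′ i j w = trans (sym (Finₚ.join-splitAt k ∣ Y ∣ i))
      (trans (cong (Fin.join k ∣ Y ∣) (rep-inj (Fin.splitAt k i) (Fin.splitAt k j) w)) (Finₚ.join-splitAt k ∣ Y ∣ j))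
    from : ∀ v s → OWalk T v (rep s) → ∃ λ i → OWalk T v (rep (Fin.splitAt k i))
    from v s w = Fin.join k ∣ Y ∣ s , subst (λ s → OWalk T v (rep s)) (sym (Finₚ.splitAt-join k ∣ Y ∣ s)) w
    cover′ : ∀ v → ∃ λ i → OWalk T v (rep (Fin.splitAt k i))
    cover′ v with vlookup Y v in eq
    ... | false = let (i , w) = cover v eq in from v (inj₁ i) w
    ... | true  = let (i , e) = elems-surjective Y v eq in
                  from v (inj₂ i) (subst (OWalk T v) (sym e) here)

-- Deletion–contraction in which contracting an edge is modelled by moving it to F.
module Positivity {V : Set} (cnt : List (V × V) → ℕ) (isCnt : ∀ S → CompCount S (cnt S)) where

  cnt-anti : ∀ {S S′} → (∀ {x y} → OWalk S x y → OWalk S′ x y) → cnt S′ ℕ.≤ cnt S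
  cnt-anti {S} {S′} = count-anti (isCnt S) (isCnt S′)

  cnt-≡ : ∀ {S S′} → (∀ {x y} → OWalk S x y → OWalk S′ x y) → (∀ {x y} → OWalk S′ x y → OWalk S x y) →
          cnt S ≡ cnt S′
  cnt-≡ {S} {S′} = count-≡ (isCnt S) (isCnt S′)

  cnt-set : ∀ {S S′} → (∀ {e} → e ∈ S → e ∈ S′) → (∀ {e} → e ∈ S′ → e ∈ S) → cnt S ≡ cnt S′
  cnt-set f g = cnt-≡ (owalk-mono f) (owalk-mono g)

  cnt-loop : ∀ {S u v} → OWalk S u v → cnt ((u , v) ∷ S) ≡ cnt S
  cnt-loop uv = cnt-≡ (owalk-loop uv) (owalk-mono there)

  cnt-merge : ∀ {S u v} → ¬ OWalk S u v → cnt S ≡ suc (cnt ((u , v) ∷ S))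
  cnt-merge {S} {u} {v} ¬uv with cnt S | isCnt S
  ... | zero  | c with () ← component c u
  ... | suc k | c = cong suc (count-≡ (count-merge ¬uv c) (isCnt ((u , v) ∷ S)) id id)

  cnt-shift : ∀ e T F → cnt ((e ∷ T) ++ F) ≡ cnt (T ++ e ∷ F)
  cnt-shift e T F = cnt-set (∈-shift⁺ T) (∈-shift⁻ T)

  -- The signless Whitney number of the graph `Es` after contraction of `F`: its vertices are the
  -- components of `F`, so `cnt F` takes the place of the order.
  relWhitney : List (V × V) → List (V × V) → ℕ → ℤ
  relWhitney F Es j = sgn j * ∑ (sublists Es) (λ T → when ((cnt (T ++ F) ℕ.+ j) ≡ᵇ cnt F) (sgn (length T)))

  private
    summand : List (V × V) → ℕ → List (V × V) → ℤ
    summand F j T = when ((cnt (T ++ F) ℕ.+ j) ≡ᵇ cnt F) (sgn (length T))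

  -- An edge within a component of `F` is a loop after contraction. Adding it to `T` changes only
  -- the sign, so the terms cancel in pairs.
  relWhitney-loop : ∀ {F u v} Es j → OWalk F u v → relWhitney F ((u , v) ∷ Es) j ≡ + 0
  relWhitney-loop {F} {u} {v} Es j uv = trans (cong (sgn j *_) (begin
    ∑ (sublists ((u , v) ∷ Es)) (summand F j)  ≡⟨ ∑-sublists-∷ (u , v) Es (summand F j) ⟩
    ∑ (sublists Es) (λ T → summand F j ((u , v) ∷ T)) + D
      ≡⟨ cong (_+ D) (trans (∑-cong (sublists Es) e) (∑-neg (sublists Es) (summand F j))) ⟩
    - D + D  ≡⟨ ℤₚ.+-inverseˡ D ⟩
    + 0 ∎)) (ℤₚ.*-zeroʳ (sgn j))
    where
    open ≡-Reasoning
    D = ∑ (sublists Es) (summand F j)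
    e : ∀ T → summand F j ((u , v) ∷ T) ≡ - summand F j T
    e T = trans (when-neg ((cnt ((u , v) ∷ T ++ F) ℕ.+ j) ≡ᵇ cnt F) (sgn (length T))) (cong (λ k → - when ((k ℕ.+ j) ≡ᵇ cnt F) (sgn (length T)))
            (cnt-loop (owalk-mono (∈ₚ.∈-++⁺ʳ T) uv)))

  -- An edge between two components of `F` strictly lowers the count, so no set containing it has
  -- rank 0 over `F`.
  relWhitney-zero : ∀ {F u v} Es → ¬ OWalk F u v → relWhitney F ((u , v) ∷ Es) 0 ≡ relWhitney F Es 0
  relWhitney-zero {F} {u} {v} Es ¬uv = cong (+ 1 *_) (trans (∑-sublists-∷ (u , v) Es (summand F 0))
    (trans (cong (_+ ∑ (sublists Es) (summand F 0)) (∑-zero (sublists Es) λ T _ → e T)) (ℤₚ.+-identityˡ _)))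
    where
    ≡ᵇ-< : ∀ {m n} → m ℕ.< n → (m ≡ᵇ n) ≡ false
    ≡ᵇ-< {zero}  (ℕ.s≤s _) = refl
    ≡ᵇ-< {suc m} (ℕ.s≤s p) = ≡ᵇ-< p
    e : ∀ T → summand F 0 ((u , v) ∷ T) ≡ + 0
    e T = cong (λ b → when b (sgn (suc (length T)))) (≡ᵇ-< (begin-strict
      cnt ((u , v) ∷ T ++ F) ℕ.+ 0  ≡⟨ ℕₚ.+-identityʳ _ ⟩
      cnt ((u , v) ∷ T ++ F)        ≡⟨ cnt-shift (u , v) T F ⟩
      cnt (T ++ (u , v) ∷ F)        ≤⟨ cnt-anti (owalk-mono (∈ₚ.∈-++⁺ʳ T)) ⟩
      cnt ((u , v) ∷ F)             <⟨ ℕₚ.≤-refl ⟩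
      suc (cnt ((u , v) ∷ F))       ≡⟨ cnt-merge ¬uv ⟨
      cnt F                         ∎))
      where open ℕₚ.≤-Reasoning

  -- Sets with the edge belong to the contraction, where their rank is one less; the others belong
  -- to the deletion. The sign of the extra edge is absorbed by passing from `sgn (suc j)` to
  -- `sgn j`, hence the plus.
  relWhitney-suc : ∀ {F u v} Es j → ¬ OWalk F u v →
    relWhitney F ((u , v) ∷ Es) (suc j) ≡ relWhitney ((u , v) ∷ F) Es j + relWhitney F Es (suc j)
  relWhitney-suc {F} {u} {v} Es j ¬uv = begin
    - sgn j * ∑ (sublists ((u , v) ∷ Es)) (summand F (suc j))
      ≡⟨ cong (- sgn j *_) (∑-sublists-∷ (u , v) Es (summand F (suc j))) ⟩
    - sgn j * (∑ (sublists Es) (λ T → summand F (suc j) ((u , v) ∷ T)) + D)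
      ≡⟨ cong (λ z → - sgn j * (z + D)) (trans (∑-cong (sublists Es) e) (∑-neg (sublists Es) _)) ⟩
    - sgn j * (- D′ + D)
      ≡⟨ lemma (sgn j) D′ D ⟩
    sgn j * D′ + - sgn j * D ∎
    where
    open ≡-Reasoning
    D  = ∑ (sublists Es) (summand F (suc j))
    D′ = ∑ (sublists Es) (summand ((u , v) ∷ F) j)
    lemma : ∀ s x y → - s * (- x + y) ≡ s * x + - s * y
    lemma = solve-∀
    e : ∀ T → summand F (suc j) ((u , v) ∷ T) ≡ - summand ((u , v) ∷ F) j T
    e T = trans (when-neg ((cnt ((u , v) ∷ T ++ F) ℕ.+ suc j) ≡ᵇ cnt F) (sgn (length T))) (cong (λ b → - when b (sgn (length T)))
            (cong₂ _≡ᵇ_ (trans (ℕₚ.+-suc _ j) (cong (λ k → suc (k ℕ.+ j)) (cnt-shift (u , v) T F))) (cnt-merge ¬uv)))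

  relWhitney-[] : ∀ F j → (j ≡ 0 × relWhitney F [] j ≡ + 1) ⊎ (j ≢ 0 × relWhitney F [] j ≡ + 0)
  relWhitney-[] F zero = inj₁ (refl , cong (λ b → + 1 * (when b (+ 1) + + 0))
    (trans (cong (_≡ᵇ cnt F) (ℕₚ.+-identityʳ (cnt F))) (≡ᵇ-refl (cnt F))))
    where
    ≡ᵇ-refl : ∀ m → (m ≡ᵇ m) ≡ true
    ≡ᵇ-refl zero    = refl
    ≡ᵇ-refl (suc m) = ≡ᵇ-refl m
  relWhitney-[] F (suc j) = inj₂ ((λ ()) , trans (cong (λ b → sgn (suc j) * (when b (+ 1) + + 0)) (m+j≢m (cnt F))) (ℤₚ.*-zeroʳ (sgn (suc j))))
    where
    m+j≢m : ∀ m → (m ℕ.+ suc j ≡ᵇ m) ≡ false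
    m+j≢m zero    = refl
    m+j≢m (suc m) = m+j≢m m

  relWhitney-nonneg : ∀ F Es j → + 0 ≤ relWhitney F Es j
  relWhitney-nonneg F [] j with relWhitney-[] F j
  ... | inj₁ (_ , e) = subst (+ 0 ≤_) (sym e) (+≤+ ℕ.z≤n)
  ... | inj₂ (_ , e) = subst (+ 0 ≤_) (sym e) (+≤+ ℕ.z≤n)
  relWhitney-nonneg F ((u , v) ∷ Es) j with owalk? (isCnt F) u v
  ... | yes uv = subst (+ 0 ≤_) (sym (relWhitney-loop Es j uv)) (+≤+ ℕ.z≤n)
  relWhitney-nonneg F ((u , v) ∷ Es) zero | no ¬uv =
    subst (+ 0 ≤_) (sym (relWhitney-zero Es ¬uv)) (relWhitney-nonneg F Es 0)
  relWhitney-nonneg F ((u , v) ∷ Es) (suc j) | no ¬uv =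
    subst (+ 0 ≤_) (sym (relWhitney-suc Es j ¬uv))
      (ℤₚ.+-mono-≤ (relWhitney-nonneg ((u , v) ∷ F) Es j) (relWhitney-nonneg F Es (suc j)))

  -- If `uv` is not a bridge of the whole graph, its deletion keeps the rank and the deletion term
  -- is positive. If it is a bridge, its contraction creates no loop and the contraction term is
  -- positive. The other term is nonnegative.
  relWhitney-pos : ∀ F Es j → (∀ {x y} → (x , y) ∈ Es → ¬ OWalk F x y) →
    cnt (Es ++ F) ℕ.+ j ℕ.≤ cnt F → + 0 < relWhitney F Es j
  relWhitney-pos F [] j _ le with relWhitney-[] F j
  ... | inj₁ (_ , e)   = subst (+ 0 <_) (sym e) (+<+ (ℕ.s≤s ℕ.z≤n))
  ... | inj₂ (j≢0 , _) = contradiction (ℕₚ.n≤0⇒n≡0 (ℕₚ.+-cancelˡ-≤ (cnt F) j 0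
                            (subst (cnt F ℕ.+ j ℕ.≤_) (sym (ℕₚ.+-identityʳ _)) le))) j≢0
  relWhitney-pos F ((u , v) ∷ Es) zero noLoop le =
    subst (+ 0 <_) (sym (relWhitney-zero Es (noLoop (here refl))))
      (relWhitney-pos F Es 0 (noLoop ∘ there)
        (subst (ℕ._≤ cnt F) (sym (ℕₚ.+-identityʳ _)) (cnt-anti (owalk-mono (∈ₚ.∈-++⁺ʳ Es)))))
  relWhitney-pos F ((u , v) ∷ Es) (suc j) noLoop le with owalk? (isCnt (Es ++ F)) u v
  ... | yes uv = subst (+ 0 <_) (sym (relWhitney-suc Es j (noLoop (here refl))))
    (ℤₚ.+-mono-≤-< (relWhitney-nonneg ((u , v) ∷ F) Es j)
      (relWhitney-pos F Es (suc j) (noLoop ∘ there) (subst (λ k → k ℕ.+ suc j ℕ.≤ cnt F) (cnt-loop uv) le)))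
  ... | no ¬uv = subst (+ 0 <_) (sym (relWhitney-suc Es j (noLoop (here refl))))
    (ℤₚ.+-mono-<-≤ (relWhitney-pos ((u , v) ∷ F) Es j noLoop′ le′) (relWhitney-nonneg F Es (suc j)))
    where
    -- an edge of Es closing a circle with uv modulo F would connect u and v in Es ++ F
    noLoop′ : ∀ {x y} → (x , y) ∈ Es → ¬ OWalk ((u , v) ∷ F) x y
    noLoop′ {x} {y} xy w with owalk-cut w
    ... | inj₁ w′ = noLoop (there xy) w′
    ... | inj₂ (inj₁ (xu , vy)) = ¬uv (owalk-trans (owalk-sym (owalk-mono (∈ₚ.∈-++⁺ʳ Es) xu))
            (owalk-trans (owalk-edge (∈ₚ.∈-++⁺ˡ xy)) (owalk-sym (owalk-mono (∈ₚ.∈-++⁺ʳ Es) vy))))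
    ... | inj₂ (inj₂ (xv , uy)) = ¬uv (owalk-trans (owalk-mono (∈ₚ.∈-++⁺ʳ Es) uy)
            (owalk-trans (owalk-sym (owalk-edge (∈ₚ.∈-++⁺ˡ xy))) (owalk-mono (∈ₚ.∈-++⁺ʳ Es) xv)))
    le′ : cnt (Es ++ (u , v) ∷ F) ℕ.+ j ℕ.≤ cnt ((u , v) ∷ F)
    le′ = ℕ.s≤s⁻¹ (subst₂ ℕ._≤_ (trans (ℕₚ.+-suc _ j) (cong (λ k → suc (k ℕ.+ j)) (cnt-shift (u , v) Es F)))
                             (cnt-merge (noLoop (here refl))) le)

-- Gains and potentials

true≢false : true ≢ false
true≢false ()

avoid : ∀ {n} → Subset n → List (Fin n × Fin n) → List (Fin n × Fin n)
avoid Y []             = []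
avoid Y ((u , v) ∷ Es) = if vlookup Y u ∨ vlookup Y v then avoid Y Es else (u , v) ∷ avoid Y Es

avoid-Avoids : ∀ {n} (Y : Subset n) Es → Avoids Y (avoid Y Es)
avoid-Avoids Y ((u , v) ∷ Es) e with vlookup Y u in eu | vlookup Y v in ev
avoid-Avoids Y ((u , v) ∷ Es) e           | true  | _     = avoid-Avoids Y Es e
avoid-Avoids Y ((u , v) ∷ Es) e           | false | true  = avoid-Avoids Y Es e
avoid-Avoids Y ((u , v) ∷ Es) (here refl) | false | false = eu , ev
avoid-Avoids Y ((u , v) ∷ Es) (there e)   | false | false = avoid-Avoids Y Es e

avoid-⊆ : ∀ {n} (Y : Subset n) Es {e} → e ∈ avoid Y Es → e ∈ Es
avoid-⊆ Y ((u , v) ∷ Es) e with vlookup Y u ∨ vlookup Y v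
avoid-⊆ Y ((u , v) ∷ Es) e           | true  = there (avoid-⊆ Y Es e)
avoid-⊆ Y ((u , v) ∷ Es) (here refl) | false = here refl
avoid-⊆ Y ((u , v) ∷ Es) (there e)   | false = there (avoid-⊆ Y Es e)

avoid-∈ : ∀ {n} (Y : Subset n) Es {x y} → (x , y) ∈ Es →
          vlookup Y x ≡ false → vlookup Y y ≡ false → (x , y) ∈ avoid Y Es
avoid-∈ Y ((u , v) ∷ Es) (here refl) ox oy rewrite ox | oy = here refl
avoid-∈ Y ((u , v) ∷ Es) (there e) ox oy with vlookup Y u ∨ vlookup Y v
... | true  = avoid-∈ Y Es e ox oy
... | false = there (avoid-∈ Y Es e ox oy)

module Potentials {c ℓ : Level} (G : Group c ℓ) {n : ℕ} where

  open Group G using (_≈_; _∙_; ε; _⁻¹; ∙-cong; ∙-congˡ; ∙-congʳ; ⁻¹-cong; assoc; identityˡ; identityʳ; inverseˡ; inverseʳ; reflexive; setoid) renaming (Carrier to Gr; sym to ≈-sym; trans to ≈-trans)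
  open GroupProperties G
  open Gain G (Fin n)
  open import Relation.Binary.Reasoning.Setoid setoid

  diff : Gr → Gr → Gr
  diff x y = x ⁻¹ ∙ y

  diff-trans : ∀ x y z → diff x y ∙ diff y z ≈ diff x z
  diff-trans x y z = begin
    (x ⁻¹ ∙ y) ∙ (y ⁻¹ ∙ z)  ≈⟨ assoc _ _ _ ⟩
    x ⁻¹ ∙ (y ∙ (y ⁻¹ ∙ z))  ≈⟨ ∙-congˡ (assoc _ _ _) ⟨
    x ⁻¹ ∙ ((y ∙ y ⁻¹) ∙ z)  ≈⟨ ∙-congˡ (≈-trans (∙-congʳ (inverseʳ y)) (identityˡ z)) ⟩
    x ⁻¹ ∙ z                 ∎

  diff-sym : ∀ x y → diff x y ⁻¹ ≈ diff y x
  diff-sym x y = ≈-trans (⁻¹-anti-homo-∙ (x ⁻¹) y) (∙-congˡ (⁻¹-involutive x))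

  diff-translate : ∀ a x y → diff (a ∙ x) (a ∙ y) ≈ diff x y
  diff-translate a x y = begin
    (a ∙ x) ⁻¹ ∙ (a ∙ y)       ≈⟨ ∙-congʳ (⁻¹-anti-homo-∙ a x) ⟩
    (x ⁻¹ ∙ a ⁻¹) ∙ (a ∙ y)    ≈⟨ assoc _ _ _ ⟩
    x ⁻¹ ∙ (a ⁻¹ ∙ (a ∙ y))    ≈⟨ ∙-congˡ (assoc _ _ _) ⟨
    x ⁻¹ ∙ ((a ⁻¹ ∙ a) ∙ y)    ≈⟨ ∙-congˡ (≈-trans (∙-congʳ (inverseˡ a)) (identityˡ y)) ⟩
    x ⁻¹ ∙ y                   ∎

  diff-shift : ∀ u v g → g ≈ diff u (((u ∙ g) ∙ v ⁻¹) ∙ v)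
  diff-shift u v g = begin
    g                                 ≈⟨ identityˡ g ⟨
    ε ∙ g                             ≈⟨ ∙-congʳ (inverseˡ u) ⟨
    (u ⁻¹ ∙ u) ∙ g                    ≈⟨ assoc _ _ _ ⟩
    u ⁻¹ ∙ (u ∙ g)                    ≈⟨ ∙-congˡ (identityʳ _) ⟨
    u ⁻¹ ∙ ((u ∙ g) ∙ ε)              ≈⟨ ∙-congˡ (∙-congˡ (inverseˡ v)) ⟨
    u ⁻¹ ∙ ((u ∙ g) ∙ (v ⁻¹ ∙ v))     ≈⟨ ∙-congˡ (assoc _ _ _) ⟨
    u ⁻¹ ∙ (((u ∙ g) ∙ v ⁻¹) ∙ v)     ∎

  diff-solve : ∀ {g} u v → g ∙ diff v u ≈ ε → g ≈ diff u v
  diff-solve {g} u v e = ≈-trans (inverseˡ-unique g (diff v u) e) (diff-sym v u)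

  underlying : List Edge → List (Fin n × Fin n)
  underlying []               = []
  underlying (half _ ∷ S)     = underlying S
  underlying (link u v _ ∷ S) = (u , v) ∷ underlying S

  underlying⁺ : ∀ {S x y g} → link x y g ∈ S → (x , y) ∈ underlying S
  underlying⁺ {half _ ∷ S}     (there e)   = underlying⁺ e
  underlying⁺ {link _ _ _ ∷ S} (here refl) = here refl
  underlying⁺ {link _ _ _ ∷ S} (there e)   = there (underlying⁺ e)

  underlying⁻ : ∀ {S x y} → (x , y) ∈ underlying S → ∃ λ g → link x y g ∈ S
  underlying⁻ {half _ ∷ S}     e           = let (g , e′) = underlying⁻ e in g , there e′
  underlying⁻ {link _ _ g ∷ S} (here refl) = g , here refl
  underlying⁻ {link _ _ _ ∷ S} (there e)   = let (g , e′) = underlying⁻ e in g , there e′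

  underlying-mono : ∀ {S S′} → (∀ {e} → e ∈ S → e ∈ S′) → ∀ {e} → e ∈ underlying S → e ∈ underlying S′
  underlying-mono f {x , y} e = underlying⁺ (f (proj₂ (underlying⁻ e)))

  lookup⇒∈ : ∀ {S : List Edge} {e} i → lookup S i ≡ e → e ∈ S
  lookup⇒∈ {S} i refl = ∈ₚ.∈-lookup i

  ∈⇒lookup : ∀ {S : List Edge} {e} → e ∈ S → ∃ λ i → lookup S i ≡ e
  ∈⇒lookup p = index p , sym (lookup-index p)

  walk⇒owalk : ∀ {S x y} → Walk S x y → OWalk (underlying S) x y
  walk⇒owalk     []            = here
  walk⇒owalk {S} (fwd i p ∷ w) = step (inj₁ (underlying⁺ {S} (lookup⇒∈ i p))) (walk⇒owalk w)
  walk⇒owalk {S} (bwd i p ∷ w) = step (inj₂ (underlying⁺ {S} (lookup⇒∈ i p))) (walk⇒owalk w)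

  owalk⇒walk : ∀ {S x y} → OWalk (underlying S) x y → Walk S x y
  owalk⇒walk     here              = []
  owalk⇒walk {S} (step (inj₁ e) w) = let (i , p) = ∈⇒lookup (proj₂ (underlying⁻ {S} e)) in fwd i p ∷ owalk⇒walk w
  owalk⇒walk {S} (step (inj₂ e) w) = let (i , p) = ∈⇒lookup (proj₂ (underlying⁻ {S} e)) in bwd i p ∷ owalk⇒walk w

  -- Simple paths and the circles that they close

  allVerts : ∀ {S x y} → Walk S x y → List (Fin n)
  allVerts {x = x} []      = x ∷ []
  allVerts {x = x} (_ ∷ w) = x ∷ allVerts w

  first∈allVerts : ∀ {S x y} (w : Walk S x y) → x ∈ allVerts w
  first∈allVerts []      = here refl
  first∈allVerts (_ ∷ w) = here refl

  last∈allVerts : ∀ {S x y} (w : Walk S x y) → y ∈ allVerts w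
  last∈allVerts []      = here refl
  last∈allVerts (_ ∷ w) = there (last∈allVerts w)

  walkVerts⊆allVerts : ∀ {S x y} (w : Walk S x y) {z} → z ∈ walkVerts w → z ∈ allVerts w
  walkVerts⊆allVerts (_ ∷ w) (here refl) = here refl
  walkVerts⊆allVerts (_ ∷ w) (there p)   = there (walkVerts⊆allVerts w p)

  suffix : ∀ {S x y z} (w : Walk S x y) → z ∈ allVerts w → Unique (allVerts w) →
           Σ (Walk S z y) λ w′ → Unique (allVerts w′)
  suffix []      (here refl) u       = [] , u
  suffix (s ∷ w) (here refl) u       = s ∷ w , u
  suffix (s ∷ w) (there p)   (_ ∷ u) = suffix w p u

  ∉⇒All≢ : ∀ {A : Set} {x : A} L → ¬ (x ∈ L) → All (x ≢_) L
  ∉⇒All≢ L x∉L = Allₚ.¬Any⇒All¬ L x∉L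

  simplify : ∀ {S x y} → Walk S x y → Σ (Walk S x y) λ w → Unique (allVerts w)
  simplify [] = [] , [] ∷ []
  simplify {x = x} (s ∷ w) with simplify w
  ... | w′ , u with x ∈? allVerts w′
    where open import Data.List.Membership.DecPropositional Finₚ._≟_ using (_∈?_)
  ...   | yes p = suffix w′ p u
  ...   | no ¬p = s ∷ w′ , ∉⇒All≢ (allVerts w′) ¬p ∷ u

  ends∈allVerts : ∀ {S x y} (w : Walk S x y) {i} → i ∈ walkEdges w →
    ∀ {a b g} → lookup S i ≡ link a b g → a ∈ allVerts w × b ∈ allVerts w
  ends∈allVerts (fwd i p ∷ w) (here refl) q with refl ← trans (sym p) q = here refl , there (first∈allVerts w)
  ends∈allVerts (bwd i p ∷ w) (here refl) q with refl ← trans (sym p) q = there (first∈allVerts w) , here refl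
  ends∈allVerts (_ ∷ w) (there e) q = let (a∈ , b∈) = ends∈allVerts w e q in there a∈ , there b∈

  -- A second use of an edge would put both its ends, and so the vertex just left, on the rest of
  -- the walk.
  simple⇒uniqueEdges : ∀ {S x y} (w : Walk S x y) → Unique (allVerts w) → Unique (walkEdges w)
  simple⇒uniqueEdges []            u        = []
  simple⇒uniqueEdges (s ∷ w)       (x∉ ∷ u) = ∉⇒All≢ (walkEdges w) (new s) ∷ simple⇒uniqueEdges w u
    where
    new : ∀ {g} (s : Step _ _ _ g) → ¬ (stepEdge s ∈ walkEdges w)
    new (fwd i p) e = All.lookup x∉ (proj₁ (ends∈allVerts w e p)) refl
    new (bwd i p) e = All.lookup x∉ (proj₂ (ends∈allVerts w e p)) refl

  -- The end `y`, missing from `walkVerts`, is moved to the front because the circle built by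
  -- `close` starts where the path ends.
  simple⇒uniqueVerts : ∀ {S x y} (w : Walk S x y) → Unique (allVerts w) → Unique (y ∷ walkVerts w)
  simple⇒uniqueVerts []      u = [] ∷ []
  simple⇒uniqueVerts {x = x} {y} (s ∷ w) (x∉ ∷ u) with simple⇒uniqueVerts w u
  ... | y∉ ∷ u′ = ((λ { refl → All.lookup x∉ (last∈allVerts w) refl }) ∷ y∉)
                ∷ (∉⇒All≢ (walkVerts w) (λ p → All.lookup x∉ (walkVerts⊆allVerts w p) refl) ∷ u′)

  liftWalk : ∀ {S x y} e → Walk S x y → Walk (e ∷ S) x y
  liftWalk e []            = []
  liftWalk e (fwd i p ∷ w) = fwd (suc i) p ∷ liftWalk e w
  liftWalk e (bwd i p ∷ w) = bwd (suc i) p ∷ liftWalk e w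

  liftWalk-gain : ∀ {S x y} e (w : Walk S x y) → walkGain (liftWalk e w) ≡ walkGain w
  liftWalk-gain e []            = refl
  liftWalk-gain e (fwd i p ∷ w) = cong (_ ∙_) (liftWalk-gain e w)
  liftWalk-gain e (bwd i p ∷ w) = cong (_ ∙_) (liftWalk-gain e w)

  liftWalk-edges : ∀ {S x y} e (w : Walk S x y) → walkEdges (liftWalk e w) ≡ map suc (walkEdges w)
  liftWalk-edges e []            = refl
  liftWalk-edges e (fwd i p ∷ w) = cong (suc i ∷_) (liftWalk-edges e w)
  liftWalk-edges e (bwd i p ∷ w) = cong (suc i ∷_) (liftWalk-edges e w)

  liftWalk-verts : ∀ {S x y} e (w : Walk S x y) → walkVerts (liftWalk e w) ≡ walkVerts w
  liftWalk-verts e []            = refl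
  liftWalk-verts e (fwd i p ∷ w) = cong (_ ∷_) (liftWalk-verts e w)
  liftWalk-verts e (bwd i p ∷ w) = cong (_ ∷_) (liftWalk-verts e w)

  liftWalk-circle : ∀ {S x} e (w : Walk S x x) → IsCircle w → IsCircle (liftWalk e w)
  liftWalk-circle e w (pos , ue , uv) =
    subst (λ L → 1 ℕ.≤ length L) (sym (liftWalk-edges e w))
      (subst (1 ℕ.≤_) (sym (Listₚ.length-map suc (walkEdges w))) pos) ,
    subst Unique (sym (liftWalk-edges e w)) (Uniqueₚ.map⁺ Finₚ.suc-injective ue) ,
    subst Unique (sym (liftWalk-verts e w)) uv

  close : ∀ {S u v} g → Walk S v u → Walk (link u v g ∷ S) u u
  close g w = fwd zero refl ∷ liftWalk _ w

  -- Edges are positions in the list, so the new one, `zero`, differs from all lifted ones even if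
  -- it is parallel to one of them. For `u` equal to `v` the simple path is empty and the circle is
  -- a loop.
  close-circle : ∀ {S u v} g (w : Walk S v u) → Unique (allVerts w) → IsCircle (close g w)
  close-circle {S} {u} {v} g w s =
    ℕ.s≤s ℕ.z≤n ,
    subst (λ L → Unique (zero ∷ L)) (sym (liftWalk-edges _ w))
      (Allₚ.map⁺ (All.universal (λ _ ()) (walkEdges w)) ∷ Uniqueₚ.map⁺ Finₚ.suc-injective (simple⇒uniqueEdges w s)) ,
    subst (λ L → Unique (u ∷ L)) (sym (liftWalk-verts _ w)) (simple⇒uniqueVerts w s)

  -- Edge sets that are balanced outside a vertex set

  module Outside (Y : Subset n) where

    π : List Edge → List (Fin n × Fin n)
    π S = avoid Y (underlying S)

    -- Balance outside Y is expressed by the potential θ.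
    record Good (S : List Edge) : Set (c ⊔ ℓ) where
      field
        closed    : ∀ {x y g} → link x y g ∈ S → vlookup Y x ≡ vlookup Y y
        halfIn    : ∀ {x} → half x ∈ S → vlookup Y x ≡ true
        θ         : Fin n → Gr
        potential : ∀ {x y g} → link x y g ∈ S → vlookup Y x ≡ false → g ≈ diff (θ x) (θ y)
    open Good

    good-mono : ∀ {S S′} → (∀ {e} → e ∈ S → e ∈ S′) → Good S′ → Good S
    good-mono f p = record
      { closed = closed p ∘ f ; halfIn = halfIn p ∘ f ; θ = θ p ; potential = potential p ∘ f }

    good-[] : Good []
    good-[] = record { closed = λ () ; halfIn = λ () ; θ = λ _ → ε ; potential = λ () }

    good-half : ∀ {S x} → vlookup Y x ≡ true → Good S → Good (half x ∷ S)
    good-half ix p = record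
      { closed    = λ { (there e) → closed p e }
      ; halfIn    = λ { (here refl) → ix ; (there e) → halfIn p e }
      ; θ         = θ p
      ; potential = λ { (there e) → potential p e }
      }

    good-inside : ∀ {S u v g} → vlookup Y u ≡ true → vlookup Y v ≡ true → Good S → Good (link u v g ∷ S)
    good-inside iu iv p = record
      { closed    = λ { (here refl) → trans iu (sym iv) ; (there e) → closed p e }
      ; halfIn    = λ { (there e) → halfIn p e }
      ; θ         = θ p
      ; potential = λ { (here refl) ou → contradiction (trans (sym iu) ou) true≢false ; (there e) → potential p e }
      }

    -- Along each edge both potentials reproduce the same gain. Hence an edge whose ends are already
    -- connected has only one consistent gain, whichever potential is used.
    potential-unique : ∀ {S} (p q : Good S) {x y} → OWalk (π S) x y →
      diff (θ p x) (θ p y) ≈ diff (θ q x) (θ q y)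
    potential-unique p q here = ≈-trans (inverseˡ _) (≈-sym (inverseˡ _))
    potential-unique {S} p q (step {x} {y} {z} e w) =
      ≈-trans (≈-sym (diff-trans _ _ _))
        (≈-trans (∙-cong (edge e) (potential-unique p q w)) (diff-trans _ _ _))
      where
      edge′ : ∀ {x y} → (x , y) ∈ π S → diff (θ p x) (θ p y) ≈ diff (θ q x) (θ q y)
      edge′ e = let (ox , _) = avoid-Avoids Y (underlying S) e
                    (_ , l)  = underlying⁻ (avoid-⊆ Y (underlying S) e)
                in ≈-trans (≈-sym (potential p l ox)) (potential q l ox)
      edge : (x , y) ∈ π S ⊎ (y , x) ∈ π S → diff (θ p x) (θ p y) ≈ diff (θ q x) (θ q y)
      edge (inj₁ e) = edge′ e
      edge (inj₂ e) = ≈-trans (≈-sym (diff-sym _ _)) (≈-trans (⁻¹-cong (edge′ e)) (diff-sym _ _))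

    good-consistent : ∀ {S u v g} (p : Good S) → vlookup Y u ≡ false → vlookup Y v ≡ false →
      g ≈ diff (θ p u) (θ p v) → Good (link u v g ∷ S)
    good-consistent p ou ov eq = record
      { closed    = λ { (here refl) → trans ou (sym ov) ; (there e) → closed p e }
      ; halfIn    = λ { (there e) → halfIn p e }
      ; θ         = θ p
      ; potential = λ { (here refl) _ → eq ; (there e) → potential p e }
      }

    good-consistent⁻ : ∀ {S u v g} (p : Good S) → vlookup Y u ≡ false → OWalk (π S) u v →
      Good (link u v g ∷ S) → g ≈ diff (θ p u) (θ p v)
    good-consistent⁻ p ou uv q =
      ≈-trans (potential q (here refl) ou) (potential-unique (good-mono there q) p uv)

    -- Translating the potential on the component of v makes any gain consistent.
    good-merge : ∀ {S u v g} (p : Good S) {k} → CompCount (π S) k → vlookup Y u ≡ false → vlookup Y v ≡ false →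
      ¬ OWalk (π S) u v → Good (link u v g ∷ S)
    good-merge {S} {u} {v} {g} p cnt ou ov ¬uv = record
      { closed    = λ { (here refl) → trans ou (sym ov) ; (there e) → closed p e }
      ; halfIn    = λ { (there e) → halfIn p e }
      ; θ         = θ′
      ; potential = λ { (here refl) _ → new ; (there e) → old e }
      }
      where
      a : Gr
      -- Chosen so that `a ∙ θ p v` is `θ p u ∙ g`; left translation does not disturb the gains
      -- within the component of `v`.
      a = (θ p u ∙ g) ∙ θ p v ⁻¹
      shift : ∀ x → Dec (OWalk (π S) x v) → Gr
      shift x (yes _) = a ∙ θ p x
      shift x (no _)  = θ p x
      θ′ : Fin n → Gr
      θ′ x = shift x (owalk? cnt x v)
      new : g ≈ diff (θ′ u) (θ′ v)
      new with owalk? cnt u v | owalk? cnt v v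
      ... | yes uv | _      = contradiction uv ¬uv
      ... | no _   | no ¬vv = contradiction here ¬vv
      ... | no _   | yes _  = diff-shift (θ p u) (θ p v) g
      old : ∀ {x y h} → link x y h ∈ S → vlookup Y x ≡ false → h ≈ diff (θ′ x) (θ′ y)
      old {x} {y} e ox with owalk? cnt x v | owalk? cnt y v
      ... | yes _  | yes _  = ≈-trans (potential p e ox) (≈-sym (diff-translate a (θ p x) (θ p y)))
      ... | no _   | no _   = potential p e ox
      ... | yes xv | no ¬yv = contradiction (owalk-trans (owalk-sym (owalk-edge xy)) xv) ¬yv
        where xy = avoid-∈ Y (underlying S) (underlying⁺ e) ox (trans (sym (closed p e)) ox)
      ... | no ¬xv | yes yv = contradiction (owalk-trans (owalk-edge xy) yv) ¬xv
        where xy = avoid-∈ Y (underlying S) (underlying⁺ e) ox (trans (sym (closed p e)) ox)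

    walk-stays : ∀ {S x y} → (∀ {x y g} → link x y g ∈ S → vlookup Y x ≡ vlookup Y y) →
                 Walk S x y → vlookup Y x ≡ vlookup Y y
    walk-stays cl []            = refl
    walk-stays cl (fwd i p ∷ w) = trans (cl (lookup⇒∈ i p)) (walk-stays cl w)
    walk-stays cl (bwd i p ∷ w) = trans (sym (cl (lookup⇒∈ i p))) (walk-stays cl w)

    walk⇒owalk-π : ∀ {S x y} → (∀ {x y g} → link x y g ∈ S → vlookup Y x ≡ vlookup Y y) →
                   Walk S x y → vlookup Y x ≡ false → OWalk (π S) x y
    walk⇒owalk-π cl [] ox = here
    walk⇒owalk-π {S} cl (fwd i p ∷ w) ox =
      step (inj₁ (avoid-∈ Y (underlying S) (underlying⁺ l) ox oy)) (walk⇒owalk-π cl w oy)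
      where l  = lookup⇒∈ i p
            oy = trans (sym (cl l)) ox
    walk⇒owalk-π {S} cl (bwd i p ∷ w) ox =
      step (inj₂ (avoid-∈ Y (underlying S) (underlying⁺ l) oy ox)) (walk⇒owalk-π cl w oy)
      where l  = lookup⇒∈ i p
            oy = trans (cl l) ox

    owalk-π⇒walk : ∀ {S x y} → OWalk (π S) x y → Walk S x y
    owalk-π⇒walk {S} w = owalk⇒walk (owalk-mono (avoid-⊆ Y (underlying S)) w)

    good⇒gain : ∀ {S} (p : Good S) {x y} (w : Walk S x y) → vlookup Y x ≡ false →
                walkGain w ≈ diff (θ p x) (θ p y)
    good⇒gain p []            ox = ≈-sym (inverseˡ _)
    good⇒gain p (fwd i q ∷ w) ox =
      ≈-trans (∙-cong (potential p l ox) (good⇒gain p w (trans (sym (closed p l)) ox))) (diff-trans _ _ _)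
      where l = lookup⇒∈ i q
    good⇒gain p (bwd i q ∷ w) ox =
      ≈-trans (∙-cong (≈-trans (⁻¹-cong (potential p l oy)) (diff-sym _ _)) (good⇒gain p w oy)) (diff-trans _ _ _)
      where l  = lookup⇒∈ i q
            oy = trans (closed p l) ox

    good⇒balanced : ∀ {S} → Good S → ∀ {v} → vlookup Y v ≡ false → BalancedComp S v
    good⇒balanced p ov =
      (λ w vw hw → true≢false (trans (sym (halfIn p hw)) (trans (sym (walk-stays (closed p) vw)) ov))) ,
      (λ w Z vw _ → ≈-trans (good⇒gain p Z (trans (sym (walk-stays (closed p) vw)) ov)) (inverseˡ _))

    -- The potential is built edge by edge. A link within one component closes a simple path to a
    -- circle, and the neutrality of this circle says that the link agrees with the potential found
    -- so far.
    balanced⇒good : (cnt : List (Fin n × Fin n) → ℕ) → (∀ S → CompCount S (cnt S)) → ∀ S →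
      (∀ {x y g} → link x y g ∈ S → vlookup Y x ≡ vlookup Y y) →
      (∀ {x} → half x ∈ S → vlookup Y x ≡ true) →
      (∀ {w} (Z : Walk S w w) → vlookup Y w ≡ false → IsCircle Z → walkGain Z ≈ ε) → Good S
    balanced⇒good cnt isCnt [] cl hf neutral = good-[]
    balanced⇒good cnt isCnt (e ∷ S) cl hf neutral = extend e cl hf neutral
      (balanced⇒good cnt isCnt S (cl ∘ there) (hf ∘ there)
        (λ Z ow circ → ≈-trans (≈-sym (reflexive (liftWalk-gain e Z))) (neutral (liftWalk e Z) ow (liftWalk-circle e Z circ))))
      where
      extend : ∀ e → (∀ {x y g} → link x y g ∈ e ∷ S → vlookup Y x ≡ vlookup Y y) →
        (∀ {x} → half x ∈ e ∷ S → vlookup Y x ≡ true) →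
        (∀ {w} (Z : Walk (e ∷ S) w w) → vlookup Y w ≡ false → IsCircle Z → walkGain Z ≈ ε) → Good S → Good (e ∷ S)
      extend (half x) cl hf _ p = good-half (hf (here refl)) p
      extend (link u v g) cl hf neutral p with vlookup Y u in ou
      ... | true  = good-inside ou (trans (sym (cl (here refl))) ou) p
      ... | false with owalk? (isCnt (π S)) u v
      ...   | no ¬uv = good-merge p (isCnt (π S)) ou (trans (sym (cl (here refl))) ou) ¬uv
      ...   | yes uv = good-consistent p ou ov (diff-solve (θ p u) (θ p v)
                (≈-trans (∙-congˡ (≈-trans (≈-sym (good⇒gain p w ov)) (≈-sym (reflexive (liftWalk-gain (link u v g) w)))))
                       (neutral (close g w) ou (close-circle g w simple))))
        where
        ov = trans (sym (cl (here refl))) ou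
        path = simplify (owalk-π⇒walk (owalk-sym uv))
        w = proj₁ path
        simple = proj₂ path

-- Summing over the balanced lifts of an edge set

∑-allFin-suc : ∀ γ (f : Fin (suc γ) → ℤ) → ∑ (allFin (suc γ)) f ≡ f zero + ∑ (allFin γ) (f ∘ suc)
∑-allFin-suc γ f = cong (λ L → f zero + sumℤ L)
  (trans (Listₚ.map-tabulate suc f) (sym (Listₚ.map-tabulate id (f ∘ suc))))

∑-allFin-const : ∀ γ x → ∑ (allFin γ) (λ _ → x) ≡ + γ * x
∑-allFin-const zero    x = sym (ℤₚ.*-zeroˡ x)
∑-allFin-const (suc γ) x = trans (∑-allFin-suc γ (λ _ → x))
  (trans (cong (_+_ x) (∑-allFin-const γ x)) (sym (ℤₚ.suc-* (+ γ) x)))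

∑-allFin-single : ∀ γ (k : Fin γ) (f : Fin γ → ℤ) → (∀ i → i ≢ k → f i ≡ + 0) → ∑ (allFin γ) f ≡ f k
∑-allFin-single (suc γ) zero f z = trans (∑-allFin-suc γ f)
  (trans (cong (_+_ (f zero)) (∑-zero (allFin γ) λ i _ → z (suc i) λ ())) (ℤₚ.+-identityʳ _))
∑-allFin-single (suc γ) (suc k) f z = trans (∑-allFin-suc γ f)
  (trans (cong₂ _+_ (z zero λ ()) (∑-allFin-single γ k (f ∘ suc) λ i i≢k → z (suc i) (i≢k ∘ Finₚ.suc-injective)))
         (ℤₚ.+-identityˡ _))

noneInside : ∀ {n} → Subset n → List (Fin n × Fin n) → Bool
noneInside Y []             = true
noneInside Y ((u , v) ∷ Es) = not (vlookup Y u ∧ vlookup Y v) ∧ noneInside Y Es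

disjointOn : ∀ {n} → Subset n → Subset n → List (Fin n) → Bool
disjointOn X Y []       = true
disjointOn X Y (x ∷ xs) = not (vlookup Y x ∧ vlookup X x) ∧ disjointOn X Y xs

module Expansion {c ℓ : Level} (G : Group c ℓ) {n γ : ℕ} (enum : Fin γ → Group.Carrier G) where

  open Gain G (Fin n)

  lift : Fin n → Fin n → Fin γ → Edge
  lift u v k = link u v (enum k)

  block : Fin n × Fin n → List Edge
  block (u , v) = map (lift u v) (allFin γ)

  halves : Subset n → List (Fin n) → List Edge
  halves X = concatMap (λ x → if vlookup X x then half x ∷ [] else [])

  expansionEdges-≡ : ∀ Γ X → expansionEdges G enum Γ X ≡ concatMap block (edgesOf Γ) ++ halves X (allFin n)
  expansionEdges-≡ Γ X = cong (_++ halves X (allFin n)) (Listₚ.concatMap-cong (λ { (u , v) → refl }) (edgesOf Γ))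

module Lifting {c ℓ : Level} (G : Group c ℓ) {n γ : ℕ} (enum : Fin (suc γ) → Group.Carrier G)
  (enum-inj : ∀ a b → Group._≈_ G (enum a) (enum b) → a ≡ b)
  (enum-surj : ∀ g → ∃ λ k → Group._≈_ G (enum k) g)
  (cnt : List (Fin n × Fin n) → ℕ) (isCnt : ∀ S → CompCount S (cnt S)) where

  open Group G using (_≈_) renaming (Carrier to Gr; sym to ≈-sym; trans to ≈-trans)
  open Gain G (Fin n)
  open Potentials G {n}
  open Expansion G {n} enum
  open Positivity cnt isCnt

  _≈?_ : ∀ g h → Dec (g ≈ h)
  g ≈? h = map′
    (λ e → ≈-trans (≈-sym (proj₂ (enum-surj g))) (≈-trans (Group.reflexive G (cong enum e)) (proj₂ (enum-surj h))))
    (λ e → enum-inj _ _ (≈-trans (proj₂ (enum-surj g)) (≈-trans e (≈-sym (proj₂ (enum-surj h))))))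
    (proj₁ (enum-surj g) Finₚ.≟ proj₁ (enum-surj h))

  module _ (Y : Subset n) where
    open Outside Y
    open Good

    -- Each new edge is tested against the potential already found; `potential-unique` ensures that
    -- a failure of this potential is a failure of all.
    good? : ∀ S → Dec (Good S)
    good? [] = yes good-[]
    good? (e ∷ S) with good? S
    ... | no ¬p = no (¬p ∘ good-mono there)
    good? (half x ∷ S) | yes p with vlookup Y x in ix
    ... | true  = yes (good-half ix p)
    ... | false = no λ q → true≢false (trans (sym (halfIn q (here refl))) ix)
    good? (link u v g ∷ S) | yes p with vlookup Y u in eu | vlookup Y v in ev
    ... | true  | true  = yes (good-inside eu ev p)
    ... | true  | false = no λ q → true≢false (trans (sym eu) (trans (closed q (here refl)) ev))
    ... | false | true  = no λ q → true≢false (trans (sym ev) (trans (sym (closed q (here refl))) eu))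
    ... | false | false with owalk? (isCnt (π S)) u v
    ...   | no ¬uv = yes (good-merge p (isCnt (π S)) eu ev ¬uv)
    ...   | yes uv = map′ (good-consistent p eu ev) (good-consistent⁻ p eu uv) (g ≈? diff (θ p u) (θ p v))

    π-mono : ∀ {S S′} → (∀ {e} → e ∈ S → e ∈ S′) → ∀ {e} → e ∈ π S → e ∈ π S′
    π-mono {S} {S′} f {x , y} e = let (ox , oy) = avoid-Avoids Y (underlying S) e in
      avoid-∈ Y (underlying S′) (underlying-mono f (avoid-⊆ Y (underlying S) e)) ox oy

    module _ (h : ℕ → ℤ) where

      val : List Edge → ℤ
      val S = when (does (good? S)) (h (cnt (π S)))

      val-good : ∀ {S} → Good S → val S ≡ h (cnt (π S))
      val-good {S} p = cong (λ b → when b (h (cnt (π S)))) (dec-true (good? S) p)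

      val-bad : ∀ {S} → ¬ Good S → val S ≡ + 0
      val-bad {S} ¬p = cong (λ b → when b (h (cnt (π S)))) (dec-false (good? S) ¬p)

      val-⇔ : ∀ {S S′} → (Good S → Good S′) → (Good S′ → Good S) → cnt (π S) ≡ cnt (π S′) → val S ≡ val S′
      val-⇔ {S} {S′} f g e = go (good? S)
        where
        go : Dec (Good S) → val S ≡ val S′
        go (yes p) = trans (val-good p) (trans (cong h e) (sym (val-good (f p))))
        go (no ¬p) = trans (val-bad ¬p) (sym (val-bad (¬p ∘ g)))

      val-set : ∀ {S S′} → (∀ {e} → e ∈ S → e ∈ S′) → (∀ {e} → e ∈ S′ → e ∈ S) → val S ≡ val S′
      val-set f g = val-⇔ (good-mono g) (good-mono f) (cnt-set (π-mono f) (π-mono g))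

      -- `F` holds the edges already taken, `L` those still undecided; the sign counts only the
      -- edges taken from `L`.
      K : List Edge → List Edge → ℤ
      K L F = ∑ (sublists L) (λ S → sgn (length S) * val (S ++ F))

      K-∷ : ∀ e L F → K (e ∷ L) F ≡ - K L (e ∷ F) + K L F
      K-∷ e L F = trans (∑-sublists-∷ e L _) (cong (_+ K L F)
        (trans (∑-cong (sublists L) λ S →
            trans (cong (- sgn (length S) *_) (val-set (∈-shift⁺ S) (∈-shift⁻ S)))
                  (sym (ℤₚ.neg-distribˡ-* (sgn (length S)) _)))
          (∑-neg (sublists L) _)))

      K-bad : ∀ L {F} → ¬ Good F → K L F ≡ + 0
      K-bad L ¬p = ∑-zero (sublists L) λ S _ →
        trans (cong (sgn (length S) *_) (val-bad (¬p ∘ good-mono (∈ₚ.∈-++⁺ʳ S)))) (ℤₚ.*-zeroʳ (sgn (length S)))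

      K-drop : ∀ {e} L {F} → ¬ Good (e ∷ F) → K (e ∷ L) F ≡ K L F
      K-drop {e} L {F} ¬p = trans (K-∷ e L F)
        (trans (cong (λ z → - z + K L F) (K-bad L ¬p)) (ℤₚ.+-identityˡ _))

      K-drops : ∀ M L {F} → All (λ e → ¬ Good (e ∷ F)) M → K (M ++ L) F ≡ K L F
      K-drops []      L []       = refl
      K-drops (e ∷ M) L (¬p ∷ a) = trans (K-drop (M ++ L) ¬p) (K-drops M L a)

      -- Taking or leaving `e` changes nothing but the sign. This removes every `Y` that contains
      -- both ends of an edge or a vertex of `X`.
      K-cancel : ∀ {e} L {F} → (∀ S → val (e ∷ S) ≡ val S) → K (e ∷ L) F ≡ + 0
      K-cancel {e} L {F} inv = trans (K-∷ e L F)
        (trans (cong (λ z → - z + K L F) (∑-cong (sublists L) λ S → cong (sgn (length S) *_)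
                  (trans (sym (val-set (∈-shift⁺ S) (∈-shift⁻ S))) (inv (S ++ F)))))
               (ℤₚ.+-inverseˡ (K L F)))

      val-half : ∀ {x} → vlookup Y x ≡ true → ∀ S → val (half x ∷ S) ≡ val S
      val-half {x} ix S = val-⇔ {half x ∷ S} {S} (good-mono there) (good-half ix) refl

      π-inside : ∀ {u v g} → vlookup Y u ≡ true → ∀ S → π (link u v g ∷ S) ≡ π S
      π-inside iu S rewrite iu = refl

      π-outside : ∀ {u v g} → vlookup Y u ≡ false → vlookup Y v ≡ false → ∀ S → π (link u v g ∷ S) ≡ (u , v) ∷ π S
      π-outside ou ov S rewrite ou | ov = refl

      val-inside : ∀ {u v g} → vlookup Y u ≡ true → vlookup Y v ≡ true → ∀ S → val (link u v g ∷ S) ≡ val S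
      val-inside {u} {v} {g} iu iv S = val-⇔ {link u v g ∷ S} {S} (good-mono there) (good-inside iu iv) (cong cnt (π-inside {u} {v} {g} iu S))

      K-halves : ∀ X xs {F} → Good F → K (halves X xs) F ≡ when (disjointOn X Y xs) (h (cnt (π F)))
      K-halves X [] p = trans (ℤₚ.+-identityʳ _) (trans (ℤₚ.*-identityˡ _) (val-good p))
      K-halves X (x ∷ xs) p with vlookup X x | vlookup Y x in ix
      ... | false | true  = K-halves X xs p
      ... | false | false = K-halves X xs p
      ... | true  | true  = K-cancel (halves X xs) (val-half ix)
      ... | true  | false = trans (K-drop (halves X xs) (λ q → true≢false (trans (sym (halfIn q (here refl))) ix)))
                                  (K-halves X xs p)

      -- Two copies of `uv` with different gains cannot obey the same potential, so at most one copy
      -- is taken.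
      K-block : ∀ {u v} L {F} ks → vlookup Y u ≡ false → Unique ks →
        K (map (lift u v) ks ++ L) F ≡ - ∑ ks (λ k → K L (lift u v k ∷ F)) + K L F
      K-block L [] ou [] = sym (ℤₚ.+-identityˡ _)
      K-block {u} {v} L {F} (k ∷ ks) ou (k∉ ∷ uniq) = begin
        K (lift u v k ∷ M ++ L) F
          ≡⟨ K-∷ (lift u v k) (M ++ L) F ⟩
        - K (M ++ L) (lift u v k ∷ F) + K (M ++ L) F
          ≡⟨ cong₂ (λ a b → - a + b) (K-drops M L (Allₚ.map⁺ (All.map clash k∉))) (K-block L ks ou uniq) ⟩
        - K L (lift u v k ∷ F) + (- D + K L F)
          ≡⟨ lemma (K L (lift u v k ∷ F)) D (K L F) ⟩
        - (K L (lift u v k ∷ F) + D) + K L F ∎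
        where
        open ≡-Reasoning
        M = map (lift u v) ks
        D = ∑ ks (λ k → K L (lift u v k ∷ F))
        lemma : ∀ a b c → - a + (- b + c) ≡ - (a + b) + c
        lemma = solve-∀
        clash : ∀ {k′} → k ≢ k′ → ¬ Good (lift u v k′ ∷ lift u v k ∷ F)
        clash k≢k′ q = k≢k′ (enum-inj _ _
          (≈-trans (potential q (there (here refl)) ou) (≈-sym (potential q (here refl) ou))))

      -- The sum over gains carried out: `P` is the part outside `Y` already taken, and every
      -- component lost between `P` and `T ++ P` stands for one free choice among `suc γ` gains.
      R : List (Fin n × Fin n) → List (Fin n × Fin n) → ℤ
      R Es P = ∑ (sublists Es) (λ T → sgn (length T) * (+ (suc γ ^ (cnt P ∸ cnt (T ++ P))) * h (cnt (T ++ P))))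

      -- Component counts only go down, so the exponent of `suc γ` splits at the intermediate set
      -- `e ∷ P`.
      R-∷ : ∀ e Es P → cnt (e ∷ P) ℕ.≤ cnt P →
        R (e ∷ Es) P ≡ - (+ (suc γ ^ (cnt P ∸ cnt (e ∷ P))) * R Es (e ∷ P)) + R Es P
      R-∷ e Es P le = trans (∑-sublists-∷ e Es _) (cong (_+ R Es P)
        (trans (∑-cong (sublists Es) eq)
          (trans (∑-neg (sublists Es) _) (cong -_ (∑-*ˡ (sublists Es) (+ (suc γ ^ (cnt P ∸ cnt (e ∷ P)))) _)))))
        where
        open ≡-Reasoning
        lemma : ∀ s a b x → - s * (a * b * x) ≡ - (a * (s * (b * x)))
        lemma = solve-∀
        eq : ∀ T → - sgn (length T) * (+ (suc γ ^ (cnt P ∸ cnt ((e ∷ T) ++ P))) * h (cnt ((e ∷ T) ++ P)))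
          ≡ - (+ (suc γ ^ (cnt P ∸ cnt (e ∷ P))) *
               (sgn (length T) * (+ (suc γ ^ (cnt (e ∷ P) ∸ cnt (T ++ e ∷ P))) * h (cnt (T ++ e ∷ P)))))
        eq T = begin
          - sgn (length T) * (+ (suc γ ^ (cnt P ∸ cnt ((e ∷ T) ++ P))) * h (cnt ((e ∷ T) ++ P)))
            ≡⟨ cong (λ m → - sgn (length T) * (+ (suc γ ^ (cnt P ∸ m)) * h m)) (cnt-shift e T P) ⟩
          - sgn (length T) * (+ (suc γ ^ (cnt P ∸ m)) * h m)
            ≡⟨ cong (λ q → - sgn (length T) * (q * h m)) (trans (cong +_ pow) (ℤₚ.pos-* (suc γ ^ a) (suc γ ^ b))) ⟩
          - sgn (length T) * (+ (suc γ ^ a) * + (suc γ ^ b) * h m)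
            ≡⟨ lemma (sgn (length T)) (+ (suc γ ^ a)) (+ (suc γ ^ b)) (h m) ⟩
          - (+ (suc γ ^ a) * (sgn (length T) * (+ (suc γ ^ b) * h m))) ∎
          where
          m = cnt (T ++ e ∷ P)
          a = cnt P ∸ cnt (e ∷ P)
          b = cnt (e ∷ P) ∸ m
          m≤ : m ℕ.≤ cnt (e ∷ P)
          m≤ = cnt-anti (owalk-mono (∈ₚ.∈-++⁺ʳ T))
          pow : suc γ ^ (cnt P ∸ m) ≡ suc γ ^ a ℕ.* suc γ ^ b
          pow = trans (cong (suc γ ^_) (sym (trans (sym (ℕₚ.+-∸-assoc a m≤)) (cong (_∸ m) (ℕₚ.m∸n+n≡m le)))))
                      (ℕₚ.^-distribˡ-+-* (suc γ) a b)

      -- A new edge uv has a single consistent gain if u, v are already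
      -- connected, and otherwise all gains are consistent but there is one component less.
      K-expand : ∀ X xs Es {F} → Good F → K (concatMap block Es ++ halves X xs) F
        ≡ when (noneInside Y Es) (when (disjointOn X Y xs) (R (avoid Y Es) (π F)))
      K-expand X xs [] {F} p = trans (K-halves X xs p) (when-cong (disjointOn X Y xs) λ _ →
        sym (trans (ℤₚ.+-identityʳ _) (trans (ℤₚ.*-identityˡ _)
          (trans (cong (λ k → + (suc γ ^ k) * h (cnt (π F))) (ℕₚ.n∸n≡0 (cnt (π F)))) (ℤₚ.*-identityˡ _)))))
      K-expand X xs ((u , v) ∷ Es) {F} p = trans
        (cong (λ L → K L F) (Listₚ.++-assoc (block (u , v)) (concatMap block Es) (halves X xs))) go
        where
        L = concatMap block Es ++ halves X xs
        cond : ℤ → ℤ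
        cond x = when (noneInside Y Es) (when (disjointOn X Y xs) x)
        go : K (block (u , v) ++ L) F ≡ when (noneInside Y ((u , v) ∷ Es)) (when (disjointOn X Y xs) (R (avoid Y ((u , v) ∷ Es)) (π F)))
        go with vlookup Y u in eu | vlookup Y v in ev
        -- A single copy of the link is enough for the cancellation; a first copy exists because the
        -- group order is a successor.
        ... | true  | true  = K-cancel (map (lift u v) (tabulate suc) ++ L) (val-inside eu ev)
        -- A link between `Y` and its complement violates `closed`, so none of its copies can be
        -- taken.
        ... | true  | false = trans (K-drops (block (u , v)) L (Allₚ.map⁺ (All.universal
                (λ k q → true≢false (trans (sym eu) (trans (closed q (here refl)) ev))) (allFin (suc γ)))))
                (K-expand X xs Es p)
        ... | false | true  = trans (K-drops (block (u , v)) L (Allₚ.map⁺ (All.universal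
                (λ k q → true≢false (trans (sym ev) (trans (sym (closed q (here refl))) eu))) (allFin (suc γ)))))
                (K-expand X xs Es p)
        ... | false | false = trans (K-block {u} {v} L (allFin (suc γ)) eu (Uniqueₚ.allFin⁺ (suc γ)))
                (trans (cong₂ (λ a b → - a + b) (sum (owalk? (isCnt (π F)) u v)) (K-expand X xs Es p))
                  (trans (distr (noneInside Y Es) (disjointOn X Y xs))
                    (cong cond (sym (R-∷ (u , v) (avoid Y Es) (π F) (cnt-anti (owalk-mono there)))))))
          where
          P = π F
          a = + (suc γ ^ (cnt P ∸ cnt ((u , v) ∷ P)))
          IH : ∀ k → Good (lift u v k ∷ F) → K L (lift u v k ∷ F) ≡ cond (R (avoid Y Es) ((u , v) ∷ P))
          IH k q = trans (K-expand X xs Es q) (cong (λ P′ → cond (R (avoid Y Es) P′)) (π-outside {u} {v} {enum k} eu ev F))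
          sum : Dec (OWalk P u v) → ∑ (allFin (suc γ)) (λ k → K L (lift u v k ∷ F)) ≡ a * cond (R (avoid Y Es) ((u , v) ∷ P))
          sum (yes uv) =
            trans (∑-allFin-single (suc γ) k₀ _ λ i i≢k₀ → K-bad L λ q →
                     i≢k₀ (enum-inj _ _ (≈-trans (good-consistent⁻ p eu uv q) (≈-sym k₀≈))))
              (trans (IH k₀ (good-consistent p eu ev k₀≈))
                (trans (sym (ℤₚ.*-identityˡ _)) (cong (λ m → + (suc γ ^ m) * cond (R (avoid Y Es) ((u , v) ∷ P)))
                  (sym (trans (cong (cnt P ∸_) (cnt-loop uv)) (ℕₚ.n∸n≡0 (cnt P)))))))
            where
            k₀  = proj₁ (enum-surj (diff (θ p u) (θ p v)))
            k₀≈ = proj₂ (enum-surj (diff (θ p u) (θ p v)))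
          sum (no ¬uv) =
            trans (∑-cong (allFin (suc γ)) λ k → IH k (good-merge p (isCnt P) eu ev ¬uv))
              (trans (∑-allFin-const (suc γ) _)
                (cong (λ m → + m * cond (R (avoid Y Es) ((u , v) ∷ P)))
                  (sym (trans (cong (suc γ ^_) (trans (cong (_∸ cnt ((u , v) ∷ P)) (cnt-merge ¬uv))
                                                      (ℕₚ.m+n∸n≡m 1 (cnt ((u , v) ∷ P)))))
                              (ℕₚ.*-identityʳ (suc γ))))))
          distr : ∀ b c {y z} → - (a * when b (when c y)) + when b (when c z) ≡ when b (when c (- (a * y) + z))
          distr true  true  = refl
          distr true  false = cong (λ x → - x + + 0) (ℤₚ.*-zeroʳ a)
          distr false c     = cong (λ x → - x + + 0) (ℤₚ.*-zeroʳ a)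

-- Balanced components

false-iff⇒≡ : ∀ {p q : Bool} → (p ≡ false → q ≡ false) → (q ≡ false → p ≡ false) → p ≡ q
false-iff⇒≡ {true}  {true}  f g = refl
false-iff⇒≡ {true}  {false} f g = g refl
false-iff⇒≡ {false} {q}     f g = sym (f refl)

not-true : ∀ {p} → not p ≡ true → p ≡ false
not-true {false} _ = refl

+-≡ᵇ-∸ : ∀ b {i n} → i ℕ.≤ n → (b ℕ.+ i ≡ᵇ n) ≡ (b ≡ᵇ (n ∸ i))
+-≡ᵇ-∸ b {zero}  ℕ.z≤n     = cong (_≡ᵇ _) (ℕₚ.+-identityʳ b)
+-≡ᵇ-∸ b {suc i} {suc n} (ℕ.s≤s le) = trans (cong (_≡ᵇ suc n) (ℕₚ.+-suc b i)) (+-≡ᵇ-∸ b le)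

module Balanced {c ℓ : Level} (G : Group c ℓ) {n γ : ℕ} (enum : Fin (suc γ) → Group.Carrier G)
  (enum-inj : ∀ a b → Group._≈_ G (enum a) (enum b) → a ≡ b)
  (enum-surj : ∀ g → ∃ λ k → Group._≈_ G (enum k) g)
  (cnt : List (Fin n × Fin n) → ℕ) (isCnt : ∀ S → CompCount S (cnt S)) where

  open Gain G (Fin n)
  open Potentials G {n}
  open Lifting G enum enum-inj enum-surj cnt isCnt
  open Outside

  module _ {S : List Edge} {k : ℕ} (bal : BalCount S k) where

    private
      r : Fin k → Fin n
      r = proj₁ bal
      U = underlying S

      r-inj : ∀ {i j} → OWalk U (r i) (r j) → i ≡ j
      r-inj w = proj₁ (proj₂ bal) _ _ (owalk⇒walk w)

      r-balanced : ∀ i → BalancedComp S (r i)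
      r-balanced = proj₁ (proj₂ (proj₂ bal))

      r-cover : ∀ v → BalancedComp S v → ∃ λ i → OWalk U v (r i)
      r-cover v bv = let (i , w) = proj₂ (proj₂ (proj₂ bal)) v bv in i , walk⇒owalk w

    chosen? : ∀ Q v → Dec (∃ λ i → vlookup Q i ≡ true × OWalk U v (r i))
    chosen? Q v = Finₚ.any? λ i → (vlookup Q i Bool.≟ true) ×-dec owalk? (isCnt U) v (r i)

    -- φ Q is the complement of the union of the components chosen by Q; φ and ψ
    -- are inverse bijections between sets of balanced components and sets Y with Good Y S.
    φ : Subset k → Subset n
    φ Q = Vec.tabulate λ v → not (does (chosen? Q v))

    ψ : Subset n → Subset k
    ψ Y = Vec.tabulate λ i → not (vlookup Y (r i))

    φ-out : ∀ Q {v} → vlookup (φ Q) v ≡ false → ∃ λ i → vlookup Q i ≡ true × OWalk U v (r i)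
    φ-out Q {v} e with chosen? Q v | trans (sym (Vecₚ.lookup∘tabulate (λ v → not (does (chosen? Q v))) v)) e
    ... | yes p | _ = p

    φ-out⁻ : ∀ Q {v i} → vlookup Q i ≡ true → OWalk U v (r i) → vlookup (φ Q) v ≡ false
    φ-out⁻ Q {v} {i} e w = trans (Vecₚ.lookup∘tabulate _ v) (cong not (dec-true (chosen? Q v) (i , e , w)))

    ψ-in : ∀ Y i → vlookup (ψ Y) i ≡ true → vlookup Y (r i) ≡ false
    ψ-in Y i e = not-true (trans (sym (Vecₚ.lookup∘tabulate _ i)) e)

    ψ-in⁻ : ∀ Y i → vlookup Y (r i) ≡ false → vlookup (ψ Y) i ≡ true
    ψ-in⁻ Y i e = trans (Vecₚ.lookup∘tabulate _ i) (cong not e)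

    ψ-φ : ∀ Q → ψ (φ Q) ≡ Q
    ψ-φ Q = trans (Vecₚ.tabulate-cong pointwise) (Vecₚ.tabulate∘lookup Q)
      where
      pointwise : ∀ i → not (vlookup (φ Q) (r i)) ≡ vlookup Q i
      pointwise i with vlookup Q i in eq | vlookup (φ Q) (r i) in eq′
      ... | true  | false = refl
      ... | true  | true  = trans (sym (φ-out⁻ Q eq here)) eq′
      ... | false | true  = refl
      ... | false | false = let (j , e , w) = φ-out Q eq′ in
        trans (sym e) (trans (cong (vlookup Q) (sym (r-inj w))) eq)

    -- The complement of `φ Q` is a union of balanced components: no link leaves it, it carries no
    -- half edge, and its circles are neutral.
    good-φ : ∀ Q → Good (φ Q) S
    good-φ Q = balanced⇒good (φ Q) cnt isCnt S
      (λ e → let xy = owalk-edge (underlying⁺ {S} e) in false-iff⇒≡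
        (λ ox → let (i , q , w) = φ-out Q ox in φ-out⁻ Q q (owalk-trans (owalk-sym xy) w))
        (λ oy → let (i , q , w) = φ-out Q oy in φ-out⁻ Q q (owalk-trans xy w)))
      halfIn
      (λ Z ow circ → let (i , _ , w) = φ-out Q ow in proj₂ (r-balanced i) _ Z (owalk⇒walk (owalk-sym w)) circ)
      where
      halfIn : ∀ {x} → half x ∈ S → vlookup (φ Q) x ≡ true
      halfIn {x} e with vlookup (φ Q) x in ox
      ... | true  = refl
      ... | false = let (i , _ , w) = φ-out Q ox in
                    contradiction e (proj₁ (r-balanced i) x (owalk⇒walk (owalk-sym w)))

    module _ {Y : Subset n} (p : Good Y S) where

      stays : ∀ {x y} → OWalk U x y → vlookup Y x ≡ vlookup Y y
      stays w = walk-stays Y (Good.closed p) (owalk⇒walk {S} w)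

      outside-rep : ∀ v → vlookup Y v ≡ false → ∃ λ i → vlookup (ψ Y) i ≡ true × OWalk U v (r i)
      outside-rep v ov = let (i , w) = r-cover v (good⇒balanced Y p ov) in
        i , ψ-in⁻ Y i (trans (sym (stays w)) ov) , w

      φ-ψ : φ (ψ Y) ≡ Y
      φ-ψ = trans (sym (Vecₚ.tabulate∘lookup (φ (ψ Y)))) (trans (Vecₚ.tabulate-cong pointwise) (Vecₚ.tabulate∘lookup Y))
        where
        pointwise : ∀ v → vlookup (φ (ψ Y)) v ≡ vlookup Y v
        pointwise v = false-iff⇒≡
          (λ o → let (i , q , w) = φ-out (ψ Y) o in trans (stays w) (ψ-in Y i q))
          (λ o → let (i , q , w) = outside-rep v o in φ-out⁻ (ψ Y) q w)

      -- In `π Y S` the vertices of `Y` are isolated and the other vertices form exactly the chosen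
      -- balanced components.
      ∣ψ∣ : ∣ ψ Y ∣ ≡ cnt (π Y S) ∸ ∣ Y ∣
      ∣ψ∣ = trans (sym (ℕₚ.m+n∸n≡m ∣ ψ Y ∣ ∣ Y ∣)) (cong (_∸ ∣ Y ∣) (count-≡ count (isCnt (π Y S)) id id))
        where
        count : CompCount (π Y S) (∣ ψ Y ∣ ℕ.+ ∣ Y ∣)
        count = count-avoiding Y (avoid-Avoids Y U) (r ∘ elems (ψ Y))
          (λ i → ψ-in Y (elems (ψ Y) i) (elems-∈ (ψ Y) i))
          (λ i j w → elems-injective (ψ Y) i j (r-inj (owalk-mono (avoid-⊆ Y U) w)))
          (λ v ov → let (i , q , w) = outside-rep v ov
                        (j , e)     = elems-surjective (ψ Y) i q in
             j , walk⇒owalk-π Y (Good.closed p) (owalk⇒walk {S} (subst (λ i → OWalk U v (r i)) (sym e) w)) ov)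

    -- Replaces an index set that varies with `S` by a fixed one, so that the sum over `Y` can be
    -- moved outside the sum over `S`.
    ∑-balanced : ∀ (g : ℕ → ℤ) → ∑ (allSubsets k) (λ Q → g ∣ Q ∣)
      ≡ ∑ (allSubsets n) (λ Y → val Y (λ m → g (m ∸ ∣ Y ∣)) S)
    ∑-balanced g = begin
      ∑ (allSubsets k) (λ Q → g ∣ Q ∣)
        ≡⟨ ∑-cong (allSubsets k) (λ Q → sym (∑-allSubsets-δ n (φ Q) (λ _ → g ∣ Q ∣))) ⟩
      ∑ (allSubsets k) (λ Q → ∑ (allSubsets n) (λ Y → when (does (Y ≟ˢ φ Q)) (g ∣ Q ∣)))
        ≡⟨ ∑-swap (allSubsets k) (allSubsets n) _ ⟩
      ∑ (allSubsets n) (λ Y → ∑ (allSubsets k) (λ Q → when (does (Y ≟ˢ φ Q)) (g ∣ Q ∣)))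
        ≡⟨ ∑-cong (allSubsets n) (λ Y → fibre Y (good? Y S)) ⟩
      ∑ (allSubsets n) (λ Y → val Y (λ m → g (m ∸ ∣ Y ∣)) S) ∎
      where
      open ≡-Reasoning
      fibre : ∀ Y → Dec (Good Y S) → ∑ (allSubsets k) (λ Q → when (does (Y ≟ˢ φ Q)) (g ∣ Q ∣)) ≡ val Y (λ m → g (m ∸ ∣ Y ∣)) S
      fibre Y (no ¬p) = trans
        (∑-zero (allSubsets k) λ Q _ → cong (λ b → when b (g ∣ Q ∣))
          (dec-false (Y ≟ˢ φ Q) λ e → ¬p (subst (λ Y → Good Y S) (sym e) (good-φ Q))))
        (sym (val-bad Y (λ m → g (m ∸ ∣ Y ∣)) ¬p))
      fibre Y (yes p) = trans
        (∑-cong (allSubsets k) λ Q → cong (λ b → when b (g ∣ Q ∣))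
          (does-⇔ (mk⇔ (λ e → trans (sym (ψ-φ Q)) (cong ψ (sym e))) (λ e → trans (sym (φ-ψ p)) (cong φ (sym e))))
                  (Y ≟ˢ φ Q) (Q ≟ˢ ψ Y)))
        (trans (∑-allSubsets-δ k (ψ Y) (λ Q → g ∣ Q ∣)) (trans (cong g (∣ψ∣ p)) (sym (val-good Y (λ m → g (m ∸ ∣ Y ∣)) p))))

  -- Here `cnt T ∸ ∣ Y ∣` is the number `s` of chosen balanced components, and `binv (n ∸ i)` reads
  -- the coefficient of `λ^(n−i)` off `(λ − 1)^s`.
  gainWhitney-expansion : (Γ : SimpleGraph n) (X : Subset n) (b : List Edge → ℕ) → (∀ S → BalCount S (b S)) →
    ∀ i → i ℕ.≤ n → gainWhitney n (expansionEdges G enum Γ X) b i ≡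
      sgn i * ∑ (allSubsets n) (λ Y → when (noneInside Y (edgesOf Γ)) (when (disjointOn X Y (allFin n))
        (∑ (sublists (avoid Y (edgesOf Γ))) (λ T →
          sgn (length T) * (+ (suc γ ^ (n ∸ cnt T)) * binv (n ∸ i) (cnt T ∸ ∣ Y ∣))))))
  gainWhitney-expansion Γ X b isB i i≤n = cong (sgn i *_) (begin
    ∑ (sublists Φ) (λ S → when ((b S ℕ.+ i) ≡ᵇ n) (sgn (length S)))
      ≡⟨ ∑-cong (sublists Φ) summand ⟩
    ∑ (sublists Φ) (λ S → ∑ (allSubsets n) (λ Y → sgn (length S) * val Y (h Y) (S ++ [])))
      ≡⟨ ∑-swap (sublists Φ) (allSubsets n) _ ⟩
    ∑ (allSubsets n) (λ Y → K Y (h Y) Φ [])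
      ≡⟨ ∑-cong (allSubsets n) (λ Y → trans (cong (λ L → K Y (h Y) L []) (Expansion.expansionEdges-≡ G enum Γ X)) (K-expand Y (h Y) X (allFin n) E (good-[] Y))) ⟩
    ∑ (allSubsets n) (λ Y → when (noneInside Y E) (when (disjointOn X Y (allFin n)) (R Y (h Y) (avoid Y E) [])))
      ≡⟨ ∑-cong (allSubsets n) (λ Y → when-cong (noneInside Y E) λ _ → when-cong (disjointOn X Y (allFin n)) λ _ →
           ∑-cong (sublists (avoid Y E)) λ T → cong (sgn (length T) *_)
             (cong₂ (λ m T → + (suc γ ^ (m ∸ cnt T)) * h Y (cnt T)) cnt-[] (Listₚ.++-identityʳ T))) ⟩
    _ ∎)
    where
    open ≡-Reasoning
    E = edgesOf Γ
    Φ = expansionEdges G enum Γ X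
    h : Subset n → ℕ → ℤ
    h Y m = binv (n ∸ i) (m ∸ ∣ Y ∣)
    cnt-[] : cnt [] ≡ n
    cnt-[] = count-≡ (isCnt []) (count-[] n) id id
    summand : ∀ S → when ((b S ℕ.+ i) ≡ᵇ n) (sgn (length S)) ≡ ∑ (allSubsets n) (λ Y → sgn (length S) * val Y (h Y) (S ++ []))
    summand S = begin
      when ((b S ℕ.+ i) ≡ᵇ n) (sgn (length S))
        ≡⟨ cong (λ q → when q (sgn (length S))) (+-≡ᵇ-∸ (b S) i≤n) ⟩
      when (b S ≡ᵇ (n ∸ i)) (sgn (length S))
        ≡⟨ cong (when (b S ≡ᵇ (n ∸ i))) (sym (ℤₚ.*-identityʳ (sgn (length S)))) ⟩
      when (b S ≡ᵇ (n ∸ i)) (sgn (length S) * + 1)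
        ≡⟨ sym (when-*ˡ (b S ≡ᵇ (n ∸ i)) (sgn (length S)) (+ 1)) ⟩
      sgn (length S) * when (b S ≡ᵇ (n ∸ i)) (+ 1)
        ≡⟨ cong (sgn (length S) *_) (sym (∑-binv (b S) (n ∸ i))) ⟩
      sgn (length S) * ∑ (allSubsets (b S)) (λ Q → binv (n ∸ i) ∣ Q ∣)
        ≡⟨ cong (sgn (length S) *_) (∑-balanced (isB S) (binv (n ∸ i))) ⟩
      sgn (length S) * ∑ (allSubsets n) (λ Y → val Y (h Y) S)
        ≡⟨ cong (λ S′ → sgn (length S) * ∑ (allSubsets n) (λ Y → val Y (h Y) S′)) (sym (Listₚ.++-identityʳ S)) ⟩
      sgn (length S) * ∑ (allSubsets n) (λ Y → val Y (h Y) (S ++ []))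
        ≡⟨ sym (∑-*ˡ (allSubsets n) (sgn (length S)) _) ⟩
      ∑ (allSubsets n) (λ Y → sgn (length S) * val Y (h Y) (S ++ [])) ∎

-- Vertex deletion and isolated vertices

true-iff⇒≡ : ∀ {p q : Bool} → (p ≡ true → q ≡ true) → (q ≡ true → p ≡ true) → p ≡ q
true-iff⇒≡ {false} {false} f g = refl
true-iff⇒≡ {false} {true}  f g = g refl
true-iff⇒≡ {true}  {q}     f g = sym (f refl)

∧-true : ∀ {p q} → p ∧ q ≡ true → p ≡ true × q ≡ true
∧-true {true} {true} _ = refl , refl

<ᵇ-true : ∀ {m n} → m ℕ.< n → (m <ᵇ n) ≡ true
<ᵇ-true {zero}  (ℕ.s≤s _) = refl
<ᵇ-true {suc m} (ℕ.s≤s p) = <ᵇ-true p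

<ᵇ-false : ∀ {m n} → n ℕ.≤ m → (m <ᵇ n) ≡ false
<ᵇ-false ℕ.z≤n     = refl
<ᵇ-false (ℕ.s≤s p) = <ᵇ-false p

≡ᵇ-false : ∀ {m n} → m ≢ n → (m ≡ᵇ n) ≡ false
≡ᵇ-false {zero}  {zero}  e = contradiction refl e
≡ᵇ-false {zero}  {suc n} e = refl
≡ᵇ-false {suc m} {zero}  e = refl
≡ᵇ-false {suc m} {suc n} e = ≡ᵇ-false (e ∘ cong suc)

module _ {a} {A : Set a} where

  and⁺ : (f : A → Bool) (L : List A) → (∀ x → f x ≡ true) → and (map f L) ≡ true
  and⁺ f []      h = refl
  and⁺ f (x ∷ L) h rewrite h x = and⁺ f L h

  and⁻ : (f : A → Bool) (L : List A) → and (map f L) ≡ true → ∀ {x} → x ∈ L → f x ≡ true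
  and⁻ f (x ∷ L) h (here refl) = proj₁ (∧-true h)
  and⁻ f (x ∷ L) h (there p)   = and⁻ f L (proj₂ (∧-true {f x} h)) p

  and-false : (f : A → Bool) (L : List A) → and (map f L) ≡ false → ∃ λ x → f x ≡ false
  and-false f (x ∷ L) h with f x in e
  ... | false = x , e
  ... | true  = and-false f L h

  sublists-⊆ : ∀ (L : List A) {S} → S ∈ sublists L → ∀ {e} → e ∈ S → e ∈ L
  sublists-⊆ [] (here refl) ()
  sublists-⊆ (x ∷ L) p e with ∈ₚ.∈-++⁻ (map (x ∷_) (sublists L)) p
  ... | inj₂ q = there (sublists-⊆ L q e)
  ... | inj₁ q with ∈ₚ.∈-map⁻ (x ∷_) q
  sublists-⊆ (x ∷ L) p (here refl) | inj₁ q | _ , _ , refl  = here refl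
  sublists-⊆ (x ∷ L) p (there e)   | inj₁ q | _ , q′ , refl = there (sublists-⊆ L q′ e)

  length-filter-tabulate : ∀ {n} (f : A → Bool) (g : Fin n → A) →
    length (filter (λ v → f v Bool.≟ true) (tabulate g)) ≡ ∣ Vec.tabulate (f ∘ g) ∣
  length-filter-tabulate {zero}  f g = refl
  length-filter-tabulate {suc n} f g with f (g zero)
  ... | true  = cong suc (length-filter-tabulate f (g ∘ suc))
  ... | false = length-filter-tabulate f (g ∘ suc)

∣Y∣≡0⇒⊥ : ∀ {n} (Y : Subset n) → ∣ Y ∣ ≡ 0 → Y ≡ ⊥
∣Y∣≡0⇒⊥ []          _ = refl
∣Y∣≡0⇒⊥ (false ∷ Y) e = cong (false ∷_) (∣Y∣≡0⇒⊥ Y e)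

⊆ᵇ-true : ∀ {n} (Y I : Subset n) → (Y ⊆ᵇ I) ≡ true → ∀ v → vlookup Y v ≡ true → vlookup I v ≡ true
⊆ᵇ-true (true ∷ Y) (true ∷ I) h zero    e = refl
⊆ᵇ-true (y ∷ Y)    (i ∷ I)    h (suc v) e = ⊆ᵇ-true Y I (proj₂ (∧-true {not y ∨ i} h)) v e

⊆ᵇ-false : ∀ {n} (Y I : Subset n) → (Y ⊆ᵇ I) ≡ false → ∃ λ v → vlookup Y v ≡ true × vlookup I v ≡ false
⊆ᵇ-false []          []          ()
⊆ᵇ-false (true ∷ Y)  (false ∷ I) h = zero , refl , refl
⊆ᵇ-false (true ∷ Y)  (true ∷ I)  h = let (v , p) = ⊆ᵇ-false Y I h in suc v , p
⊆ᵇ-false (false ∷ Y) (i ∷ I)     h = let (v , p) = ⊆ᵇ-false Y I h in suc v , p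

noneInside⁻ : ∀ {n} (Y : Subset n) Es → noneInside Y Es ≡ true →
  ∀ {u v} → (u , v) ∈ Es → vlookup Y u ≡ true → vlookup Y v ≡ false
noneInside⁻ Y ((u , v) ∷ Es) h (here refl) iu rewrite iu = not-true (proj₁ (∧-true h))
noneInside⁻ Y ((u , v) ∷ Es) h (there e)   iu = noneInside⁻ Y Es (proj₂ (∧-true {not (vlookup Y u ∧ vlookup Y v)} h)) e iu

noneInside⁺ : ∀ {n} (Y : Subset n) Es → (∀ {u v} → (u , v) ∈ Es → vlookup Y u ≡ true → vlookup Y v ≡ false) →
  noneInside Y Es ≡ true
noneInside⁺ Y []             h = refl
noneInside⁺ Y ((u , v) ∷ Es) h with vlookup Y u in iu
... | false = noneInside⁺ Y Es (h ∘ there)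
... | true rewrite h (here refl) iu = noneInside⁺ Y Es (h ∘ there)

disjointOn⁻ : ∀ {n} (X Y : Subset n) xs → disjointOn X Y xs ≡ true →
  ∀ {x} → x ∈ xs → vlookup Y x ≡ true → vlookup X x ≡ false
disjointOn⁻ X Y (x ∷ xs) h (here refl) iu rewrite iu = not-true (proj₁ (∧-true h))
disjointOn⁻ X Y (x ∷ xs) h (there e)   iu = disjointOn⁻ X Y xs (proj₂ (∧-true {not (vlookup Y x ∧ vlookup X x)} h)) e iu

disjointOn⁺ : ∀ {n} (X Y : Subset n) xs → (∀ {x} → vlookup Y x ≡ true → vlookup X x ≡ false) →
  disjointOn X Y xs ≡ true
disjointOn⁺ X Y []       h = refl
disjointOn⁺ X Y (x ∷ xs) h with vlookup Y x in iu
... | false = disjointOn⁺ X Y xs h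
... | true rewrite h iu = disjointOn⁺ X Y xs h

avoid-disjoint : ∀ {n} (Y : Subset n) Es → Avoids Y Es → avoid Y Es ≡ Es
avoid-disjoint Y []             a = refl
avoid-disjoint Y ((u , v) ∷ Es) a rewrite proj₁ (a (here refl)) | proj₂ (a (here refl)) =
  cong ((u , v) ∷_) (avoid-disjoint Y Es (a ∘ there))

module _ {n : ℕ} (Γ : SimpleGraph n) where

  private
    E = edgesOf Γ

  edgesOf⁻ : ∀ {u v} → (u , v) ∈ E → (Fin.toℕ u <ᵇ Fin.toℕ v) ≡ true × adj Γ u v ≡ true
  edgesOf⁻ {u} {v} p with ∈ₚ.∈-concatMap⁻ _ {xs = allFin n} p
  ... | q with find q
  ...   | u′ , _ , q₁ with find (∈ₚ.∈-concatMap⁻ _ {xs = allFin n} q₁)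
  ...     | v′ , _ , q₂ with (Fin.toℕ u′ <ᵇ Fin.toℕ v′) ∧ adj Γ u′ v′ in e
  edgesOf⁻ p | q | u′ , _ , q₁ | v′ , _ , here refl | true = ∧-true e

  edgesOf⁺ : ∀ {u v} → (Fin.toℕ u <ᵇ Fin.toℕ v) ≡ true → adj Γ u v ≡ true → (u , v) ∈ E
  edgesOf⁺ {u} {v} lt a = ∈ₚ.∈-concatMap⁺ _ (lose (∈ₚ.∈-allFin u) (∈ₚ.∈-concatMap⁺ _ (lose (∈ₚ.∈-allFin v) inner)))
    where
    inner : (u , v) ∈ (if (Fin.toℕ u <ᵇ Fin.toℕ v) ∧ adj Γ u v then (u , v) ∷ [] else [])
    inner rewrite lt | a = here refl

  edge-adj : ∀ {u v} → (u , v) ∈ E → adj Γ u v ≡ true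
  edge-adj = proj₂ ∘ edgesOf⁻

  edge-irrefl : ∀ {u v} → (u , v) ∈ E → u ≢ v
  edge-irrefl {u} e refl = true≢false (trans (sym (edge-adj e)) (irrefl Γ u))

  adj⇒edge : ∀ {u v} → adj Γ u v ≡ true → (u , v) ∈ E ⊎ (v , u) ∈ E
  adj⇒edge {u} {v} a with ℕₚ.<-cmp (Fin.toℕ u) (Fin.toℕ v)
  ... | tri< u<v _ _ = inj₁ (edgesOf⁺ (<ᵇ-true u<v) a)
  ... | tri> _ _ v<u = inj₂ (edgesOf⁺ (<ᵇ-true v<u) (trans (SimpleGraph.sym Γ v u) a))
  ... | tri≈ _ e _ with refl ← Finₚ.toℕ-injective e = contradiction (trans (sym a) (irrefl Γ u)) true≢false

  stable⁻ : ∀ X Y → stableOutsideᵇ Γ X Y ≡ true →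
    (∀ {u} → vlookup Y u ≡ true → vlookup X u ≡ false) ×
    (∀ {u v} → vlookup Y u ≡ true → vlookup Y v ≡ true → adj Γ u v ≡ false)
  stable⁻ X Y h = outX , nonadj
    where
    at : ∀ u → _
    at u = ∧-true {not (vlookup Y u ∧ vlookup X u)} (and⁻ _ (allFin n) h (∈ₚ.∈-allFin u))
    outX : ∀ {u} → vlookup Y u ≡ true → vlookup X u ≡ false
    outX {u} iu with p ← proj₁ (at u) rewrite iu = not-true p
    nonadj : ∀ {u v} → vlookup Y u ≡ true → vlookup Y v ≡ true → adj Γ u v ≡ false
    nonadj {u} {v} iu iv with p ← and⁻ _ (allFin n) (proj₂ (at u)) (∈ₚ.∈-allFin v) rewrite iu | iv = not-true p

  stable⁺ : ∀ X Y → (∀ {u} → vlookup Y u ≡ true → vlookup X u ≡ false) →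
    (∀ {u v} → vlookup Y u ≡ true → vlookup Y v ≡ true → adj Γ u v ≡ false) → stableOutsideᵇ Γ X Y ≡ true
  stable⁺ X Y outX nonadj = and⁺ _ (allFin n) λ u →
    cong₂ _∧_ (first u) (and⁺ _ (allFin n) (second u))
    where
    first : ∀ u → not (vlookup Y u ∧ vlookup X u) ≡ true
    first u with vlookup Y u in iu
    ... | false = refl
    ... | true  = cong not (outX iu)
    second : ∀ u v → not (vlookup Y u ∧ vlookup Y v ∧ adj Γ u v) ≡ true
    second u v with vlookup Y u in iu | vlookup Y v in iv
    ... | false | _     = refl
    ... | true  | false = refl
    ... | true  | true  = cong not (nonadj iu iv)

  stable-split : ∀ X Y → stableOutsideᵇ Γ X Y ≡ noneInside Y E ∧ disjointOn X Y (allFin n)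
  stable-split X Y = true-iff⇒≡
    (λ h → let (outX , nonadj) = stable⁻ X Y h in cong₂ _∧_
      (noneInside⁺ Y E λ {u} {v} e iu → Boolₚ.¬-not λ iv → true≢false (trans (sym (edge-adj e)) (nonadj iu iv)))
      (disjointOn⁺ X Y (allFin n) outX))
    (λ h → let (none , disj) = ∧-true {noneInside Y E} h in stable⁺ X Y
      (disjointOn⁻ X Y (allFin n) disj (∈ₚ.∈-allFin _))
      (λ iu iv → Boolₚ.¬-not λ a → [ (λ e → true≢false (trans (sym iv) (noneInside⁻ Y E none e iu)))
                                   , (λ e → true≢false (trans (sym iu) (noneInside⁻ Y E none e iv))) ]′ (adj⇒edge a)))

  isolatedᵇ : Subset n → Fin n → Bool
  isolatedᵇ X v = and (map (λ w → not (adj Γ v w)) (allFin n)) ∧ not (vlookup X v)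

  isolated : Subset n → Subset n
  isolated X = Vec.tabulate (isolatedᵇ X)

  ∣isolated∣ : ∀ X → zetaOf Γ X ≡ ∣ isolated X ∣
  ∣isolated∣ X = length-filter-tabulate (isolatedᵇ X) id

  isolated⁻ : ∀ X {v} → vlookup (isolated X) v ≡ true → (∀ w → adj Γ v w ≡ false) × vlookup X v ≡ false
  isolated⁻ X {v} h =
    let (p , q) = ∧-true {and (map (λ w → not (adj Γ v w)) (allFin n))} (trans (sym (Vecₚ.lookup∘tabulate (isolatedᵇ X) v)) h)
    in (λ w → not-true (and⁻ _ (allFin n) p (∈ₚ.∈-allFin w))) , not-true q

  isolated-false : ∀ X {v} → vlookup (isolated X) v ≡ false → vlookup X v ≡ false → ∃ λ w → adj Γ v w ≡ true
  isolated-false X {v} h ox with and (map (λ w → not (adj Γ v w)) (allFin n)) in e | trans (sym (Vecₚ.lookup∘tabulate (isolatedᵇ X) v)) h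
  ... | true  | h′ = contradiction (trans (sym (cong not ox)) h′) true≢false
  ... | false | _  = let (w , p) = and-false _ (allFin n) e in w , trans (sym (Boolₚ.not-involutive _)) (cong not p)

  isolated-edge : ∀ X {v w} → vlookup (isolated X) v ≡ true → ¬ ((v , w) ∈ E ⊎ (w , v) ∈ E)
  isolated-edge X {v} {w} i (inj₁ e) = true≢false (trans (sym (edge-adj e)) (proj₁ (isolated⁻ X i) w))
  isolated-edge X {v} {w} i (inj₂ e) = true≢false
    (trans (sym (trans (SimpleGraph.sym Γ v w) (edge-adj e))) (proj₁ (isolated⁻ X i) w))

  isolated-walk : ∀ X {v w} → vlookup (isolated X) v ≡ true → OWalk E v w → v ≡ w
  isolated-walk X i here       = refl
  isolated-walk X i (step e _) = contradiction e (isolated-edge X i)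

  ∣isolated∣≤ : ∀ X {k} → CompCount E k → ∣ isolated X ∣ ℕ.≤ k
  ∣isolated∣≤ X cc = Finₚ.injective⇒≤ {f = component cc ∘ elems (isolated X)} λ {i} {j} e →
    elems-injective (isolated X) i j (isolated-walk X (elems-∈ (isolated X) i) (component-≡⇒walk cc e))

  ⊆isolated⇒stable : ∀ X Y → (∀ v → vlookup Y v ≡ true → vlookup (isolated X) v ≡ true) → stableOutsideᵇ Γ X Y ≡ true
  ⊆isolated⇒stable X Y h = stable⁺ X Y (λ iu → proj₂ (isolated⁻ X (h _ iu))) (λ iu _ → proj₁ (isolated⁻ X (h _ iu)) _)

  ⊆isolated⇒avoid : ∀ X Y → (∀ v → vlookup Y v ≡ true → vlookup (isolated X) v ≡ true) → avoid Y E ≡ E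
  ⊆isolated⇒avoid X Y h = avoid-disjoint Y E λ e →
    Boolₚ.¬-not (λ i → isolated-edge X (h _ i) (inj₁ e)) , Boolₚ.¬-not (λ i → isolated-edge X (h _ i) (inj₂ e))

forget : ∀ {n} (Y : Subset n) → VMinus Y × VMinus Y → Fin n × Fin n
forget Y ((u , _) , (v , _)) = u , v

-- restrictEdge applies its with-function to proofs refl, so abstracting
-- vlookup Y u alone is ill-typed, and abstracting refl as well would also
-- rewrite the left-hand side of its type.  Writing Y as f a or f b, which are
-- convertible by η for ⊤ but syntactically different, protects that side.
map-forget-restrictEdge-η : ∀ {n} (f : ⊤ → Subset n) (a b : ⊤) u v →
  map (forget (f a)) (restrictEdge (f a) (u , v)) ≡ (if vlookup (f a) u ∨ vlookup (f a) v then [] else (u , v) ∷ [])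
map-forget-restrictEdge-η f a b u v
  with vlookup (f a) u | ((vlookup (f b) u ≡ vlookup (f a) u) ∋ refl)
     | vlookup (f a) v | ((vlookup (f b) v ≡ vlookup (f a) v) ∋ refl)
... | false | _ | false | _ = refl
... | false | _ | true  | _ = refl
... | true  | _ | _     | _ = refl

map-forget-restrictEdge : ∀ {n} (Y : Subset n) u v →
  map (forget Y) (restrictEdge Y (u , v)) ≡ (if vlookup Y u ∨ vlookup Y v then [] else (u , v) ∷ [])
map-forget-restrictEdge Y = map-forget-restrictEdge-η (λ _ → Y) tt tt

map-forget : ∀ {n} (Y : Subset n) Es → map (forget Y) (concatMap (restrictEdge Y) Es) ≡ avoid Y Es
map-forget Y [] = refl
map-forget Y ((u , v) ∷ Es) =
  trans (Listₚ.map-++ (forget Y) (restrictEdge Y (u , v)) (concatMap (restrictEdge Y) Es))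
  (trans (cong₂ _++_ (map-forget-restrictEdge Y u v) (map-forget Y Es)) (if-++ (vlookup Y u ∨ vlookup Y v)))
  where
  if-++ : ∀ p → (if p then [] else (u , v) ∷ []) ++ avoid Y Es ≡ (if p then avoid Y Es else (u , v) ∷ avoid Y Es)
  if-++ true  = refl
  if-++ false = refl

module _ {n : ℕ} (Y : Subset n) {T : List (VMinus Y × VMinus Y)} where

  -- Equality proofs in `Bool` are unique, so a walk may pass between different proofs that the same
  -- vertex lies outside `Y`.
  VMinus-≡ : {x y : VMinus Y} → proj₁ x ≡ proj₁ y → x ≡ y
  VMinus-≡ {v , p} {.v , q} refl = cong (v ,_) (Decidable⇒UIP.≡-irrelevant Bool._≟_ p q)

  forget-walk⁻ : ∀ {x y} → OWalk (map (forget Y) T) x y → (p : vlookup Y x ≡ false) →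
    ∃ λ q → OWalk T (x , p) (y , q)
  forget-walk⁻ here p = p , here
  forget-walk⁻ {x} (step (inj₁ e) w) p with ∈ₚ.∈-map⁻ (forget Y) e
  ... | ((_ , p′) , (_ , q′)) , e′ , refl with forget-walk⁻ w q′
  ...   | q , w′ = q , subst (λ x → OWalk T x _) (VMinus-≡ refl) (step (inj₁ e′) w′)
  forget-walk⁻ {x} (step (inj₂ e) w) p with ∈ₚ.∈-map⁻ (forget Y) e
  ... | ((_ , q′) , (_ , p′)) , e′ , refl with forget-walk⁻ w q′
  ...   | q , w′ = q , subst (λ x → OWalk T x _) (VMinus-≡ refl) (step (inj₂ e′) w′)

  forget-walk⁺ : ∀ {x y} → OWalk T x y → OWalk (map (forget Y) T) (proj₁ x) (proj₁ y)
  forget-walk⁺ here              = here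
  forget-walk⁺ (step (inj₁ e) w) = step (inj₁ (∈ₚ.∈-map⁺ (forget Y) e)) (forget-walk⁺ w)
  forget-walk⁺ (step (inj₂ e) w) = step (inj₂ (∈ₚ.∈-map⁺ (forget Y) e)) (forget-walk⁺ w)

  forget-avoids : Avoids Y (map (forget Y) T)
  forget-avoids e with ∈ₚ.∈-map⁻ (forget Y) e
  ... | ((_ , p) , (_ , q)) , _ , refl = p , q

  count-forget : ∀ {k} → CompCount T k → CompCount (map (forget Y) T) (k ℕ.+ ∣ Y ∣)
  count-forget (r , inj , cover) = count-avoiding Y forget-avoids (proj₁ ∘ r) (proj₂ ∘ r)
    (λ i j w → inj i j (subst (OWalk T (r i)) (VMinus-≡ refl) (proj₂ (forget-walk⁻ w (proj₂ (r i))))))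
    (λ v o → let (i , w) = cover (v , o) in i , forget-walk⁺ w)

-- The deleted vertices are put back as isolated ones: the order and every component count rise by
-- `∣ Y ∣`, so the same edge sets are selected. All Whitney numbers are thus computed on `Fin n`
-- with one component count.
ordWhitney-minus : ∀ {n} (Γ : SimpleGraph n) (Y : Subset n)
  (cnt : List (Fin n × Fin n) → ℕ) → (∀ S → CompCount S (cnt S)) →
  (bY : List (VMinus Y × VMinus Y) → ℕ) → (∀ S → CompCount S (bY S)) → ∀ j →
  Ordinary.ordWhitney (n ∸ ∣ Y ∣) (edgesMinus Γ Y) bY j ≡ Ordinary.ordWhitney n (avoid Y (edgesOf Γ)) cnt j
ordWhitney-minus {n} Γ Y cnt isCnt bY isBY j = cong (sgn j *_) (sym (begin
  ∑ (sublists (avoid Y (edgesOf Γ))) f              ≡⟨ cong (λ L → ∑ (sublists L) f) (sym (map-forget Y (edgesOf Γ))) ⟩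
  ∑ (sublists (map (forget Y) (edgesMinus Γ Y))) f  ≡⟨ ∑-sublists-map (forget Y) (edgesMinus Γ Y) f ⟩
  ∑ (sublists (edgesMinus Γ Y)) (f ∘ map (forget Y)) ≡⟨ ∑-cong (sublists (edgesMinus Γ Y)) eq ⟩
  ∑ (sublists (edgesMinus Γ Y)) (λ S → when ((bY S ℕ.+ j) ≡ᵇ (n ∸ ∣ Y ∣)) (sgn (length S))) ∎))
  where
  open ≡-Reasoning
  f : List (Fin n × Fin n) → ℤ
  f T = when ((cnt T ℕ.+ j) ≡ᵇ n) (sgn (length T))
  swap : ∀ a b c → a ℕ.+ b ℕ.+ c ≡ a ℕ.+ c ℕ.+ b
  swap a b c = trans (ℕₚ.+-assoc a b c) (trans (cong (a ℕ.+_) (ℕₚ.+-comm b c)) (sym (ℕₚ.+-assoc a c b)))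
  eq : ∀ S → f (map (forget Y) S) ≡ when ((bY S ℕ.+ j) ≡ᵇ (n ∸ ∣ Y ∣)) (sgn (length S))
  eq S = cong₂ (λ b k → when b (sgn k))
    (trans (cong (λ k → (k ℕ.+ j) ≡ᵇ n) (count-≡ (isCnt (map (forget Y) S)) (count-forget Y (isBY S)) id id))
      (trans (cong (_≡ᵇ n) (swap (bY S) ∣ Y ∣ j)) (+-≡ᵇ-∸ (bY S ℕ.+ j) (∣p∣≤n Y))))
    (Listₚ.length-map (forget Y) S)

-- The coefficients of γ^j

*-*-zero : ∀ a b → a * (b * + 0) ≡ + 0
*-*-zero = solve-∀

-- The sums over `k` and over `Y` of size `k` merge into one sum over `Y`; the range of `k` survives
-- as a bound on `∣ Y ∣`.
coeff-collapse : ∀ {n} (Γ : SimpleGraph n) X (w : Subset n → ℕ → ℤ) i j →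
  coeff Γ X w i j ≡ ∑ (allSubsets n) (λ Y → when (stableOutsideᵇ Γ X Y) (when (∣ Y ∣ <ᵇ suc (i ∸ j))
    (sgn ∣ Y ∣ * (+ ((n ∸ j ∸ ∣ Y ∣) C (n ∸ i)) * w Y j))))
coeff-collapse {n} Γ X w i j = begin
  ∑ ks (λ k → sgn k * (+ a k * ∑ Ys (λ Y → when (s Y ∧ (∣ Y ∣ ≡ᵇ k)) (w Y j))))
    ≡⟨ ∑-cong ks inner ⟩
  ∑ ks (λ k → ∑ Ys (λ Y → when (s Y) (when (∣ Y ∣ ≡ᵇ k) (F Y k))))
    ≡⟨ ∑-swap ks Ys _ ⟩
  ∑ Ys (λ Y → ∑ ks (λ k → when (s Y) (when (∣ Y ∣ ≡ᵇ k) (F Y k))))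
    ≡⟨ ∑-cong Ys (λ Y → trans (∑-when ks (s Y) _) (cong (when (s Y)) (∑-upTo-δ (suc (i ∸ j)) ∣ Y ∣ (F Y)))) ⟩
  ∑ Ys (λ Y → when (s Y) (when (∣ Y ∣ <ᵇ suc (i ∸ j)) (F Y ∣ Y ∣))) ∎
  where
  open ≡-Reasoning
  ks = upTo (suc (i ∸ j))
  Ys = allSubsets n
  s  = stableOutsideᵇ Γ X
  a  = λ k → (n ∸ j ∸ k) C (n ∸ i)
  F : Subset n → ℕ → ℤ
  F Y k = sgn k * (+ a k * w Y j)
  inner : ∀ k → sgn k * (+ a k * ∑ Ys (λ Y → when (s Y ∧ (∣ Y ∣ ≡ᵇ k)) (w Y j)))
    ≡ ∑ Ys (λ Y → when (s Y) (when (∣ Y ∣ ≡ᵇ k) (F Y k)))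
  inner k = trans (cong (sgn k *_) (sym (∑-*ˡ Ys (+ a k) _))) (trans (sym (∑-*ˡ Ys (sgn k) _))
    (∑-cong Ys λ Y → trans (cong (sgn k *_) (when-*ˡ (s Y ∧ (∣ Y ∣ ≡ᵇ k)) (+ a k) (w Y j)))
      (trans (when-*ˡ (s Y ∧ (∣ Y ∣ ≡ᵇ k)) (sgn k) _) (when-∧ (s Y) (∣ Y ∣ ≡ᵇ k) (F Y k)))))

∸-<-∸ : ∀ {n i c y} → y ℕ.≤ c → c ℕ.≤ n → i ℕ.< (n ∸ c) ℕ.+ y → c ∸ y ℕ.< n ∸ i
∸-<-∸ {n} {i} {c} {y} y≤c c≤n lt = ℕₚ.m+n≤o⇒m≤o∸n (suc (c ∸ y)) (begin
  suc (c ∸ y) ℕ.+ i            ≡⟨ ℕₚ.+-suc (c ∸ y) i ⟨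
  (c ∸ y) ℕ.+ suc i            ≤⟨ ℕₚ.+-monoʳ-≤ (c ∸ y) lt ⟩
  (c ∸ y) ℕ.+ ((n ∸ c) ℕ.+ y)  ≡⟨ cong ((c ∸ y) ℕ.+_) (ℕₚ.+-comm (n ∸ c) y) ⟩
  (c ∸ y) ℕ.+ (y ℕ.+ (n ∸ c))  ≡⟨ ℕₚ.+-assoc (c ∸ y) y (n ∸ c) ⟨
  (c ∸ y) ℕ.+ y ℕ.+ (n ∸ c)    ≡⟨ cong (ℕ._+ (n ∸ c)) (ℕₚ.m∸n+n≡m y≤c) ⟩
  c ℕ.+ (n ∸ c)                ≡⟨ ℕₚ.m+[n∸m]≡n c≤n ⟩
  n                            ∎)
  where open ℕₚ.≤-Reasoning

-- Since `i + (n ∸ i) = n`, the exponents on both sides have the parity of `n + c + y`.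
sgn-balance : ∀ {n i c y} → y ℕ.≤ c → c ℕ.≤ n → i ℕ.≤ n →
  sgn i * sgn ((c ∸ y) ℕ.+ (n ∸ i)) ≡ sgn y * sgn (n ∸ c)
sgn-balance {n} {i} {c} {y} y≤c c≤n i≤n = begin
  sgn i * sgn (e ℕ.+ m)                ≡⟨ cong (sgn i *_) (sgn-+ e m) ⟩
  sgn i * (sgn e * sgn m)              ≡⟨ lemma₁ (sgn i) (sgn e) (sgn m) ⟩
  sgn e * (sgn i * sgn m)              ≡⟨ cong (sgn e *_) (trans (sym (sgn-+ i m)) (cong sgn n≡)) ⟩
  sgn e * sgn (e ℕ.+ (y ℕ.+ d))        ≡⟨ cong (sgn e *_) (trans (sgn-+ e (y ℕ.+ d)) (cong (sgn e *_) (sgn-+ y d))) ⟩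
  sgn e * (sgn e * (sgn y * sgn d))    ≡⟨ sym (ℤₚ.*-assoc (sgn e) (sgn e) _) ⟩
  sgn e * sgn e * (sgn y * sgn d)      ≡⟨ cong (_* (sgn y * sgn d)) (sgn-² e) ⟩
  + 1 * (sgn y * sgn d)                ≡⟨ ℤₚ.*-identityˡ _ ⟩
  sgn y * sgn d                        ∎
  where
  open ≡-Reasoning
  e = c ∸ y
  m = n ∸ i
  d = n ∸ c
  lemma₁ : ∀ a b c → a * (b * c) ≡ b * (a * c)
  lemma₁ = solve-∀
  n≡ : i ℕ.+ m ≡ e ℕ.+ (y ℕ.+ d)
  n≡ = trans (ℕₚ.m+[n∸m]≡n i≤n) (sym (trans (sym (ℕₚ.+-assoc e y d))
         (trans (cong (ℕ._+ d) (ℕₚ.m∸n+n≡m y≤c)) (ℕₚ.m+[n∸m]≡n c≤n))))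

-- For `T` with `c` components, so of rank `j = n ∸ c`, the bounds `j ≤ i` and `y ≤ i ∸ j` lose
-- nothing: beyond them `c ∸ y < n ∸ i` and the binomial coefficient vanishes. `g` stands for the
-- powers of the group order and `t` for the sign of `T`.
binv-collapse : ∀ {n i c y} t (g : ℕ → ℕ) → y ℕ.≤ c → c ℕ.≤ n → i ℕ.≤ n →
  sgn i * (t * (+ g (n ∸ c) * binv (n ∸ i) (c ∸ y))) ≡
  when ((n ∸ c) <ᵇ suc i) (+ g (n ∸ c) * when (y <ᵇ suc (i ∸ (n ∸ c)))
    (sgn y * (+ ((n ∸ (n ∸ c) ∸ y) C (n ∸ i)) * (sgn (n ∸ c) * t))))
binv-collapse {n} {i} {c} {y} t g y≤c c≤n i≤n = go ((n ∸ c) ℕ.≤? i) (y ℕ.≤? (i ∸ (n ∸ c)))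
  where
  open ≡-Reasoning
  d = n ∸ c
  B = (c ∸ y) C (n ∸ i)
  B′ = (n ∸ d ∸ y) C (n ∸ i)
  x = + g d
  lhs = sgn i * (t * (x * binv (n ∸ i) (c ∸ y)))
  rhs = λ (p q : Bool) → when p (x * when q (sgn y * (+ B′ * (sgn d * t))))
  vanish : i ℕ.< d ℕ.+ y → lhs ≡ + 0
  vanish lt = trans (cong (λ z → sgn i * (t * (x * (sgn ((c ∸ y) ℕ.+ (n ∸ i)) * + z)))) (k>n⇒nCk≡0 (∸-<-∸ y≤c c≤n lt)))
    (lemma (sgn i) t x (sgn ((c ∸ y) ℕ.+ (n ∸ i))))
    where
    lemma : ∀ a b c d → a * (b * (c * (d * + 0))) ≡ + 0
    lemma = solve-∀
  go : Dec (d ℕ.≤ i) → Dec (y ℕ.≤ i ∸ d) → lhs ≡ rhs (d <ᵇ suc i) (y <ᵇ suc (i ∸ d))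
  go (no d≰i) _ = trans (vanish (ℕₚ.≤-trans (ℕₚ.≰⇒> d≰i) (ℕₚ.m≤m+n d y)))
    (cong (λ b → rhs b (y <ᵇ suc (i ∸ d))) (sym (<ᵇ-false (ℕₚ.≰⇒> d≰i))))
  go (yes d≤i) (no y≰) = trans (vanish (ℕₚ.≤-trans
        (ℕₚ.≤-reflexive (trans (cong suc (sym (ℕₚ.m+[n∸m]≡n d≤i))) (sym (ℕₚ.+-suc d (i ∸ d)))))
        (ℕₚ.+-monoʳ-≤ d (ℕₚ.≰⇒> y≰))))
    (sym (trans (cong (rhs (d <ᵇ suc i)) (<ᵇ-false (ℕₚ.≰⇒> y≰)))
      (trans (cong (when (d <ᵇ suc i)) (ℤₚ.*-zeroʳ x)) (when-0 (d <ᵇ suc i)))))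
  go (yes d≤i) (yes y≤) = begin
    sgn i * (t * (x * (sgn ((c ∸ y) ℕ.+ (n ∸ i)) * + B)))
      ≡⟨ lemma₁ (sgn i) t x (sgn ((c ∸ y) ℕ.+ (n ∸ i))) (+ B) ⟩
    x * ((sgn i * sgn ((c ∸ y) ℕ.+ (n ∸ i))) * (+ B * t))
      ≡⟨ cong (λ z → x * (z * (+ B * t))) (sgn-balance y≤c c≤n i≤n) ⟩
    x * ((sgn y * sgn d) * (+ B * t))
      ≡⟨ lemma₂ x (sgn y) (sgn d) (+ B) t ⟩
    x * (sgn y * (+ B * (sgn d * t)))
      ≡⟨ cong (λ z → x * (sgn y * (+ ((z ∸ y) C (n ∸ i)) * (sgn d * t)))) (sym (ℕₚ.m∸[m∸n]≡n c≤n)) ⟩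
    x * (sgn y * (+ B′ * (sgn d * t)))
      ≡⟨ cong₂ rhs (sym (<ᵇ-true (ℕ.s≤s d≤i))) (sym (<ᵇ-true (ℕ.s≤s y≤))) ⟩
    rhs (d <ᵇ suc i) (y <ᵇ suc (i ∸ d)) ∎
    where
    lemma₁ : ∀ a t x b c → a * (t * (x * (b * c))) ≡ x * ((a * b) * (c * t))
    lemma₁ = solve-∀
    lemma₂ : ∀ x a b c t → x * ((a * b) * (c * t)) ≡ x * (a * (c * (b * t)))
    lemma₂ = solve-∀

C-pos : ∀ n k → k ℕ.≤ n → 0 ℕ.< n C k
C-pos n       zero    _          = subst (0 ℕ.<_) (sym (nC0≡1 n)) (ℕ.s≤s ℕ.z≤n)
C-pos (suc n) (suc k) (ℕ.s≤s le) = subst (0 ℕ.<_) (nCk+nC[k+1]≡[n+1]C[k+1] n k)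
  (ℕₚ.≤-trans (C-pos n k le) (ℕₚ.m≤m+n (n C k) (n C suc k)))

module Assembly {n : ℕ} (Γ : SimpleGraph n)
  (cnt : List (Fin n × Fin n) → ℕ) (isCnt : ∀ S → CompCount S (cnt S))
  (bY : (Y : Subset n) → List (VMinus Y × VMinus Y) → ℕ) (isBY : ∀ Y S → CompCount S (bY Y S))
  (X : Subset n) where

  open Positivity cnt isCnt
  open Ordinary using (ordWhitney)

  E = edgesOf Γ
  wΓ = ordWhitney n E cnt

  wY : Subset n → ℕ → ℤ
  wY Y = ordWhitney (n ∸ ∣ Y ∣) (edgesMinus Γ Y) (bY Y)

  A : ℕ → ℕ → ℤ
  A = coeff Γ X wY

  st : Subset n → Bool
  st = stableOutsideᵇ Γ X

  wY≡ : ∀ Y j → wY Y j ≡ ordWhitney n (avoid Y E) cnt j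
  wY≡ Y = ordWhitney-minus Γ Y cnt isCnt (bY Y) (isBY Y)

  cnt-[] : cnt [] ≡ n
  cnt-[] = count-≡ (isCnt []) (count-[] n) id id

  cnt≤n : ∀ T → cnt T ℕ.≤ n
  cnt≤n T = subst (cnt T ℕ.≤_) cnt-[] (cnt-anti (owalk-mono λ ()))

  avoid-sublist : ∀ Y {T} → T ∈ sublists (avoid Y E) → Avoids Y T
  avoid-sublist Y T∈ e = avoid-Avoids Y E (sublists-⊆ (avoid Y E) T∈ e)

  ∣Y∣≤cnt : ∀ Y {T} → Avoids Y T → ∣ Y ∣ ℕ.≤ cnt T
  ∣Y∣≤cnt Y {T} av = Finₚ.injective⇒≤ {f = component (isCnt T) ∘ elems Y} λ {i} {j} e →
    elems-injective Y i j (walk-inside Y av (component-≡⇒walk (isCnt T) e) (elems-∈ Y i))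

  -- Both sides equal `mid`, a sum over pairs of `Y` and `T`. On the right, `T` contributes only for
  -- `j = n ∸ cnt T`, which collapses the sum over `j`.
  formula : ∀ (g : ℕ → ℕ) i → i ℕ.≤ n →
    sgn i * ∑ (allSubsets n) (λ Y → when (noneInside Y E) (when (disjointOn X Y (allFin n))
        (∑ (sublists (avoid Y E)) (λ T → sgn (length T) * (+ g (n ∸ cnt T) * binv (n ∸ i) (cnt T ∸ ∣ Y ∣))))))
    ≡ sumTo i (λ j → + g j * A i j)
  formula g i i≤n = trans left (sym right)
    where
    open ≡-Reasoning
    Ys = allSubsets n
    js = upTo (suc i)
    Ts = λ Y → sublists (avoid Y E)
    F : Subset n → List (Fin n × Fin n) → ℕ → ℤ
    F Y T j = + g j * when (∣ Y ∣ <ᵇ suc (i ∸ j))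
                (sgn ∣ Y ∣ * (+ ((n ∸ j ∸ ∣ Y ∣) C (n ∸ i)) * (sgn j * sgn (length T))))
    mid = ∑ Ys (λ Y → when (st Y) (∑ (Ts Y) (λ T → when ((n ∸ cnt T) <ᵇ suc i) (F Y T (n ∸ cnt T)))))
    left : _ ≡ mid
    left = trans (sym (∑-*ˡ Ys (sgn i) _)) (∑-cong Ys λ Y →
      trans (cong (sgn i *_) (trans (sym (when-∧ (noneInside Y E) (disjointOn X Y (allFin n)) _))
                                    (cong (λ b → when b _) (sym (stable-split Γ X Y)))))
        (trans (when-*ˡ (st Y) (sgn i) _) (cong (when (st Y)) (trans (sym (∑-*ˡ (Ts Y) (sgn i) _))
          (∑-cong-∈ (Ts Y) λ T T∈ → binv-collapse (sgn (length T)) g (∣Y∣≤cnt Y (avoid-sublist Y T∈)) (cnt≤n T) i≤n)))))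
    push : ∀ s t (a x c e : ℤ) {B : Set} (L : List B) (p : B → Bool) (f : B → ℤ) →
      a * when s (when t (x * (c * (e * ∑ L (λ T → when (p T) (f T)))))) ≡
      when s (∑ L (λ T → when (p T) (a * when t (x * (c * (e * f T))))))
    push false t     a x c e L p f = ℤₚ.*-zeroʳ a
    push true  false a x c e L p f = trans (ℤₚ.*-zeroʳ a) (sym (∑-zero L λ T _ →
      trans (cong (when (p T)) (ℤₚ.*-zeroʳ a)) (when-0 (p T))))
    push true  true  a x c e L p f = trans (assoc₅ a x c e _) (trans (sym (∑-*ˡ L (a * x * c * e) _))
      (∑-cong L λ T → trans (when-*ˡ (p T) (a * x * c * e) (f T)) (cong (when (p T)) (sym (assoc₅ a x c e (f T))))))
      where
      assoc₅ : ∀ a x c e z → a * (x * (c * (e * z))) ≡ a * x * c * e * z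
      assoc₅ = solve-∀
    right : sumTo i (λ j → + g j * A i j) ≡ mid
    right = begin
      ∑ js (λ j → + g j * A i j)
        ≡⟨ ∑-cong js (λ j → trans (cong (+ g j *_) (coeff-collapse Γ X wY i j)) (sym (∑-*ˡ Ys (+ g j) _))) ⟩
      ∑ js (λ j → ∑ Ys (λ Y → + g j * when (st Y) (when (∣ Y ∣ <ᵇ suc (i ∸ j))
          (sgn ∣ Y ∣ * (+ ((n ∸ j ∸ ∣ Y ∣) C (n ∸ i)) * wY Y j)))))
        ≡⟨ ∑-cong js (λ j → ∑-cong Ys λ Y → trans
             (cong (λ w → + g j * when (st Y) (when (∣ Y ∣ <ᵇ suc (i ∸ j)) (sgn ∣ Y ∣ * (+ ((n ∸ j ∸ ∣ Y ∣) C (n ∸ i)) * w)))) (wY≡ Y j))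
             (push (st Y) (∣ Y ∣ <ᵇ suc (i ∸ j)) (+ g j) (sgn ∣ Y ∣) (+ ((n ∸ j ∸ ∣ Y ∣) C (n ∸ i))) (sgn j)
                   (Ts Y) (λ T → (cnt T ℕ.+ j) ≡ᵇ n) (λ T → sgn (length T)))) ⟩
      ∑ js (λ j → ∑ Ys (λ Y → when (st Y) (∑ (Ts Y) (λ T → when ((cnt T ℕ.+ j) ≡ᵇ n) (F Y T j)))))
        ≡⟨ ∑-swap js Ys _ ⟩
      ∑ Ys (λ Y → ∑ js (λ j → when (st Y) (∑ (Ts Y) (λ T → when ((cnt T ℕ.+ j) ≡ᵇ n) (F Y T j)))))
        ≡⟨ ∑-cong Ys (λ Y → trans (∑-when js (st Y) _) (cong (when (st Y)) (trans (∑-swap js (Ts Y) _)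
             (∑-cong (Ts Y) λ T → trans (∑-cong js λ j → cong (λ b → when b (F Y T j)) (solve-≡ᵇ T j))
               (∑-upTo-δ (suc i) (n ∸ cnt T) (F Y T)))))) ⟩
      mid ∎
      where
      ≡ᵇ-comm : ∀ a b → (a ≡ᵇ b) ≡ (b ≡ᵇ a)
      ≡ᵇ-comm zero    zero    = refl
      ≡ᵇ-comm zero    (suc b) = refl
      ≡ᵇ-comm (suc a) zero    = refl
      ≡ᵇ-comm (suc a) (suc b) = ≡ᵇ-comm a b
      solve-≡ᵇ : ∀ T j → (cnt T ℕ.+ j ≡ᵇ n) ≡ ((n ∸ cnt T) ≡ᵇ j)
      solve-≡ᵇ T j = trans (cong (_≡ᵇ n) (ℕₚ.+-comm (cnt T) j))
        (trans (+-≡ᵇ-∸ j (cnt≤n T)) (≡ᵇ-comm j (n ∸ cnt T)))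

  -- With nothing contracted, `relWhitney` is the ordinary Whitney number, and a simple graph has no
  -- loops, so `relWhitney-pos` applies.
  wΓ-nonzero : ∀ i → i ℕ.≤ n ∸ cnt E → wΓ i ≢ + 0
  wΓ-nonzero i le = λ e → ℤₚ.<-irrefl (sym (trans rel e)) (relWhitney-pos [] E i
      (λ e w → edge-irrefl Γ e (owalk-[] w))
      (subst₂ (λ L m → cnt L ℕ.+ i ℕ.≤ m) (sym (Listₚ.++-identityʳ E)) (sym cnt-[])
        (ℕₚ.≤-trans (ℕₚ.+-monoʳ-≤ (cnt E) le) (ℕₚ.≤-reflexive (ℕₚ.m+[n∸m]≡n (cnt≤n E))))))
    where
    rel : relWhitney [] E i ≡ wΓ i
    rel = cong (sgn i *_) (∑-cong (sublists E) λ T →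
      cong₂ (λ L m → when ((cnt L ℕ.+ i) ≡ᵇ m) (sgn (length T))) (Listₚ.++-identityʳ T) cnt-[])

  lookup-⊥ : ∀ (v : Fin n) → vlookup ⊥ v ≡ false
  lookup-⊥ v = Vecₚ.lookup-replicate v false

  -- For `j = i` the bound on `∣ Y ∣` leaves only the empty set, whose binomial coefficient is 1.
  diagonal : ∀ i → A i i ≡ wΓ i
  diagonal i = begin
    A i i
      ≡⟨ coeff-collapse Γ X wY i i ⟩
    ∑ (allSubsets n) (λ Y → when (st Y) (when (∣ Y ∣ <ᵇ suc (i ∸ i)) (sgn ∣ Y ∣ * (+ ((n ∸ i ∸ ∣ Y ∣) C (n ∸ i)) * wY Y i))))
      ≡⟨ ∑-cong (allSubsets n) (λ Y → only Y (Y ≟ˢ ⊥)) ⟩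
    ∑ (allSubsets n) (λ Y → when (does (Y ≟ˢ ⊥)) (wΓ i))
      ≡⟨ ∑-allSubsets-δ n ⊥ (λ _ → wΓ i) ⟩
    wΓ i ∎
    where
    open ≡-Reasoning
    none : ∀ {v} → vlookup ⊥ v ≡ true → ∀ {Z : Set} → Z
    none {v} e = contradiction (trans (sym e) (lookup-⊥ v)) true≢false
    only : ∀ Y → Dec (Y ≡ ⊥) →
      when (st Y) (when (∣ Y ∣ <ᵇ suc (i ∸ i)) (sgn ∣ Y ∣ * (+ ((n ∸ i ∸ ∣ Y ∣) C (n ∸ i)) * wY Y i))) ≡ when (does (Y ≟ˢ ⊥)) (wΓ i)
    only Y (no Y≢⊥) = trans
      (cong (λ b → when (st Y) (when b (sgn ∣ Y ∣ * (+ ((n ∸ i ∸ ∣ Y ∣) C (n ∸ i)) * wY Y i))))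
        (trans (cong (λ m → ∣ Y ∣ <ᵇ suc m) (ℕₚ.n∸n≡0 i)) (<ᵇ-false (ℕₚ.n≢0⇒n>0 (Y≢⊥ ∘ ∣Y∣≡0⇒⊥ Y)))))
      (trans (when-0 (st Y)) (cong (λ b → when b (wΓ i)) (sym (dec-false (Y ≟ˢ ⊥) Y≢⊥))))
    only .⊥ (yes refl) = begin
      when (st ⊥) (when (∣ ⊥ {n} ∣ <ᵇ suc (i ∸ i)) (f ∣ ⊥ {n} ∣))
        ≡⟨ cong₂ (λ b k → when b (when (k <ᵇ suc (i ∸ i)) (f k))) (stable⁺ Γ X ⊥ (λ e → none e) (λ e _ → none e)) (∣⊥∣≡0 n) ⟩
      + 1 * (+ ((n ∸ i) C (n ∸ i)) * wY ⊥ i)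
        ≡⟨ ℤₚ.*-identityˡ _ ⟩
      + ((n ∸ i) C (n ∸ i)) * wY ⊥ i
        ≡⟨ cong (λ k → + k * wY ⊥ i) (nCn≡1 (n ∸ i)) ⟩
      + 1 * wY ⊥ i
        ≡⟨ ℤₚ.*-identityˡ _ ⟩
      wY ⊥ i
        ≡⟨ wY≡ ⊥ i ⟩
      ordWhitney n (avoid ⊥ E) cnt i
        ≡⟨ cong (λ L → ordWhitney n L cnt i) (avoid-disjoint ⊥ E λ {x} {y} _ → lookup-⊥ x , lookup-⊥ y) ⟩
      wΓ i
        ≡⟨ cong (λ b → when b (wΓ i)) (sym (dec-true (⊥ {n} ≟ˢ ⊥) refl)) ⟩
      when (does (⊥ {n} ≟ˢ ⊥)) (wΓ i) ∎
      where
      f : ℕ → ℤ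
      f k = sgn k * (+ ((n ∸ i ∸ k) C (n ∸ i)) * wY ⊥ i)

  cnt-sublist : ∀ Y {T} → T ∈ sublists (avoid Y E) → cnt E ℕ.≤ cnt T
  cnt-sublist Y T∈ = cnt-anti (owalk-mono (avoid-⊆ Y E ∘ sublists-⊆ (avoid Y E) T∈))

  wY-zero : ∀ Y j → (∀ T → T ∈ sublists (avoid Y E) → n ℕ.< cnt T ℕ.+ j) → wY Y j ≡ + 0
  wY-zero Y j big = trans (wY≡ Y j) (trans (cong (sgn j *_) (∑-zero (sublists (avoid Y E)) λ T T∈ →
    cong (λ b → when b (sgn (length T))) (≡ᵇ-false (ℕₚ.>⇒≢ (big T T∈))))) (ℤₚ.*-zeroʳ (sgn j)))

  -- `wY Y j` sums over edge sets of rank `j`, and no subset of `E` has rank above `n ∸ cnt E`.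
  high-degree : ∀ i j → n ∸ cnt E ℕ.< j → A i j ≡ + 0
  high-degree i j lt = trans (coeff-collapse Γ X wY i j) (∑-zero (allSubsets n) λ Y _ →
    trans (cong (λ w → when (st Y) (when (∣ Y ∣ <ᵇ suc (i ∸ j)) (sgn ∣ Y ∣ * (+ ((n ∸ j ∸ ∣ Y ∣) C (n ∸ i)) * w))))
             (wY-zero Y j λ T T∈ → ℕₚ.≤-trans (n<cntE+j) (ℕₚ.+-monoˡ-≤ j (cnt-sublist Y T∈))))
      (trans (cong (λ z → when (st Y) (when (∣ Y ∣ <ᵇ suc (i ∸ j)) z)) (*-*-zero (sgn ∣ Y ∣) (+ ((n ∸ j ∸ ∣ Y ∣) C (n ∸ i)))))
        (trans (cong (when (st Y)) (when-0 (∣ Y ∣ <ᵇ suc (i ∸ j)))) (when-0 (st Y)))))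
    where
    n<cntE+j : n ℕ.< cnt E ℕ.+ j
    n<cntE+j = subst (ℕ._< cnt E ℕ.+ j) (ℕₚ.m+[n∸m]≡n (cnt≤n E)) (ℕₚ.+-monoʳ-< (cnt E) lt)

  private
    I  = isolated Γ X
    cc = cnt E
    j₀ = n ∸ cc

  ζ≤cc : ∣ I ∣ ℕ.≤ cc
  ζ≤cc = ∣isolated∣≤ Γ X (isCnt E)

  n∸j₀ : n ∸ j₀ ≡ cc
  n∸j₀ = ℕₚ.m∸[m∸n]≡n (cnt≤n E)

  -- Deleting a non-isolated vertex outside X lowers the rank.
  rank-drop : ∀ Y → st Y ≡ true → (Y ⊆ᵇ I) ≡ false → wY Y j₀ ≡ + 0
  rank-drop Y stable Y⊈I = wY-zero Y j₀ big
    where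
    open ℕₚ.≤-Reasoning
    v = proj₁ (⊆ᵇ-false Y I Y⊈I)
    v∈Y = proj₁ (proj₂ (⊆ᵇ-false Y I Y⊈I))
    v∉I = proj₂ (proj₂ (⊆ᵇ-false Y I Y⊈I))
    nb = isolated-false Γ X v∉I (proj₁ (stable⁻ Γ X Y stable) v∈Y)
    w = proj₁ nb
    vw : OWalk E v w
    vw = [ owalk-edge , owalk-sym ∘ owalk-edge ]′ (adj⇒edge Γ (proj₂ nb))
    -- The vertex `v` is isolated in `T`, so adding `vw` merges two components; yet the enlarged set
    -- still connects only vertices that `E` connects.
    big : ∀ T → T ∈ sublists (avoid Y E) → n ℕ.< cnt T ℕ.+ j₀
    big T T∈ = begin-strict
      n                               ≡⟨ ℕₚ.m+[n∸m]≡n (cnt≤n E) ⟨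
      cc ℕ.+ j₀                       <⟨ ℕₚ.n<1+n _ ⟩
      suc cc ℕ.+ j₀                   ≤⟨ ℕₚ.+-monoˡ-≤ j₀ (ℕ.s≤s (cnt-anti (owalk-bind into))) ⟩
      suc (cnt ((v , w) ∷ T)) ℕ.+ j₀  ≡⟨ cong (ℕ._+ j₀) (cnt-merge ¬vw) ⟨
      cnt T ℕ.+ j₀                    ∎
      where
      into : ∀ {x y} → (x , y) ∈ (v , w) ∷ T → OWalk E x y
      into (here refl) = vw
      into (there e)   = owalk-edge (avoid-⊆ Y E (sublists-⊆ (avoid Y E) T∈ e))
      ¬vw : ¬ OWalk T v w
      ¬vw p = true≢false (trans (sym (proj₂ nb))
        (subst (λ z → adj Γ v z ≡ false) (walk-inside Y (avoid-sublist Y T∈) p v∈Y) (irrefl Γ v)))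

  -- Sets `Y` not contained in `I` drop out by `rank-drop`. Those inside `I` leave every edge in
  -- place and share the factor `wΓ j₀`, so an alternating binomial sum over the subsets of `I`
  -- remains. It equals `C(c − ζ, n − i − ζ)`, which symmetry turns into `C(c − ζ, i − (n − c))`.
  leading : ∀ i → j₀ ℕ.≤ i → i ℕ.≤ n ∸ ∣ I ∣ → A i j₀ ≡ wΓ j₀ * + ((cc ∸ ∣ I ∣) C (i ∸ j₀))
  leading i j₀≤i i≤ = begin
    A i j₀
      ≡⟨ coeff-collapse Γ X wY i j₀ ⟩
    ∑ Ys (λ Y → when (st Y) (when (∣ Y ∣ <ᵇ suc (i ∸ j₀)) (sgn ∣ Y ∣ * (+ ((n ∸ j₀ ∸ ∣ Y ∣) C (n ∸ i)) * wY Y j₀))))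
      ≡⟨ ∑-cong Ys (λ Y → restrict Y (Y ⊆ᵇ I) refl) ⟩
    ∑ Ys (λ Y → when (Y ⊆ᵇ I) (wΓ j₀ * g ∣ Y ∣))
      ≡⟨ ∑-⊆ n I (λ k → wΓ j₀ * g k) ⟩
    ∑ (allSubsets ∣ I ∣) (λ Q → wΓ j₀ * g ∣ Q ∣)
      ≡⟨ ∑-*ˡ (allSubsets ∣ I ∣) (wΓ j₀) _ ⟩
    wΓ j₀ * ∑ (allSubsets ∣ I ∣) (λ Q → g ∣ Q ∣)
      ≡⟨ cong (wΓ j₀ *_) (∑-cong (allSubsets ∣ I ∣) λ Q → cong₂ (λ a b → sgn ∣ Q ∣ * + ((a ∸ ∣ Q ∣) C b)) (sym ζ+d) (sym ζ+m)) ⟩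
    wΓ j₀ * ∑ (allSubsets ∣ I ∣) (λ Q → sgn ∣ Q ∣ * + ((∣ I ∣ ℕ.+ d ∸ ∣ Q ∣) C (∣ I ∣ ℕ.+ m)))
      ≡⟨ cong (wΓ j₀ *_) (∑-alternating-C ∣ I ∣ d m) ⟩
    wΓ j₀ * + (d C m)
      ≡⟨ cong (λ k → wΓ j₀ * + k) symm ⟩
    wΓ j₀ * + (d C p) ∎
    where
    open ≡-Reasoning
    Ys = allSubsets n
    d = cc ∸ ∣ I ∣
    m = n ∸ i ∸ ∣ I ∣
    p = i ∸ j₀
    g : ℕ → ℤ
    g k = sgn k * + ((cc ∸ k) C (n ∸ i))
    ζ+d : ∣ I ∣ ℕ.+ d ≡ cc
    ζ+d = ℕₚ.m+[n∸m]≡n ζ≤cc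
    i+ζ≤n : i ℕ.+ ∣ I ∣ ℕ.≤ n
    i+ζ≤n = ℕₚ.≤-trans (ℕₚ.+-monoˡ-≤ ∣ I ∣ i≤) (ℕₚ.≤-reflexive (ℕₚ.m∸n+n≡m (∣p∣≤n I)))
    ζ+m : ∣ I ∣ ℕ.+ m ≡ n ∸ i
    ζ+m = ℕₚ.m+[n∸m]≡n (ℕₚ.m+n≤o⇒m≤o∸n ∣ I ∣ (subst (ℕ._≤ n) (ℕₚ.+-comm i ∣ I ∣) i+ζ≤n))
    p+m≡d : p ℕ.+ m ≡ d
    p+m≡d = ℕₚ.+-cancelʳ-≡ ∣ I ∣ (p ℕ.+ m) d (ℕₚ.+-cancelˡ-≡ j₀ _ _ (begin
      j₀ ℕ.+ (p ℕ.+ m ℕ.+ ∣ I ∣)    ≡⟨ cong (j₀ ℕ.+_) (trans (ℕₚ.+-assoc p m ∣ I ∣) (cong (p ℕ.+_) (trans (ℕₚ.+-comm m ∣ I ∣) ζ+m))) ⟩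
      j₀ ℕ.+ (p ℕ.+ (n ∸ i))        ≡⟨ ℕₚ.+-assoc j₀ p (n ∸ i) ⟨
      j₀ ℕ.+ p ℕ.+ (n ∸ i)          ≡⟨ cong (ℕ._+ (n ∸ i)) (ℕₚ.m+[n∸m]≡n j₀≤i) ⟩
      i ℕ.+ (n ∸ i)                 ≡⟨ ℕₚ.m+[n∸m]≡n (ℕₚ.≤-trans (ℕₚ.m≤m+n i ∣ I ∣) i+ζ≤n) ⟩
      n                             ≡⟨ ℕₚ.m∸n+n≡m (cnt≤n E) ⟨
      j₀ ℕ.+ cc                     ≡⟨ cong (j₀ ℕ.+_) (trans (sym ζ+d) (ℕₚ.+-comm ∣ I ∣ d)) ⟩
      j₀ ℕ.+ (d ℕ.+ ∣ I ∣)          ∎))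
    symm : d C m ≡ d C p
    symm = trans (nCk≡nC[n∸k] {m} {d} (subst (m ℕ.≤_) p+m≡d (ℕₚ.m≤n+m m p)))
      (cong (d C_) (trans (cong (_∸ m) (sym p+m≡d)) (ℕₚ.m+n∸n≡m p m)))
    restrict : ∀ Y b → (Y ⊆ᵇ I) ≡ b →
      when (st Y) (when (∣ Y ∣ <ᵇ suc p) (sgn ∣ Y ∣ * (+ ((n ∸ j₀ ∸ ∣ Y ∣) C (n ∸ i)) * wY Y j₀)))
      ≡ when b (wΓ j₀ * g ∣ Y ∣)
    restrict Y false Y⊈I = trans (when-cong (st Y) λ stable →
        trans (cong (λ w → when (∣ Y ∣ <ᵇ suc p) (sgn ∣ Y ∣ * (+ ((n ∸ j₀ ∸ ∣ Y ∣) C (n ∸ i)) * w))) (rank-drop Y stable Y⊈I))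
          (trans (cong (when (∣ Y ∣ <ᵇ suc p)) (*-*-zero (sgn ∣ Y ∣) (+ ((n ∸ j₀ ∸ ∣ Y ∣) C (n ∸ i))))) (when-0 (∣ Y ∣ <ᵇ suc p))))
      (when-0 (st Y))
    restrict Y true Y⊆I = begin
      when (st Y) (when (∣ Y ∣ <ᵇ suc p) (sgn ∣ Y ∣ * (+ ((n ∸ j₀ ∸ ∣ Y ∣) C (n ∸ i)) * wY Y j₀)))
        ≡⟨ cong (λ b → when b (when (∣ Y ∣ <ᵇ suc p) (sgn ∣ Y ∣ * (+ ((n ∸ j₀ ∸ ∣ Y ∣) C (n ∸ i)) * wY Y j₀)))) (⊆isolated⇒stable Γ X Y sub) ⟩
      when (∣ Y ∣ <ᵇ suc p) (sgn ∣ Y ∣ * (+ ((n ∸ j₀ ∸ ∣ Y ∣) C (n ∸ i)) * wY Y j₀))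
        ≡⟨ cong₂ (λ k w → when (∣ Y ∣ <ᵇ suc p) (sgn ∣ Y ∣ * (+ ((k ∸ ∣ Y ∣) C (n ∸ i)) * w))) n∸j₀
             (trans (wY≡ Y j₀) (cong (λ L → ordWhitney n L cnt j₀) (⊆isolated⇒avoid Γ X Y sub))) ⟩
      when (∣ Y ∣ <ᵇ suc p) (sgn ∣ Y ∣ * (+ ((cc ∸ ∣ Y ∣) C (n ∸ i)) * wΓ j₀))
        ≡⟨ cong (when (∣ Y ∣ <ᵇ suc p)) (lemma (sgn ∣ Y ∣) (+ ((cc ∸ ∣ Y ∣) C (n ∸ i))) (wΓ j₀)) ⟩
      when (∣ Y ∣ <ᵇ suc p) (wΓ j₀ * g ∣ Y ∣)
        ≡⟨ truncate (∣ Y ∣ ℕ.≤? p) ⟩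
      wΓ j₀ * g ∣ Y ∣ ∎
      where
      lemma : ∀ a b c → a * (b * c) ≡ c * (a * b)
      lemma = solve-∀
      sub = ⊆ᵇ-true Y I Y⊆I
      av : Avoids Y E
      av = subst (Avoids Y) (⊆isolated⇒avoid Γ X Y sub) (avoid-Avoids Y E)
      -- The bound can be lifted, because the binomial coefficient is zero for `∣ Y ∣ > p`; the sum
      -- then runs over all subsets of `I`.
      truncate : Dec (∣ Y ∣ ℕ.≤ p) → when (∣ Y ∣ <ᵇ suc p) (wΓ j₀ * g ∣ Y ∣) ≡ wΓ j₀ * g ∣ Y ∣
      truncate (yes le) = cong (λ b → when b (wΓ j₀ * g ∣ Y ∣)) (<ᵇ-true (ℕ.s≤s le))
      truncate (no nle) = trans (cong (λ b → when b (wΓ j₀ * g ∣ Y ∣)) (<ᵇ-false (ℕₚ.≰⇒> nle)))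
        (sym (trans (cong (λ k → wΓ j₀ * (sgn ∣ Y ∣ * + k)) (k>n⇒nCk≡0 (∸-<-∸ (∣Y∣≤cnt Y av) (cnt≤n E)
            (ℕₚ.≤-trans (ℕₚ.≤-reflexive (trans (cong suc (sym (ℕₚ.m+[n∸m]≡n j₀≤i))) (sym (ℕₚ.+-suc j₀ p))))
                        (ℕₚ.+-monoʳ-≤ j₀ (ℕₚ.≰⇒> nle))))))
          (*-*-zero (wΓ j₀) (sgn ∣ Y ∣))))

  -- The bound `i ≤ n − ζ` gives `i − (n − c) ≤ c − ζ`, so the binomial coefficient is positive.
  leading-nonzero : ∀ i → j₀ ℕ.≤ i → i ℕ.≤ n ∸ ∣ I ∣ → wΓ j₀ * + ((cc ∸ ∣ I ∣) C (i ∸ j₀)) ≢ + 0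
  leading-nonzero i j₀≤i i≤ e with ℤₚ.i*j≡0⇒i≡0∨j≡0 (wΓ j₀) e
  ... | inj₁ z = wΓ-nonzero j₀ ℕₚ.≤-refl z
  ... | inj₂ z = ℕₚ.<-irrefl (sym (ℤₚ.+-injective z)) (C-pos (cc ∸ ∣ I ∣) (i ∸ j₀) (begin
      i ∸ j₀                    ≤⟨ ℕₚ.∸-monoˡ-≤ j₀ i≤ ⟩
      n ∸ ∣ I ∣ ∸ j₀            ≡⟨ ℕₚ.∸-+-assoc n ∣ I ∣ j₀ ⟩
      n ∸ (∣ I ∣ ℕ.+ j₀)        ≡⟨ cong (n ∸_) (ℕₚ.+-comm ∣ I ∣ j₀) ⟩
      n ∸ (j₀ ℕ.+ ∣ I ∣)        ≡⟨ ℕₚ.∸-+-assoc n j₀ ∣ I ∣ ⟨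
      n ∸ j₀ ∸ ∣ I ∣            ≡⟨ cong (_∸ ∣ I ∣) n∸j₀ ⟩
      cc ∸ ∣ I ∣                ∎))
    where open ℕₚ.≤-Reasoning

-- Isolated vertices outside `X` and the vanishing range

module _ {c ℓ : Level} (G : Group c ℓ) {n γ : ℕ} (enum : Fin γ → Group.Carrier G) (Γ : SimpleGraph n) (X : Subset n) where

  open Gain G (Fin n)
  open Potentials G {n}
  open Expansion G {n} enum

  private
    Φ = expansionEdges G enum Γ X
    E = edgesOf Γ
    I = isolated Γ X

  expansion-link : ∀ {x y g} → link x y g ∈ Φ → (x , y) ∈ E
  expansion-link {x} {y} {g} p with ∈ₚ.∈-++⁻ (concatMap block E) (subst (link x y g ∈_) (expansionEdges-≡ Γ X) p)
  ... | inj₁ q with find (∈ₚ.∈-concatMap⁻ block {xs = E} q)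
  ...   | (u , v) , e , q′ with ∈ₚ.∈-map⁻ (lift u v) q′
  ...     | k , _ , refl = e
  expansion-link p | inj₂ q with find (∈ₚ.∈-concatMap⁻ _ {xs = allFin n} q)
  ...   | x , _ , q′ with vlookup X x
  expansion-link p | inj₂ q | x , _ , here () | true

  expansion-half : ∀ {x} → half x ∈ Φ → vlookup X x ≡ true
  expansion-half {x} p with ∈ₚ.∈-++⁻ (concatMap block E) (subst (half x ∈_) (expansionEdges-≡ Γ X) p)
  ... | inj₁ q with find (∈ₚ.∈-concatMap⁻ block {xs = E} q)
  ...   | (u , v) , e , q′ with ∈ₚ.∈-map⁻ (lift u v) q′
  ...     | k , _ , ()
  expansion-half p | inj₂ q with find (∈ₚ.∈-concatMap⁻ _ {xs = allFin n} q)
  ...   | x , _ , q′ with vlookup X x in e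
  expansion-half p | inj₂ q | x , _ , here refl | true = e

  module _ {S : List Edge} (S⊆Φ : ∀ {e} → e ∈ S → e ∈ Φ) where

    isolated-closed : ∀ {v w} → vlookup I v ≡ true → Walk S v w → v ≡ w
    isolated-closed i []            = refl
    isolated-closed i (fwd k p ∷ _) = contradiction (inj₁ (expansion-link (S⊆Φ (lookup⇒∈ k p)))) (isolated-edge Γ X i)
    isolated-closed i (bwd k p ∷ _) = contradiction (inj₂ (expansion-link (S⊆Φ (lookup⇒∈ k p)))) (isolated-edge Γ X i)

    isolated-balanced : ∀ {v} → vlookup I v ≡ true → BalancedComp S v
    isolated-balanced {v} i = noHalf , neutral
      where
      noHalf : ∀ w → Walk S v w → ¬ (half w ∈ S)
      noHalf w vw h with refl ← isolated-closed i vw =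
        true≢false (trans (sym (expansion-half (S⊆Φ h))) (proj₂ (isolated⁻ Γ X i)))
      neutral : ∀ w (Z : Walk S w w) → Walk S v w → IsCircle Z → Group._≈_ G (walkGain Z) (Group.ε G)
      neutral w []            vw (() , _)
      neutral w (fwd k p ∷ _) vw _ with refl ← isolated-closed i vw =
        contradiction (inj₁ (expansion-link (S⊆Φ (lookup⇒∈ k p)))) (isolated-edge Γ X i)
      neutral w (bwd k p ∷ _) vw _ with refl ← isolated-closed i vw =
        contradiction (inj₂ (expansion-link (S⊆Φ (lookup⇒∈ k p)))) (isolated-edge Γ X i)

    ζ≤balanced : ∀ {k} → BalCount S k → ∣ I ∣ ℕ.≤ k
    ζ≤balanced (r , _ , _ , cover) = Finₚ.injective⇒≤ {f = idx} λ {i} {j} e →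
      elems-injective I i j (trans (isolated-closed (elems-∈ I i) (path i))
        (trans (cong r e) (sym (isolated-closed (elems-∈ I j) (path j)))))
      where
      at = λ i → cover (elems I i) (isolated-balanced (elems-∈ I i))
      idx = λ i → proj₁ (at i)
      path = λ i → proj₂ (at i)

  -- Every vertex of `I` is a balanced component of each edge set of the expansion, so `b S ≥ ζ` and
  -- the value `n − i < ζ` is never attained.
  gainWhitney-vanish : (b : List Edge → ℕ) → (∀ S → BalCount S (b S)) → ∀ i → n ∸ ∣ I ∣ ℕ.< i →
    gainWhitney n Φ b i ≡ + 0
  gainWhitney-vanish b isB i lt = trans (cong (sgn i *_) (∑-zero (sublists Φ) λ S S∈ →
      cong (λ q → when q (sgn (length S))) (≡ᵇ-false (ℕₚ.>⇒≢ (ℕₚ.≤-trans n<ζ+i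
        (ℕₚ.+-monoˡ-≤ i (ζ≤balanced (sublists-⊆ Φ S∈) (isB S)))))))) (ℤₚ.*-zeroʳ (sgn i))
    where
    n<ζ+i : n ℕ.< ∣ I ∣ ℕ.+ i
    n<ζ+i = subst (ℕ._< ∣ I ∣ ℕ.+ i) (ℕₚ.m+[n∸m]≡n (∣p∣≤n I)) (ℕₚ.+-monoʳ-< ∣ I ∣ lt)

theorem2 :
    ∀ {c ℓ : Level} (n : ℕ) → 0 ℕ.< n → (Γ : SimpleGraph n) →
    -- cc = number of connected components of Γ
    (cc : ℕ) → Ordinary.CompCount (edgesOf Γ) cc →
    -- a finite group G of order γ > 0, its elements enumerated by Fin γ
    (G : Group c ℓ) → (γ : ℕ) → 0 ℕ.< γ → (enum : Fin γ → Group.Carrier G) →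
    (∀ a b → Group._≈_ G (enum a) (enum b) → a ≡ b) →
    (∀ g → ∃ λ k → Group._≈_ G (enum k) g) →
    (X : Subset n) →
    -- b-function of G·Γ^(X)
    (b : List (Gain.Edge G (Fin n)) → ℕ) →
    (∀ S → Gain.BalCount G (Fin n) S (b S)) →
    -- component-count functions of Γ and of the graphs Γ ∖ Y
    (bΓ : List (Fin n × Fin n) → ℕ) → (∀ S → Ordinary.CompCount S (bΓ S)) →
    (bY : (Y : Subset n) → List (VMinus Y × VMinus Y) → ℕ) →
    (∀ Y S → Ordinary.CompCount S (bY Y S)) →
    let ζ = zetaOf Γ X
        W : ℕ → ℤ
        W = Gain.gainWhitney G (Fin n) n (expansionEdges G enum Γ X) b
        wΓ : ℕ → ℤ
        wΓ = Ordinary.ordWhitney n (edgesOf Γ) bΓ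
        wY : Subset n → ℕ → ℤ
        wY Y = Ordinary.ordWhitney (n ∸ ∣ Y ∣) (edgesMinus Γ Y) (bY Y)
        A : ℕ → ℕ → ℤ
        A = coeff Γ X wY
    in
    -- the formula, for i ≤ n - ζ
    (∀ i → i ℕ.≤ n ∸ ζ → W i ≡ sumTo i (λ j → + (γ ^ j) * A i j)) ×
    -- vanishing for i > n - ζ
    (∀ i → n ∸ ζ ℕ.< i → W i ≡ + 0) ×
    -- degree i and leading term w̄_i(Γ) γ^i when i ≤ n - c
    (∀ i → i ℕ.≤ n ∸ cc → A i i ≡ wΓ i × A i i ≢ + 0) ×
    -- degree n - c and leading term w̄_{n-c}(Γ) C(c-ζ, i-(n-c)) γ^{n-c}
    -- when n - c ≤ i ≤ n - ζ
    (∀ i → n ∸ cc ℕ.≤ i → i ℕ.≤ n ∸ ζ →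
       (∀ j → n ∸ cc ℕ.< j → j ℕ.≤ i → A i j ≡ + 0) ×
       A i (n ∸ cc) ≡ wΓ (n ∸ cc) * + ((cc ∸ ζ) C (i ∸ (n ∸ cc))) ×
       A i (n ∸ cc) ≢ + 0)
theorem2 n _ Γ cc isCC G (suc γ) _ enum enum-inj enum-surj X b isB bΓ isBΓ bY isBY
  -- Component counts of the same edge set agree, so `cc` becomes `bΓ (edgesOf Γ)`, while `ζ`
  -- becomes the size of the subset `isolated Γ X`.
  rewrite count-≡ isCC (isBΓ (edgesOf Γ)) id id | ∣isolated∣ Γ X =
  (λ i i≤ → let i≤n = ℕₚ.≤-trans i≤ (ℕₚ.m∸n≤m n ∣ isolated Γ X ∣) in
     trans (gainWhitney-expansion Γ X b isB i i≤n) (formula (suc γ ^_) i i≤n)) ,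
  gainWhitney-vanish G enum Γ X b isB ,
  (λ i i≤ → diagonal i , λ e → wΓ-nonzero i i≤ (trans (sym (diagonal i)) e)) ,
  (λ i j₀≤i i≤ →
     (λ j j₀<j _ → high-degree i j j₀<j) ,
     leading i j₀≤i i≤ ,
     λ e → leading-nonzero i j₀≤i i≤ (trans (sym (leading i j₀≤i i≤)) e))
  where
  open Balanced G enum enum-inj enum-surj bΓ isBΓ
  open Assembly Γ bΓ isBΓ bY isBY X
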